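{- There is an algorithm that, given a deterministic Wheeler graph $W=(V,E)$ and an integer $k\ge 1$, computes the number of distinct $k$-mers contained in $W$ in total time $O((|V|+|E|)k)$.
   Context: A labeled graph has a finite vertex set $V$ and an edge set $E\subseteq V\times V\times\Sigma$, where $\Sigma$ is a finite alphabet totally ordered by $\prec$; an edge $(u,v,a)$ goes from $u$ to $v$ and has label $a$. A $k$-mer is a string $\alpha\in\Sigma^k$. The graph contains $\alpha$ if there is a walk $v_0,\dots,v_k$ with $(v_{i-1},v_i,\alpha[i])\in E$ for all $1\le i\le k$. The graph is deterministic if no two distinct outgoing edges of the same vertex have the same label. It is a Wheeler graph if there is a total ordering $<$ of the nodes (a Wheeler order) such that nodes with no incoming edges precede those with positive indegree, and for every pair of edges $(u,v,a),(u',v',a')$: (W1) $a\prec a'\Rightarrow v<v'$; (W2) $(a=a'\wedge u<u')\Rightarrow v\le v'$. The input Wheeler graph is given together with a Wheeler order of its nodes. Model of computation: Word RAM whose word size is large enough to hold the numbers handled, which are proportional to the maximum number of distinct $\ell$-mers in the graph over $1\le \ell\le k$, so that arithmetic operations on these numbers take constant time. -}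

module Defs where

open import Data.Bool.Base using (if_then_else_)
open import Data.Fin.Base as Fin using (Fin; toℕ; inject₁)
open import Data.List.Base using (List; []; _∷_; _++_; length; map; concatMap; head; drop)
open import Data.List.Membership.Propositional using (_∈_)
open import Data.List.Relation.Unary.AllPairs using (AllPairs)
open import Data.List.Relation.Unary.Unique.Propositional using (Unique)
open import Data.Maybe.Base using (Maybe; just; nothing; fromMaybe)
open import Data.Nat.Base
open import Data.Nat.Properties using (m^n≢0; _≟_)
open import Data.Product.Base using (Σ-syntax; ∃-syntax; _×_; _,_)
open import Data.Sum.Base using (_⊎_)
open import Data.Vec.Base using (Vec; lookup)
open import Function.Bundles using (_⇔_)
open import Level using (0ℓ)
open import Relation.Binary.Core using (Rel)
open import Relation.Binary.PropositionalEquality.Core using (_≡_)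
open import Relation.Binary.Structures using (IsStrictTotalOrder)
open import Relation.Nullary.Decidable.Core using (does)
open import Relation.Nullary.Negation.Core using (¬_)

-- The vertex set is Fin #V, in no particular order, and the alphabet is
-- Fin #Σ with its usual order. The edge set is a duplicate-free list.
record LabeledGraph : Set where
  field
    #V #Σ  : ℕ
  Vertex   = Fin #V
  Label    = Fin #Σ
  field
    edges  : List (Vertex × Vertex × Label)
    unique : Unique edges

  #E : ℕ
  #E = length edges

module _ (G : LabeledGraph) where
  open LabeledGraph G

  Contains : ∀ {k} → Vec Label k → Set
  Contains {k} α =
    Σ[ v ∈ (Fin (suc k) → Vertex) ]
      (∀ (i : Fin k) → (v (inject₁ i) , v (Fin.suc i) , lookup α i) ∈ edges)

  HasKmerCount : (k N : ℕ) → Set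
  HasKmerCount k N =
    Σ[ αs ∈ List (Vec Label k) ]
      Unique αs × (∀ α → α ∈ αs ⇔ Contains α) × length αs ≡ N

  Deterministic : Set
  Deterministic = ∀ {u v v′ a} →
    (u , v , a) ∈ edges → (u , v′ , a) ∈ edges → v ≡ v′

  HasIncoming : Vertex → Set
  HasIncoming v = ∃[ u ] ∃[ a ] (u , v , a) ∈ edges

  record IsWheelerOrder (_≺_ : Rel Vertex 0ℓ) : Set where
    field
      isStrictTotalOrder : IsStrictTotalOrder _≡_ _≺_
      sources-first : ∀ {u v} → ¬ HasIncoming u → HasIncoming v → u ≺ v
      W1 : ∀ {u v a u′ v′ a′} → (u , v , a) ∈ edges → (u′ , v′ , a′) ∈ edges →
           a Fin.< a′ → v ≺ v′
      W2 : ∀ {u v a u′ v′ a′} → (u , v , a) ∈ edges → (u′ , v′ , a′) ∈ edges →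
           a ≡ a′ → u ≺ u′ → v ≺ v′ ⊎ v ≡ v′

  Enumerates : List Vertex → Rel Vertex 0ℓ → Set
  Enumerates vs _≺_ = AllPairs _≺_ vs × (∀ v → v ∈ vs)

-- Registers and memory cells hold words, i.e. numbers below 2 ^ w; hence
-- the addressable memory has 2 ^ w cells.  The instruction set is a subset
-- of that of the usual word RAM (there are no bitwise operations), so an
-- upper bound on running time here also holds with more operations.

Register Address : Set
Register = ℕ
Address  = ℕ

data Op : Set where
  add sub mul div : Op

data Instr : Set where
  const   : Register → ℕ → Instr
  arith   : Op → (target left right : Register) → Instr
  load    : (target address : Register) → Instr
  store   : (address source : Register) → Instr
  jump    : ℕ → Instr
  jump-if-< : (left right : Register) → ℕ → Instr

Program : Set
Program = List Instr

record State : Set where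
  constructor state
  field
    pc  : ℕ
    reg : Register → ℕ
    mem : Address → ℕ

_[_≔_] : (ℕ → ℕ) → ℕ → ℕ → (ℕ → ℕ)
(f [ i ≔ x ]) j = if does (j ≟ i) then x else f j

nth : ∀ {A : Set} → List A → ℕ → Maybe A
nth xs i = head (drop i xs)

module WordRAM (w : ℕ) where

  wrap : ℕ → ℕ
  wrap x = _%_ x (2 ^ w) {{m^n≢0 2 w}}

  -- Results are taken modulo 2 ^ w; division by zero yields zero.
  ⟦_⟧ : Op → ℕ → ℕ → ℕ
  ⟦ add ⟧ x y       = wrap (x + y)
  ⟦ sub ⟧ x y       = wrap ((2 ^ w + x) ∸ y)
  ⟦ mul ⟧ x y       = wrap (x * y)
  ⟦ div ⟧ x zero    = 0
  ⟦ div ⟧ x (suc y) = wrap (x / suc y)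

  execute : Instr → State → State
  execute (const r c) (state pc reg mem) =
    state (suc pc) (reg [ r ≔ wrap c ]) mem
  execute (arith op r s t) (state pc reg mem) =
    state (suc pc) (reg [ r ≔ ⟦ op ⟧ (reg s) (reg t) ]) mem
  execute (load r s) (state pc reg mem) =
    state (suc pc) (reg [ r ≔ mem (reg s) ]) mem
  execute (store r s) (state pc reg mem) =
    state (suc pc) reg (mem [ reg r ≔ reg s ])
  execute (jump ℓ) (state pc reg mem) =
    state ℓ reg mem
  execute (jump-if-< r s ℓ) (state pc reg mem) =
    state (if reg r <ᵇ reg s then ℓ else suc pc) reg mem

  -- P ⊢ s ⇓[ t ] s′: from s, the program halts in s′ after exactly t
  -- instructions.  It halts when the program counter leaves the program.
  data _⊢_⇓[_]_ (P : Program) : State → ℕ → State → Set where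
    halt : ∀ {s} → nth P (State.pc s) ≡ nothing → P ⊢ s ⇓[ 0 ] s
    step : ∀ {s i t s′} → nth P (State.pc s) ≡ just i →
           P ⊢ execute i s ⇓[ t ] s′ → P ⊢ s ⇓[ suc t ] s′

  -- The input occupies the first memory cells; all else is zero.
  initial : List ℕ → State
  initial input = state 0 (λ _ → 0) (λ i → wrap (fromMaybe 0 (nth input i)))

-- The vertices in Wheeler order are listed first, then the edges, in the
-- arbitrary order in which they appear in the graph.
encode : (G : LabeledGraph) → List (LabeledGraph.Vertex G) → ℕ → List ℕ
encode G vs k =
  #V ∷ #E ∷ #Σ ∷ k ∷
  map toℕ vs ++ concatMap (λ (u , v , a) → toℕ u ∷ toℕ v ∷ toℕ a ∷ []) edges
  where open LabeledGraph G

-- Words can hold D times the input parameters and D times the number of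
-- distinct ℓ-mers for every 1 ≤ ℓ ≤ k.
WordsSuffice : (D w : ℕ) → LabeledGraph → ℕ → Set
WordsSuffice D w G k =
  D * (1 + #V + #E + #Σ + k) ≤ 2 ^ w ×
  (∀ ℓ N → 1 ≤ ℓ → ℓ ≤ k → HasKmerCount G ℓ N → D * N ≤ 2 ^ w)
  where open LabeledGraph G

-- The program stops within T steps on a w-bit word RAM, leaving the number
-- of distinct k-mers in register 0.
CountsKmersWithin : (T w : ℕ) → Program →
                    (G : LabeledGraph) → List (LabeledGraph.Vertex G) → ℕ → Set
CountsKmersWithin T w P G vs k =
  ∃[ t ] ∃[ s ] t ≤ T × P ⊢ initial (encode G vs k) ⇓[ t ] s ×
                HasKmerCount G k (State.reg s 0)
  where open WordRAM w

{-# OPTIONS --safe #-}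
module Submission where

-- List the words of length ℓ occurring in W in colexicographic order. By W1, W2
-- and determinism the words reaching a vertex v have consecutive indices
-- [F v, L v), and for u ≺ v these blocks share at most the last index of u.
-- Sorting the edges by target and then by source also sorts them by label and
-- then by source, so one scan of the sorted edges enumerates the words of length
-- ℓ + 1 in order: an edge (u , v , a) adds the words αa with α in the block of u
-- to the block of v, and only the first of them can be old, namely when F u lies
-- below the end of the last block scanned with label a. The edges are sorted
-- beforehand by two stable bucket sorts along the Wheeler order; afterwards each
-- of the k scans takes O(|V| + |E|) steps. The program is compiled from a structured
-- language with exact arithmetic, which the machine simulates as long as all
-- numbers are below 2 ^ w; the ranks are, by the hypothesis on word length.

open import Defs
open import Data.Bool.Base using (Bool; true; false; if_then_else_; not; _∧_; _∨_; T)
open import Data.Bool.Properties using (T-∧; T-≡; T-not-≡; ∨-conicalˡ; ∨-conicalʳ)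
open import Data.Empty using (⊥; ⊥-elim)
open import Data.Fin.Base as Fin using (Fin; toℕ)
import Data.Fin.Properties as Fin
open import Data.List.Base
  using (List; []; _∷_; _++_; length; map; take; drop; foldl; concatMap; filter)
open import Data.List.Membership.Propositional using (_∈_)
open import Data.List.Membership.Propositional.Properties
  using (∈-++⁺ˡ; ∈-++⁺ʳ; ∈-++⁻; ∈-map⁺; ∈-map⁻; ∈-filter⁺; ∈-filter⁻; ∈-∃++; ∈-allFin)
open import Data.List.Properties
  using (length-++; length-map; length-take; length-drop; length-tabulate; length-filter;
         ++-assoc; ++-identityʳ; foldl-++; concatMap-++; take-all; drop-all; take++drop≡id)
open import Data.List.Relation.Unary.All as All using (All; []; _∷_)
import Data.List.Relation.Unary.All.Properties as All
open import Data.List.Relation.Unary.AllPairs as AllPairs using (AllPairs; []; _∷_)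
import Data.List.Relation.Unary.AllPairs.Properties as AllPairs
open import Data.List.Relation.Unary.Any using (here; there)
open import Data.List.Relation.Unary.Unique.Propositional using (Unique)
import Data.List.Relation.Unary.Unique.Propositional.Properties as Unique
open import Data.Maybe.Base using (just; nothing; fromMaybe)
open import Data.Maybe.Properties using (just-injective)
open import Data.Nat.Base
open import Data.Nat.DivMod using (m<n⇒m%n≡m; m%n<n; [m+n]%n≡m%n)
open import Data.Nat.Properties
open import Data.Nat.Tactic.RingSolver using (solve-∀)
open import Data.Product.Base using (Σ-syntax; ∃-syntax; _×_; _,_; proj₁; proj₂)
open import Data.Sum.Base using (_⊎_; inj₁; inj₂)
open import Data.Unit.Base using (⊤; tt)
open import Data.Vec.Base using (Vec; []; _∷_; _∷ʳ_; reverse; lookup)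
open import Data.Vec.Properties
  using (∷-injectiveʳ; reverse-∷; reverse-involutive; reverse-injective)
open import Function.Bundles using (Equivalence; mk⇔)
open import Level using (0ℓ)
open import Relation.Binary.Core using (Rel)
open import Relation.Binary.Definitions using (DecidableEquality; tri<; tri≈; tri>)
open import Relation.Binary.PropositionalEquality
open import Relation.Binary.Structures using (IsStrictTotalOrder)
open import Relation.Nullary.Decidable.Core using (yes; no)
open import Relation.Nullary.Negation.Core using (¬_)

-- A structured language and its compiler

-- The obstacle is to recognise repeated words in constant time per edge, without comparing words.
-- Edges labelled `a` are met in the order of their sources, and a later block begins at or after
-- the last index of an earlier one. So the ends of the blocks extended by `a` never decrease, and a
-- single number, the latest end, separates the indices already extended by `a` from the others. If
-- the block of `u` begins below it, only its first word is repeated, and the extension of that word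
-- is the last word found so far: stepping back by one index is enough. The colexicographic order
-- itself is never formalised. A duplicate-free list of words, an interval of indices for each
-- vertex and the bound on overlaps form an invariant strong enough to reproduce itself. Counts
-- never decrease during a scan, so they stay below the final count, which is the number of distinct
-- words of some length between 1 and `k`; this is how the hypothesis on word length reaches every
-- rank.

≡ᵇ-refl : ∀ n → (n ≡ᵇ n) ≡ true
≡ᵇ-refl zero    = refl
≡ᵇ-refl (suc n) = ≡ᵇ-refl n

≢⇒≡ᵇ : ∀ {m n} → m ≢ n → (m ≡ᵇ n) ≡ false
≢⇒≡ᵇ {m} {n} m≢n with m ≡ᵇ n in eq
... | false = refl
... | true  = ⊥-elim (m≢n (≡ᵇ⇒≡ m n (subst T (sym eq) tt)))

<⇒<ᵇ≡true : ∀ {m n} → m < n → (m <ᵇ n) ≡ true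
<⇒<ᵇ≡true m<n = Equivalence.to T-≡ (<⇒<ᵇ m<n)

≥⇒<ᵇ≡false : ∀ {m n} → n ≤ m → (m <ᵇ n) ≡ false
≥⇒<ᵇ≡false {m} {n} n≤m with m <ᵇ n in eq
... | false = refl
... | true  = ⊥-elim (<⇒≱ (<ᵇ⇒< m n (subst T (sym eq) tt)) n≤m)

≔-same : ∀ f i x → (f [ i ≔ x ]) i ≡ x
≔-same f i x rewrite ≡ᵇ-refl i = refl

≔-other : ∀ f {i j} x → j ≢ i → (f [ i ≔ x ]) j ≡ f j
≔-other f x j≢i rewrite ≢⇒≡ᵇ j≢i = refl

≔-pred : ∀ (Q : ℕ → Set) f i {x} → (∀ j → Q (f j)) → Q x → ∀ j → Q ((f [ i ≔ x ]) j)
≔-pred Q f i q qx j with j ≡ᵇ i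
... | true  = qx
... | false = q j

-- Fields are unbounded arrays; the input is a further, read-only array.

Var Field : Set
Var   = ℕ
Field = ℕ

infix  8 _:=#_ _:=_⊕_ _:=_⊖_ _:=in_ _:=_⟨_⟩ _⟨_⟩:=_
infixr 6 _⨾_
infix  7 IF_<_THEN_ELSE_ FOR_<_DO_

data Cmd : Set where
  skip            : Cmd
  _:=#_           : Var → ℕ → Cmd
  _:=_⊕_ _:=_⊖_   : Var → Var → Var → Cmd
  _:=in_          : Var → Var → Cmd
  _:=_⟨_⟩         : Var → Field → Var → Cmd
  _⟨_⟩:=_         : Field → Var → Var → Cmd
  _⨾_             : Cmd → Cmd → Cmd
  IF_<_THEN_ELSE_ : Var → Var → Cmd → Cmd → Cmd
  FOR_<_DO_       : Var → Var → Cmd → Cmd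

record Store : Set where
  constructor ⟪_,_⟫
  field
    env : Var → ℕ
    arr : Field → ℕ → ℕ
open Store public

emptyStore : Store
emptyStore = ⟪ (λ _ → 0) , (λ _ _ → 0) ⟫

_⟦_≔_⟧ : Store → Var → ℕ → Store
σ ⟦ x ≔ n ⟧ = ⟪ env σ [ x ≔ n ] , arr σ ⟫

writeField : (Field → ℕ → ℕ) → Field → ℕ → ℕ → Field → ℕ → ℕ
writeField a f i n g = if g ≡ᵇ f then a g [ i ≔ n ] else a g

iterate : ℕ → (ℕ → Store → Store) → Store → Store
iterate zero    f σ = σ
iterate (suc n) f σ = f n (iterate n f σ)

sumBelow : ℕ → (ℕ → ℕ) → ℕ
sumBelow zero    f = 0
sumBelow (suc n) f = sumBelow n f + f n

-- A Boolean, so that for a concrete command the frame conditions `assigns c x ≡ false` hold by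
-- `refl`; likewise for `writes`.
assigns : Cmd → Var → Bool
assigns (x :=# _)                 y = y ≡ᵇ x
assigns (x := _ ⊕ _)              y = y ≡ᵇ x
assigns (x := _ ⊖ _)              y = y ≡ᵇ x
assigns (x :=in _)                y = y ≡ᵇ x
assigns (x := _ ⟨ _ ⟩)            y = y ≡ᵇ x
assigns (c ⨾ d)                   y = assigns c y ∨ assigns d y
assigns (IF _ < _ THEN c ELSE d)  y = assigns c y ∨ assigns d y
assigns (FOR x < _ DO c)          y = (y ≡ᵇ x) ∨ assigns c y
assigns _                         y = false

writes : Cmd → Field → Bool
writes (f ⟨ _ ⟩:= _)             g = g ≡ᵇ f
writes (c ⨾ d)                   g = writes c g ∨ writes d g
writes (IF _ < _ THEN c ELSE d)  g = writes c g ∨ writes d g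
writes (FOR _ < _ DO c)          g = writes c g
writes _                         g = false

-- K is the number of fields. Entry i of field f is kept in cell
-- (i * K + f) + B, where register 2 holds B, the length of the input. Registers
-- 0 and 1 are scratch, and variable x lives in register 3 + x.
module Compiler (K : ℕ) where

  -- Independent of the offset: a jump over a subcommand needs the length of its code before that
  -- code has been placed.
  size : Cmd → ℕ
  size skip                     = 0
  size (_ :=# _)                = 1
  size (_ := _ ⊕ _)             = 1
  size (_ := _ ⊖ _)             = 1
  size (_ :=in _)               = 1
  size (_ := _ ⟨ _ ⟩)           = 6
  size (_ ⟨ _ ⟩:= _)            = 6
  size (c ⨾ d)                  = size c + size d
  size (IF _ < _ THEN c ELSE d) = 2 + size d + size c
  size (FOR _ < _ DO c)         = 6 + size c

  fieldAddress : Field → Var → List Instr → List Instr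
  fieldAddress f y is =
    const 0 K ∷ arith mul 0 (3 + y) 0 ∷ const 1 f ∷ arith add 0 0 1 ∷ arith add 0 0 2 ∷ is

  code : ℕ → Cmd → List Instr
  code o skip            = []
  code o (x :=# n)       = const (3 + x) n ∷ []
  code o (x := y ⊕ z)    = arith add (3 + x) (3 + y) (3 + z) ∷ []
  code o (x := y ⊖ z)    = arith sub (3 + x) (3 + y) (3 + z) ∷ []
  code o (x :=in y)      = load (3 + x) (3 + y) ∷ []
  code o (x := f ⟨ y ⟩)  = fieldAddress f y (load (3 + x) 0 ∷ [])
  code o (f ⟨ y ⟩:= x)   = fieldAddress f y (store 0 (3 + x) ∷ [])
  code o (c ⨾ d)         = code o c ++ code (size c + o) d
  -- The machine jumps when the comparison holds, so the `ELSE` branch falls through and comes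
  -- first; it alone pays for a second jump, over the other branch.
  code o (IF x < y THEN c ELSE d) =
    jump-if-< (3 + x) (3 + y) (2 + size d + o) ∷
    code (suc o) d ++ jump (2 + size d + size c + o) ∷ code (2 + size d + o) c
  -- The only conditional jump is on success, so the test jumps over the exit jump into the body.
  code o (FOR x < y DO c) =
    const (3 + x) 0 ∷ jump-if-< (3 + x) (3 + y) (3 + o) ∷ jump (6 + size c + o) ∷
    code (3 + o) c ++ const 0 1 ∷ arith add (3 + x) (3 + x) 0 ∷ jump (suc o) ∷ []

  length-code : ∀ o c → length (code o c) ≡ size c
  length-code o skip            = refl
  length-code o (x :=# n)       = refl
  length-code o (x := y ⊕ z)    = refl
  length-code o (x := y ⊖ z)    = refl
  length-code o (x :=in y)      = refl
  length-code o (x := f ⟨ y ⟩)  = refl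
  length-code o (f ⟨ y ⟩:= x)   = refl
  length-code o (c ⨾ d)
    rewrite length-++ (code o c) {code (size c + o) d}
          | length-code o c | length-code (size c + o) d = refl
  length-code o (IF x < y THEN c ELSE d)
    rewrite length-++ (code (suc o) d) {jump (2 + size d + size c + o) ∷ code (2 + size d + o) c}
          | length-code (suc o) d | length-code (2 + size d + o) c | +-suc (size d) (size c) = refl
  length-code o (FOR x < y DO c)
    rewrite length-++ (code (3 + o) c) {const 0 1 ∷ arith add (3 + x) (3 + x) 0 ∷ jump (suc o) ∷ []}
          | length-code (3 + o) c | +-comm (size c) 3 = refl

  -- The machine compares the counter with the bound anew in each iteration, whereas the semantics
  -- fixes the number of iterations at the start; they agree because the body changes neither. The
  -- bound on `f` keeps the interleaved fields apart.
  wf : Cmd → Bool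
  wf (_ := f ⟨ _ ⟩)           = f <ᵇ K
  wf (f ⟨ _ ⟩:= _)            = f <ᵇ K
  wf (c ⨾ d)                  = wf c ∧ wf d
  wf (IF _ < _ THEN c ELSE d) = wf c ∧ wf d
  wf (FOR x < y DO c)         =
    not (assigns c x) ∧ not (assigns c y) ∧ not (y ≡ᵇ x) ∧ wf c
  wf _                        = true

-- Semantics, cost and frame conditions of commands

module Semantics (input : ℕ → ℕ) where

  run : Cmd → Store → Store
  run skip            σ = σ
  run (x :=# n)       σ = σ ⟦ x ≔ n ⟧
  run (x := y ⊕ z)    σ = σ ⟦ x ≔ env σ y + env σ z ⟧
  run (x := y ⊖ z)    σ = σ ⟦ x ≔ env σ y ∸ env σ z ⟧
  run (x :=in y)      σ = σ ⟦ x ≔ input (env σ y) ⟧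
  run (x := f ⟨ y ⟩)  σ = σ ⟦ x ≔ arr σ f (env σ y) ⟧
  run (f ⟨ y ⟩:= x)   σ = ⟪ env σ , writeField (arr σ) f (env σ y) (env σ x) ⟫
  run (c ⨾ d)         σ = run d (run c σ)
  run (IF x < y THEN c ELSE d) σ = if env σ x <ᵇ env σ y then run c σ else run d σ
  run (FOR x < y DO c) σ =
    iterate (env σ y) (λ i τ → run c (τ ⟦ x ≔ i ⟧)) σ ⟦ x ≔ env σ y ⟧

  iter : Cmd → Var → ℕ → Store → Store
  iter c x n = iterate n (λ i τ → run c (τ ⟦ x ≔ i ⟧))

  cost : Cmd → Store → ℕ
  cost skip            σ = 0
  cost (x :=# n)       σ = 1
  cost (x := y ⊕ z)    σ = 1
  cost (x := y ⊖ z)    σ = 1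
  cost (x :=in y)      σ = 1
  cost (x := f ⟨ y ⟩)  σ = 6
  cost (f ⟨ y ⟩:= x)   σ = 6
  cost (c ⨾ d)         σ = cost c σ + cost d (run c σ)
  cost (IF x < y THEN c ELSE d) σ =
    if env σ x <ᵇ env σ y then 1 + cost c σ else 2 + cost d σ
  -- Initialisation, last test and exit jump cost 3; each iteration costs 4 for its test, the two
  -- instructions of the increment and the jump back.
  cost (FOR x < y DO c) σ =
    3 + sumBelow (env σ y) (λ i → 4 + cost c (iter c x i σ ⟦ x ≔ i ⟧))

  -- No subtraction is truncated, and no access leaves the input (B cells), the
  -- fields (M entries each) or the words (numbers below W).
  Ok : (B M W : ℕ) → Cmd → Store → Set
  Ok B M W = ok where
    ok : Cmd → Store → Set
    ok skip            σ = ⊤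
    ok (x :=# n)       σ = n < W
    ok (x := y ⊕ z)    σ = env σ y + env σ z < W
    ok (x := y ⊖ z)    σ = env σ z ≤ env σ y
    ok (x :=in y)      σ = env σ y < B
    ok (x := f ⟨ y ⟩)  σ = env σ y < M
    ok (f ⟨ y ⟩:= x)   σ = env σ y < M
    ok (c ⨾ d)         σ = ok c σ × ok d (run c σ)
    ok (IF x < y THEN c ELSE d) σ = if env σ x <ᵇ env σ y then ok c σ else ok d σ
    ok (FOR x < y DO c) σ = ∀ i → i < env σ y → ok c (iter c x i σ ⟦ x ≔ i ⟧)

  run-env : ∀ c σ y → assigns c y ≡ false → env (run c σ) y ≡ env σ y
  iter-env : ∀ c x n σ y → (y ≡ᵇ x) ≡ false → assigns c y ≡ false →
             env (iter c x n σ) y ≡ env σ y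
  run-env skip            σ y p = refl
  run-env (x :=# n)       σ y p rewrite p = refl
  run-env (x := _ ⊕ _)    σ y p rewrite p = refl
  run-env (x := _ ⊖ _)    σ y p rewrite p = refl
  run-env (x :=in _)      σ y p rewrite p = refl
  run-env (x := f ⟨ _ ⟩)  σ y p rewrite p = refl
  run-env (f ⟨ _ ⟩:= x)   σ y p = refl
  run-env (c ⨾ d)         σ y p =
    trans (run-env d _ y (∨-conicalʳ (assigns c y) _ p)) (run-env c σ y (∨-conicalˡ _ _ p))
  run-env (IF x < z THEN c ELSE d) σ y p with env σ x <ᵇ env σ z
  ... | true  = run-env c σ y (∨-conicalˡ _ _ p)
  ... | false = run-env d σ y (∨-conicalʳ (assigns c y) _ p)
  run-env (FOR x < z DO c) σ y p rewrite ∨-conicalˡ (y ≡ᵇ x) _ p =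
    iter-env c x (env σ z) σ y (∨-conicalˡ (y ≡ᵇ x) _ p) (∨-conicalʳ (y ≡ᵇ x) _ p)

  iter-env c x zero    σ y q p = refl
  iter-env c x (suc n) σ y q p rewrite run-env c (iter c x n σ ⟦ x ≔ n ⟧) y p | q =
    iter-env c x n σ y q p

  run-arr : ∀ c σ g → writes c g ≡ false → arr (run c σ) g ≡ arr σ g
  iter-arr : ∀ c x n σ g → writes c g ≡ false → arr (iter c x n σ) g ≡ arr σ g
  run-arr skip            σ g p = refl
  run-arr (x :=# n)       σ g p = refl
  run-arr (x := _ ⊕ _)    σ g p = refl
  run-arr (x := _ ⊖ _)    σ g p = refl
  run-arr (x :=in _)      σ g p = refl
  run-arr (x := f ⟨ _ ⟩)  σ g p = refl
  run-arr (f ⟨ _ ⟩:= x)   σ g p rewrite p = refl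
  run-arr (c ⨾ d)         σ g p =
    trans (run-arr d _ g (∨-conicalʳ (writes c g) _ p)) (run-arr c σ g (∨-conicalˡ _ _ p))
  run-arr (IF x < z THEN c ELSE d) σ g p with env σ x <ᵇ env σ z
  ... | true  = run-arr c σ g (∨-conicalˡ _ _ p)
  ... | false = run-arr d σ g (∨-conicalʳ (writes c g) _ p)
  run-arr (FOR x < z DO c) σ g p = iter-arr c x (env σ z) σ g p

  iter-arr c x zero    σ g p = refl
  iter-arr c x (suc n) σ g p = trans (run-arr c _ g p) (iter-arr c x n σ g p)

-- Simulation of commands on the machine

CodeAt : Program → ℕ → List Instr → Set
CodeAt P o []       = ⊤
CodeAt P o (i ∷ is) = nth P o ≡ just i × CodeAt P (suc o) is

codeAt-++ : ∀ P o is js → CodeAt P o (is ++ js) →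
            CodeAt P o is × CodeAt P (length is + o) js
codeAt-++ P o []       js p       = tt , p
codeAt-++ P o (i ∷ is) js (e , p) with codeAt-++ P (suc o) is js p
... | p₁ , p₂ = (e , p₁) , subst (λ n → CodeAt P n js) (+-suc (length is) o) p₂

nth-length-++ : ∀ {A : Set} (xs : List A) {y ys} → nth (xs ++ y ∷ ys) (length xs) ≡ just y
nth-length-++ []       = refl
nth-length-++ (x ∷ xs) = nth-length-++ xs

nth-beyond : ∀ {A : Set} (xs : List A) → nth xs (length xs) ≡ nothing
nth-beyond []       = refl
nth-beyond (x ∷ xs) = nth-beyond xs

codeAt-suffix : ∀ js is → CodeAt (js ++ is) (length js) is
codeAt-suffix js []       = tt
codeAt-suffix js (i ∷ is) = nth-length-++ js , subst₂ (λ P n → CodeAt P n is)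
  (++-assoc js (i ∷ []) is)
  (trans (length-++ js) (+-comm (length js) 1)) (codeAt-suffix (js ++ i ∷ []) is)

module Simulation
  (w K B M : ℕ) (input : ℕ → ℕ) (input<2^w : ∀ i → input i < 2 ^ w)
  (memory-fits : M * K + B ≤ 2 ^ w) (K<2^w : K < 2 ^ w) (1<2^w : 1 < 2 ^ w) where

  open WordRAM w
  open Compiler K
  open Semantics input

  private
    W = 2 ^ w

    instance
      W≢0 : NonZero W
      W≢0 = m^n≢0 2 w

  wrap-small : ∀ {n} → n < W → wrap n ≡ n
  wrap-small n<W = m<n⇒m%n≡m n<W

  wrap-∸ : ∀ {m n} → n ≤ m → m < W → wrap ((W + m) ∸ n) ≡ m ∸ n
  wrap-∸ {m} {n} n≤m m<W = begin
    wrap ((W + m) ∸ n) ≡⟨ cong wrap (+-∸-assoc W n≤m) ⟩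
    wrap (W + (m ∸ n)) ≡⟨ cong wrap (+-comm W (m ∸ n)) ⟩
    wrap (m ∸ n + W)   ≡⟨ [m+n]%n≡m%n (m ∸ n) W ⟩
    wrap (m ∸ n)       ≡⟨ wrap-small (≤-<-trans (m∸n≤m m n) m<W) ⟩
    m ∸ n              ∎
    where open ≡-Reasoning

  -- In contrast to `_⊢_⇓[_]_` the last state need not halt, so the runs of consecutive pieces of
  -- code compose.
  data Steps (P : Program) : State → ℕ → State → Set where
    done : ∀ {s} → Steps P s 0 s
    _▸_  : ∀ {s i t s′} → nth P (State.pc s) ≡ just i →
           Steps P (execute i s) t s′ → Steps P s (suc t) s′
  infixr 5 _▸_

  _⊙_ : ∀ {P s t s′ t′ s″} → Steps P s t s′ → Steps P s′ t′ s″ → Steps P s (t + t′) s″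
  done    ⊙ r = r
  (e ▸ q) ⊙ r = e ▸ (q ⊙ r)

  steps⇒⇓ : ∀ {P s t s′} → Steps P s t s′ → nth P (State.pc s′) ≡ nothing → P ⊢ s ⇓[ t ] s′
  steps⇒⇓ done    h = halt h
  steps⇒⇓ (e ▸ r) h = step e (steps⇒⇓ r h)

  cell : Field → ℕ → ℕ
  cell f i = (i * K + f) + B

  -- Nothing is said about the program counter and the scratch registers, so jumps and address
  -- computations preserve the relation. The bounds `vars<` and `cells<` keep every value of the
  -- store representable as a word.
  record _≈_ (σ : Store) (s : State) : Set where
    constructor sim
    field
      vars   : ∀ x → State.reg s (3 + x) ≡ env σ x
      vars<  : ∀ x → env σ x < W
      base   : State.reg s 2 ≡ B
      ins    : ∀ i → i < B → State.mem s i ≡ input i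
      cells  : ∀ f i → f < K → i < M → State.mem s (cell f i) ≡ arr σ f i
      cells< : ∀ f i → arr σ f i < W

  cell-offset< : ∀ {f i} → f < K → i < M → i * K + f < M * K
  cell-offset< {f} {i} f<K i<M = begin-strict
    i * K + f <⟨ +-monoʳ-< (i * K) f<K ⟩
    i * K + K ≡⟨ +-comm (i * K) K ⟩
    suc i * K ≤⟨ *-monoˡ-≤ K i<M ⟩
    M * K     ∎
    where open ≤-Reasoning

  cell< : ∀ {f i} → f < K → i < M → cell f i < W
  cell< f<K i<M = <-≤-trans (+-monoˡ-< B (cell-offset< f<K i<M)) memory-fits

  -- Uniqueness of quotient and remainder modulo `K`. It separates the cells of distinct entries,
  -- which is what a write has to know.
  offset-injective : ∀ i j {f g} → f < K → g < K → i * K + f ≡ j * K + g → i ≡ j × f ≡ g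
  offset-injective zero    zero    f<K g<K e = refl , e
  offset-injective zero    (suc j) {f} {g} f<K g<K e = ⊥-elim (<-irrefl e (<-≤-trans f<K
    (≤-trans (m≤m+n K (j * K)) (m≤m+n (K + j * K) g))))
  offset-injective (suc i) zero    {f} {g} f<K g<K e = ⊥-elim (<-irrefl (sym e) (<-≤-trans g<K
    (≤-trans (m≤m+n K (i * K)) (m≤m+n (K + i * K) f))))
  offset-injective (suc i) (suc j) {f} {g} f<K g<K e
    with offset-injective i j f<K g<K (+-cancelˡ-≡ K _ _
           (trans (sym (+-assoc K (i * K) f)) (trans e (+-assoc K (j * K) g))))
  ... | refl , f≡g = refl , f≡g

  set-var : ∀ {σ s x n m} pc reg → (∀ z → reg (3 + z) ≡ State.reg s (3 + z)) →
            reg 2 ≡ State.reg s 2 → m ≡ n → n < W →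
            σ ≈ s → (σ ⟦ x ≔ n ⟧) ≈ state pc (reg [ 3 + x ≔ m ]) (State.mem s)
  set-var {σ} {s} {x} pc reg same same₂ m≡n n<W r = record
    { vars   = λ z → cong₂ (if z ≡ᵇ x then_else_) m≡n (trans (same z) (vars z))
    ; vars<  = ≔-pred (_< W) (env σ) x vars< n<W
    ; base   = trans same₂ base
    ; ins    = ins
    ; cells  = cells
    ; cells< = cells<
    }
    where open _≈_ r

  set-cell : ∀ {σ s f i n a} pc reg → (∀ z → reg (3 + z) ≡ State.reg s (3 + z)) →
             reg 2 ≡ State.reg s 2 → f < K → i < M → a ≡ cell f i → n < W → σ ≈ s →
             ⟪ env σ , writeField (arr σ) f i n ⟫ ≈ state pc reg (State.mem s [ a ≔ n ])
  set-cell {σ} {s} {f} {i} {n} pc reg same same₂ f<K i<M refl n<W r = record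
    { vars   = λ z → trans (same z) (vars z)
    ; vars<  = vars<
    ; base   = trans same₂ base
    ; ins    = λ j j<B → trans (≔-other (State.mem s) n (λ j≡a →
                 <⇒≢ (<-≤-trans j<B (m≤n+m B (i * K + f))) j≡a)) (ins j j<B)
    ; cells  = written
    ; cells< = λ g → written< g
    }
    where
    open _≈_ r
    written : ∀ g j → g < K → j < M →
              (State.mem s [ cell f i ≔ n ]) (cell g j) ≡ writeField (arr σ) f i n g j
    written g j g<K j<M with g ≟ f | j ≟ i
    ... | yes refl | yes refl rewrite ≡ᵇ-refl (cell f i) | ≡ᵇ-refl f | ≡ᵇ-refl i = refl
    ... | yes refl | no j≢i rewrite ≡ᵇ-refl f | ≢⇒≡ᵇ j≢i
        | ≢⇒≡ᵇ (λ e → j≢i (proj₁ (offset-injective j i g<K f<K (+-cancelʳ-≡ B _ _ e)))) =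
        cells g j g<K j<M
    ... | no g≢f | _ rewrite ≢⇒≡ᵇ g≢f
        | ≢⇒≡ᵇ (λ e → g≢f (proj₂ (offset-injective j i g<K f<K (+-cancelʳ-≡ B _ _ e)))) =
        cells g j g<K j<M
    written< : ∀ g j → writeField (arr σ) f i n g j < W
    written< g with g ≡ᵇ f
    ... | true  = ≔-pred (_< W) (arr σ g) i (cells< g) n<W
    ... | false = cells< g

  -- The scratch register after the five instructions of fieldAddress.
  address : ∀ {σ s} f y → f < K → env σ y < M → σ ≈ s →
            wrap (wrap (wrap (State.reg s (3 + y) * wrap K) + wrap f) + State.reg s 2)
              ≡ cell f (env σ y)
  address {σ} {s} f y f<K y<M r = begin
    wrap (wrap (wrap (State.reg s (3 + y) * wrap K) + wrap f) + State.reg s 2)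
      ≡⟨ cong₂ (λ a b → wrap (wrap (wrap a + b) + State.reg s 2))
               (cong₂ _*_ (vars y) (wrap-small K<2^w)) (wrap-small (<-trans f<K K<2^w)) ⟩
    wrap (wrap (wrap (env σ y * K) + f) + State.reg s 2)
      ≡⟨ cong (λ a → wrap (wrap (a + f) + State.reg s 2))
              (wrap-small (≤-<-trans (m≤m+n (env σ y * K) f) offset<W)) ⟩
    wrap (wrap (env σ y * K + f) + State.reg s 2)
      ≡⟨ cong₂ (λ a b → wrap (a + b)) (wrap-small offset<W) base ⟩
    wrap (cell f (env σ y))
      ≡⟨ wrap-small (cell< f<K y<M) ⟩
    cell f (env σ y) ∎
    where
    open ≡-Reasoning
    open _≈_ r
    offset<W : env σ y * K + f < W
    offset<W = ≤-<-trans (m≤m+n _ B) (cell< f<K y<M)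

  retime : ∀ {P s t t′ s′} → t ≡ t′ → Steps P s t s′ → Steps P s t′ s′
  retime refl q = q

  goto : ℕ → State → State
  goto o (state _ reg mem) = state o reg mem

  moved : ∀ {σ s o} → σ ≈ s → σ ≈ goto o s
  moved r = record { _≈_ r }

  at : ∀ {P s o i t s′} → nth P o ≡ just i → State.pc s ≡ o →
       Steps P (execute i s) t s′ → Steps P s (suc t) s′
  at p refl q = p ▸ q

  jump-taken : ∀ {P s o x y ℓ t s′} → nth P o ≡ just (jump-if-< x y ℓ) → State.pc s ≡ o →
               (State.reg s x <ᵇ State.reg s y) ≡ true →
               Steps P (goto ℓ s) t s′ → Steps P s (suc t) s′
  jump-taken {P} {s} {ℓ = ℓ} {t} {s′} p refl b q =
    p ▸ subst (λ c → Steps P (goto (if c then ℓ else suc (State.pc s)) s) t s′) (sym b) q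

  jump-skipped : ∀ {P s o x y ℓ t s′} → nth P o ≡ just (jump-if-< x y ℓ) → State.pc s ≡ o →
                 (State.reg s x <ᵇ State.reg s y) ≡ false →
                 Steps P (goto (suc o) s) t s′ → Steps P s (suc t) s′
  jump-skipped {P} {s} {ℓ = ℓ} {t} {s′} p refl b q =
    p ▸ subst (λ c → Steps P (goto (if c then ℓ else suc (State.pc s)) s) t s′) (sym b) q

  private
    split-T : ∀ {a b} → T (a ∧ b) → T a × T b
    split-T = Equivalence.to T-∧

    not-T : ∀ {b} → T (not b) → b ≡ false
    not-T = Equivalence.to T-not-≡

  -- Every run of a compiled command is Ok-guarded, so that machine words never
  -- wrap around and the machine follows the exact semantics step by step.
  simulate : ∀ {P} c {o σ s} → T (wf c) → CodeAt P o (code o c) → State.pc s ≡ o →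
             Ok B M W c σ → σ ≈ s →
             ∃[ s′ ] Steps P s (cost c σ) s′ × State.pc s′ ≡ size c + o × run c σ ≈ s′
  simulate skip wfc p e k r = _ , done , e , r
  simulate (x :=# n) wfc (p , _) refl k r =
    _ , p ▸ done , refl , set-var _ _ (λ _ → refl) refl (wrap-small k) k r
  simulate (x := y ⊕ z) wfc (p , _) refl k r =
    _ , p ▸ done , refl , set-var _ _ (λ _ → refl) refl
      (trans (cong wrap (cong₂ _+_ (vars y) (vars z))) (wrap-small k)) k r
    where open _≈_ r
  simulate (x := y ⊖ z) {σ = σ} wfc (p , _) refl k r =
    _ , p ▸ done , refl , set-var _ _ (λ _ → refl) refl
      (trans (cong₂ (λ a b → wrap ((W + a) ∸ b)) (vars y) (vars z)) (wrap-∸ k (vars< y)))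
      (≤-<-trans (m∸n≤m (env σ y) (env σ z)) (vars< y)) r
    where open _≈_ r
  simulate (x :=in y) {s = s} wfc (p , _) refl k r =
    _ , p ▸ done , refl , set-var _ _ (λ _ → refl) refl
      (trans (cong (State.mem s) (vars y)) (ins _ k)) (input<2^w _) r
    where open _≈_ r
  simulate (x := f ⟨ y ⟩) {s = s} wfc (p₁ , p₂ , p₃ , p₄ , p₅ , p₆ , _) refl k r =
    _ , p₁ ▸ p₂ ▸ p₃ ▸ p₄ ▸ p₅ ▸ p₆ ▸ done , refl ,
    set-var _ _ (λ _ → refl) refl
      (trans (cong (State.mem s) (address f y f<K k r)) (cells f _ f<K k)) (cells< f _) r
    where
    open _≈_ r
    f<K = <ᵇ⇒< f K wfc
  simulate (f ⟨ y ⟩:= x) {σ = σ} {s = s} wfc (p₁ , p₂ , p₃ , p₄ , p₅ , p₆ , _) refl k r =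
    _ , p₁ ▸ p₂ ▸ p₃ ▸ p₄ ▸ p₅ ▸ p₆ ▸ done , refl ,
    subst (λ n → ⟪ env σ , writeField (arr σ) f (env σ y) n ⟫ ≈
                 execute (store 0 (3 + x)) (state (5 + State.pc s) regs (State.mem s)))
      (vars x)
      (set-cell _ _ (λ _ → refl) refl f<K k (address f y f<K k r)
        (subst (_< W) (sym (vars x)) (vars< x)) r)
    where
    open _≈_ r
    f<K = <ᵇ⇒< f K wfc
    -- The registers after the address computation, found by unification.
    regs : ℕ → ℕ
    regs = _
  simulate {P} (c ⨾ d) {o} wfc p e (k₁ , k₂) r
    with codeAt-++ P o (code o c) (code (size c + o) d) p
  ... | p₁ , p₂ with simulate c (proj₁ (split-T wfc)) p₁ e k₁ r
  ... | s₁ , q₁ , e₁ , r₁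
    with simulate d (proj₂ (split-T {wf c} wfc))
           (subst (λ n → CodeAt P (n + o) (code (size c + o) d)) (length-code o c) p₂) e₁ k₂ r₁
  ... | s₂ , q₂ , e₂ , r₂ = s₂ , q₁ ⊙ q₂ , trans e₂ (shift (size c) (size d) o) , r₂
    where
    shift : ∀ a b o → b + (a + o) ≡ a + b + o
    shift a b o = trans (sym (+-assoc b a o)) (cong (_+ o) (+-comm b a))
  simulate {P} (IF x < y THEN c ELSE d) {o} {σ} {s} wfc (p₁ , p) refl k r
    with codeAt-++ P (suc o) (code (suc o) d) (jump (2 + size d + size c + o) ∷ code (2 + size d + o) c) p
  ... | pd , pj , pc with env σ x <ᵇ env σ y in eq
  ... | true with simulate c {s = goto (2 + size d + o) s} (proj₁ (split-T wfc))
                    (subst (λ n → CodeAt P n (code (2 + size d + o) c))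
                      (cong suc (trans (cong (_+ suc o) (length-code (suc o) d)) (+-suc (size d) o))) pc)
                    refl k (moved r)
  ... | s₁ , q₁ , e₁ , r₁ =
    s₁ , jump-taken p₁ refl (trans (cong₂ _<ᵇ_ (vars x) (vars y)) eq) q₁ ,
    trans e₁ (shift (size c) (size d) o) , r₁
    where
    open _≈_ r
    shift : ∀ a b o → a + suc (suc (b + o)) ≡ suc (suc (b + a + o))
    shift = solve-∀
  simulate {P} (IF x < y THEN c ELSE d) {o} {σ} {s} wfc (p₁ , p) refl k r
      | pd , pj , pc | false
    with simulate d {suc o} {s = goto (suc o) s} (proj₂ (split-T {wf c} wfc)) pd refl k (moved r)
  ... | s₁ , q₁ , e₁ , r₁ =
    goto (2 + size d + size c + o) s₁ ,
    retime (cong suc (+-comm (cost d σ) 1))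
      (jump-skipped p₁ refl (trans (cong₂ _<ᵇ_ (vars x) (vars y)) eq)
        (q₁ ⊙ at pj (trans e₁ (cong (_+ suc o) (sym (length-code (suc o) d)))) done)) ,
    refl , moved r₁
    where open _≈_ r
  simulate {P} (FOR x < y DO c) {o} {σ} {s} wfc (p₁ , p₂ , p₃ , p) refl k r =
    let s₂ , q₂ , e₂ , r₂ = head n ≤-refl in
    goto (6 + size c + o) s₂ ,
    retime (cong suc (+-comm (sumBelow n (λ j → 4 + cost c (iter c x j σ ⟦ x ≔ j ⟧))) 2))
      (p₁ ▸ (q₂ ⊙ jump-skipped p₂ e₂
        (trans (cong₂ _<ᵇ_ (trans (_≈_.vars r₂ x) (≔-same (env (iter c x n σ)) x n))
                            (trans (_≈_.vars r₂ y) (bound n)))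
               (≥⇒<ᵇ≡false {n} ≤-refl))
        (at p₃ refl done))) ,
    refl , moved r₂
    where
    n = env σ y
    s₀ = execute (const (3 + x) 0) s

    x∉c : assigns c x ≡ false
    x∉c = not-T (proj₁ (split-T wfc))
    y∉c : assigns c y ≡ false
    y∉c = not-T (proj₁ (split-T (proj₂ (split-T {not (assigns c x)} wfc))))
    y≢x : (y ≡ᵇ x) ≡ false
    y≢x = not-T (proj₁ (split-T (proj₂ (split-T {not (assigns c y)}
            (proj₂ (split-T {not (assigns c x)} wfc))))))
    wf-c : T (wf c)
    wf-c = proj₂ (split-T {not (y ≡ᵇ x)} (proj₂ (split-T {not (assigns c y)}
            (proj₂ (split-T {not (assigns c x)} wfc)))))

    tail : List Instr
    tail = const 0 1 ∷ arith add (3 + x) (3 + x) 0 ∷ jump (suc o) ∷ []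
    pc : CodeAt P (3 + o) (code (3 + o) c)
    pc = proj₁ (codeAt-++ P (3 + o) (code (3 + o) c) tail p)
    pt : CodeAt P (size c + (3 + o)) tail
    pt = subst (λ m → CodeAt P (m + (3 + o)) tail) (length-code (3 + o) c)
           (proj₂ (codeAt-++ P (3 + o) (code (3 + o) c) tail p))

    bound : ∀ i → env (iter c x i σ ⟦ x ≔ i ⟧) y ≡ n
    bound i rewrite y≢x = iter-env c x i σ y y≢x y∉c

    -- The invariant sits at the loop test, before it is executed: a further iteration takes the
    -- jump, and the exit from the loop skips it.
    head : ∀ i → i ≤ n →
           ∃[ s′ ] Steps P s₀ (sumBelow i (λ j → 4 + cost c (iter c x j σ ⟦ x ≔ j ⟧))) s′ ×
                   State.pc s′ ≡ suc o × (iter c x i σ ⟦ x ≔ i ⟧) ≈ s′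
    head zero    i≤n = s₀ , done , refl ,
      set-var _ _ (λ _ → refl) refl (wrap-small (<-trans z<s 1<2^w)) (<-trans z<s 1<2^w) r
    head (suc i) i<n with head i (<⇒≤ i<n)
    ... | s₁ , q₁ , e₁ , r₁
      with simulate c {s = goto (3 + o) s₁} wf-c pc refl (k i i<n) (moved r₁)
    ... | s₂ , q₂ , e₂ , r₂ =
      _ , q₁ ⊙ jump-taken p₂ e₁
            (trans (cong₂ _<ᵇ_ (trans (_≈_.vars r₁ x) (≔-same (env (iter c x i σ)) x i))
                                (trans (_≈_.vars r₁ y) (bound i)))
                   (<⇒<ᵇ≡true i<n))
            (retime (+-comm (cost c (iter c x i σ ⟦ x ≔ i ⟧)) 3)
              (q₂ ⊙ at (proj₁ pt) e₂
                    (at (proj₁ (proj₂ pt)) (cong suc e₂)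
                    (at (proj₁ (proj₂ (proj₂ pt))) (cong (2 +_) e₂) done)))) ,
      refl ,
      set-var {x = x} _ (State.reg s₂ [ 0 ≔ wrap 1 ]) (λ _ → refl) refl
        (trans (cong₂ (λ a b → wrap (a + b)) x≡i (wrap-small 1<2^w))
               (trans (cong wrap (+-comm i 1)) (wrap-small suc-i<W)))
        suc-i<W r₂
      where
      x≡i : State.reg s₂ (3 + x) ≡ i
      x≡i = trans (_≈_.vars r₂ x)
        (trans (run-env c _ x x∉c) (≔-same (env (iter c x i σ)) x i))
      -- The increment cannot wrap, because its result is at most the bound of the loop, which is
      -- itself the value of a variable.
      suc-i<W : suc i < W
      suc-i<W = ≤-<-trans i<n (_≈_.vars< r y)

-- Hoare rules with time bounds

module Hoare (input : ℕ → ℕ) (B M W : ℕ) where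

  open Semantics input public

  -- Exactness, time and result are proved together, since the absence of overflow and the number of
  -- iterations depend on the same invariants as the result.
  record Run (c : Cmd) (σ : Store) (t : ℕ) (Q : Store → Set) : Set where
    constructor ran
    field
      ok   : Ok B M W c σ
      time : cost c σ ≤ t
      post : Q (run c σ)
  open Run public

  -- Passed automatically to whatever follows a command, so that postconditions mention only what
  -- the command changes.
  record Frame (c : Cmd) (σ τ : Store) : Set where
    field
      var : ∀ x → assigns c x ≡ false → env τ x ≡ env σ x
      fld : ∀ f → writes c f ≡ false → arr τ f ≡ arr σ f
  open Frame public

  frame : ∀ c σ → Frame c σ (run c σ)
  frame c σ = record { var = run-env c σ ; fld = run-arr c σ }

  consequence : ∀ {c σ t t′} {Q Q′ : Store → Set} → t ≤ t′ → (∀ τ → Frame c σ τ → Q τ → Q′ τ) →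
                Run c σ t Q → Run c σ t′ Q′
  consequence t≤ f (ran o q p) = ran o (≤-trans q t≤) (f _ (frame _ _) p)

  infixr 4 _>>_
  _>>_ : ∀ {c d σ t u} {P Q : Store → Set} → Run c σ t P →
         (∀ τ → Frame c σ τ → P τ → Run d τ u Q) → Run (c ⨾ d) σ (t + u) Q
  ran o q p >> f = let ran o′ q′ p′ = f _ (frame _ _) p in
    ran (o , o′) (+-mono-≤ q q′) p′

  run-if : ∀ {x y c d σ t} {Q : Store → Set} →
           (env σ x < env σ y → Run c σ t Q) → (env σ y ≤ env σ x → Run d σ t Q) →
           Run (IF x < y THEN c ELSE d) σ (2 + t) Q
  run-if {x} {y} {c} {d} {σ} {t} {Q} f g with env σ x <ᵇ env σ y in eq
  ... | true = let ran o q p = f (<ᵇ⇒< (env σ x) (env σ y) (subst T (sym eq) tt)) in ran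
    (subst (λ b → if b then Ok B M W c σ else Ok B M W d σ) (sym eq) o)
    (subst (λ b → (if b then 1 + cost c σ else 2 + cost d σ) ≤ 2 + t) (sym eq)
      (≤-trans (s≤s q) (n≤1+n _)))
    (subst (λ b → Q (if b then run c σ else run d σ)) (sym eq) p)
  ... | false = let ran o q p = g (≮⇒≥ (λ lt → subst T eq (<⇒<ᵇ lt))) in ran
    (subst (λ b → if b then Ok B M W c σ else Ok B M W d σ) (sym eq) o)
    (subst (λ b → (if b then 1 + cost c σ else 2 + cost d σ) ≤ 2 + t) (sym eq) (s≤s (s≤s q)))
    (subst (λ b → Q (if b then run c σ else run d σ)) (sym eq) p)

  -- S i bounds the time of the first i iterations.
  run-for : ∀ {x y c σ} {Q : Store → Set} (I : ℕ → Store → Set) (S : ℕ → ℕ) →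
            I 0 σ →
            (∀ i τ → i < env σ y → Frame (FOR x < y DO c) σ τ → I i τ →
               ∃[ t ] Run c (τ ⟦ x ≔ i ⟧) t (I (suc i)) × S i + (4 + t) ≤ S (suc i)) →
            (∀ τ → I (env σ y) τ → Q (τ ⟦ x ≔ env σ y ⟧)) →
            Run (FOR x < y DO c) σ (3 + S (env σ y)) Q
  run-for {x} {y} {c} {σ} I S start body finish = ran
    (λ i i<n → let _ , r , _ = body i _ i<n (fr i) (inv i (<⇒≤ i<n)) in ok r)
    (+-monoʳ-≤ 3 (total n ≤-refl))
    (finish _ (inv n ≤-refl))
    where
    n = env σ y
    fr : ∀ i → Frame (FOR x < y DO c) σ (iter c x i σ)
    fr i = record
      { var = λ z e → iter-env c x i σ z (∨-conicalˡ (z ≡ᵇ x) _ e) (∨-conicalʳ (z ≡ᵇ x) _ e)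
      ; fld = iter-arr c x i σ
      }
    inv : ∀ i → i ≤ n → I i (iter c x i σ)
    inv zero    _   = start
    inv (suc i) i<n = let _ , r , _ = body i _ i<n (fr i) (inv i (<⇒≤ i<n)) in post r
    total : ∀ i → i ≤ n → sumBelow i (λ j → 4 + cost c (iter c x j σ ⟦ x ≔ j ⟧)) ≤ S i
    total zero    _   = z≤n
    total (suc i) i<n = let _ , r , s = body i _ i<n (fr i) (inv i (<⇒≤ i<n)) in
      ≤-trans (+-mono-≤ (total i (<⇒≤ i<n)) (+-monoʳ-≤ 4 (time r))) s

  run-for-uniform : ∀ {x y c σ} {Q : Store → Set} (I : ℕ → Store → Set) (t : ℕ) →
            I 0 σ →
            (∀ i τ → i < env σ y → Frame (FOR x < y DO c) σ τ → I i τ →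
               Run c (τ ⟦ x ≔ i ⟧) t (I (suc i))) →
            (∀ τ → I (env σ y) τ → Q (τ ⟦ x ≔ env σ y ⟧)) →
            Run (FOR x < y DO c) σ (3 + env σ y * (4 + t)) Q
  run-for-uniform I t start body finish = run-for I (_* (4 + t)) start
    (λ i τ i<n fr inv → t , body i τ i<n fr inv , ≤-reflexive (+-comm (i * (4 + t)) (4 + t)))
    finish

-- One scan of the edges

module _ {A : Set} where

  nth-++ˡ : ∀ (xs : List A) {ys} i {x} → nth xs i ≡ just x → nth (xs ++ ys) i ≡ just x
  nth-++ˡ (x ∷ xs) zero    e = e
  nth-++ˡ (x ∷ xs) (suc i) e = nth-++ˡ xs i e

  nth-++ʳ : ∀ (xs : List A) {ys} i → nth (xs ++ ys) (length xs + i) ≡ nth ys i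
  nth-++ʳ []       i = refl
  nth-++ʳ (x ∷ xs) i = nth-++ʳ xs i

  nth-++⁻ : ∀ (xs : List A) {ys} i {x} → nth (xs ++ ys) i ≡ just x →
            nth xs i ≡ just x ⊎ ∃[ j ] nth ys j ≡ just x
  nth-++⁻ []       i       e = inj₂ (i , e)
  nth-++⁻ (x ∷ xs) zero    e = inj₁ e
  nth-++⁻ (x ∷ xs) (suc i) e = nth-++⁻ xs i e

  nth⇒< : ∀ (xs : List A) i {x} → nth xs i ≡ just x → i < length xs
  nth⇒< (x ∷ xs) zero    e = z<s
  nth⇒< (x ∷ xs) (suc i) e = s<s (nth⇒< xs i e)

  <⇒nth : ∀ (xs : List A) {i} → i < length xs → ∃[ x ] nth xs i ≡ just x
  <⇒nth (x ∷ xs) {zero}  _           = x , refl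
  <⇒nth (x ∷ xs) {suc i} (s≤s i<n) = <⇒nth xs i<n

  nth-++ˡ⁻ : ∀ (xs : List A) {ys} i {x} → i < length xs →
             nth (xs ++ ys) i ≡ just x → nth xs i ≡ just x
  nth-++ˡ⁻ (x ∷ xs) zero    i<n         e = e
  nth-++ˡ⁻ (x ∷ xs) (suc i) (s≤s i<n) e = nth-++ˡ⁻ xs i i<n e

  nth⇒∈ : ∀ (xs : List A) i {x} → nth xs i ≡ just x → x ∈ xs
  nth⇒∈ (x ∷ xs) zero    refl = here refl
  nth⇒∈ (x ∷ xs) (suc i) e    = there (nth⇒∈ xs i e)

  ∈⇒nth : ∀ {xs : List A} {x} → x ∈ xs → ∃[ i ] nth xs i ≡ just x
  ∈⇒nth (here refl) = 0 , refl
  ∈⇒nth (there x∈xs) = let i , e = ∈⇒nth x∈xs in suc i , e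

  nth-injective : ∀ (xs : List A) i j {x} → Unique xs →
                  nth xs i ≡ just x → nth xs j ≡ just x → i ≡ j
  nth-injective (x ∷ xs) zero zero  u       p    q    = refl
  nth-injective (x ∷ xs) zero (suc j) (a ∷ u) refl q    = ⊥-elim (All.lookup a (nth⇒∈ xs j q) refl)
  nth-injective (x ∷ xs) (suc i) zero  (a ∷ u) p    refl = ⊥-elim (All.lookup a (nth⇒∈ xs i p) refl)
  nth-injective (x ∷ xs) (suc i) (suc j) (a ∷ u) p    q    = cong suc (nth-injective xs i j u p q)

  slice : ℕ → ℕ → List A → List A
  slice s l xs = take (l ∸ s) (drop s xs)

  length-slice : ∀ s {l} xs → l ≤ length xs → length (slice s l xs) ≡ l ∸ s
  length-slice s {l} xs l≤ = begin
    length (take (l ∸ s) (drop s xs)) ≡⟨ length-take (l ∸ s) (drop s xs) ⟩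
    (l ∸ s) ⊓ length (drop s xs)      ≡⟨ cong ((l ∸ s) ⊓_) (length-drop s xs) ⟩
    (l ∸ s) ⊓ (length xs ∸ s)         ≡⟨ m≤n⇒m⊓n≡m (∸-monoˡ-≤ s l≤) ⟩
    l ∸ s                             ∎
    where open ≡-Reasoning

  nth-take : ∀ m (xs : List A) {j} → j < m → nth (take m xs) j ≡ nth xs j
  nth-take (suc m) []       {j}     _           = refl
  nth-take (suc m) (x ∷ xs) {zero}  _           = refl
  nth-take (suc m) (x ∷ xs) {suc j} (s≤s j<m) = nth-take m xs j<m

  nth-take⁻ : ∀ m (xs : List A) j {x} → nth (take m xs) j ≡ just x → j < m × nth xs j ≡ just x
  nth-take⁻ (suc m) (x ∷ xs) zero    e = z<s , e
  nth-take⁻ (suc m) (x ∷ xs) (suc j) e =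
    let j<m , e′ = nth-take⁻ m xs j e in s<s j<m , e′
  nth-take⁻ zero    xs       zero    ()
  nth-take⁻ zero    xs       (suc j) ()

  nth-drop : ∀ s (xs : List A) j → nth (drop s xs) j ≡ nth xs (s + j)
  nth-drop zero    xs       j       = refl
  nth-drop (suc s) []       zero    = refl
  nth-drop (suc s) []       (suc j) = refl
  nth-drop (suc s) (x ∷ xs) j       = nth-drop s xs j

nth-map : ∀ {A B : Set} (f : A → B) xs i {x} → nth xs i ≡ just x → nth (map f xs) i ≡ just (f x)
nth-map f (x ∷ xs) zero    refl = refl
nth-map f (x ∷ xs) (suc i) e    = nth-map f xs i e

nth-map⁻ : ∀ {A B : Set} (f : A → B) xs i {y} → nth (map f xs) i ≡ just y →
           ∃[ x ] nth xs i ≡ just x × y ≡ f x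
nth-map⁻ f (x ∷ xs) zero    refl = x , refl , refl
nth-map⁻ f (x ∷ xs) (suc i) e    = nth-map⁻ f xs i e

<∸⇒+< : ∀ s {i l} → i < l ∸ s → s + i < l
<∸⇒+< zero            p = p
<∸⇒+< (suc s) {l = suc l} p = s<s (<∸⇒+< s p)

-- The state of a scan: the number of words found, the end of the last block
-- scanned with the current letter, and the new blocks [first, end).
record Sweep : Set where
  constructor sweep
  field
    count top letter : ℕ
    first end        : ℕ → ℕ
open Sweep public

module _ (F L : ℕ → ℕ) (m : Sweep) (u v a : ℕ) where

  -- The reset to 0 at a new letter declares nothing old, as no index lies below 0: words ending in
  -- different labels are different.
  nextTop : ℕ
  nextTop = if letter m <ᵇ a then 0 else top m

  -- The only extension that can be old is the last word found, at index `count m ∸ 1`; the new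
  -- block then begins with it.
  startIndex : ℕ
  startIndex = if F u <ᵇ nextTop then count m ∸ 1 else count m

  next : Sweep
  next = if F u <ᵇ L u
    then sweep (startIndex + (L u ∸ F u)) (L u) a
               -- The first edge that contributes to `v` opens its block; when edges are sorted by
               -- target, later ones into `v` only move the end.
               (if first m v <ᵇ end m v then first m else first m [ v ≔ startIndex ])
               (end m [ v ≔ startIndex + (L u ∸ F u) ])
    else sweep (count m) nextTop a (first m) (end m)

initialSweep : Sweep
initialSweep = sweep 0 0 0 (λ _ → 0) (λ _ → 0)

-- The invariant of a scan

module Counting (G : LabeledGraph) (_≺_ : Rel (LabeledGraph.Vertex G) 0ℓ)
  (sto : IsStrictTotalOrder _≡_ _≺_) where

  open LabeledGraph G
  open IsStrictTotalOrder sto using () renaming (trans to ≺-trans; irrefl to ≺-irrefl)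

  Edge : Set
  Edge = Vertex × Vertex × Label

  src dst : Edge → Vertex
  src (u , _ , _) = u
  dst (_ , v , _) = v
  lab : Edge → Label
  lab (_ , _ , a) = a

  _≼_ : Rel Vertex 0ℓ
  u ≼ v = u ≺ v ⊎ u ≡ v

  ≺-≼-absurd : ∀ {u v} → u ≺ v → v ≼ u → ⊥
  ≺-≼-absurd p (inj₁ q)    = ≺-irrefl refl (≺-trans p q)
  ≺-≼-absurd p (inj₂ refl) = ≺-irrefl refl p

  Word : ℕ → Set
  Word = Vec Label

  -- Words are kept reversed: the head of α is the last label of the walk.
  Via : ∀ {ℓ} → List Edge → (Word ℓ → Vertex → Set) → Word (suc ℓ) → Vertex → Set
  Via es R (a ∷ α) v = ∃[ u ] (u , v , a) ∈ es × R α u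

  Reach : ∀ {ℓ} → Word ℓ → Vertex → Set
  Reach {zero}  _ _ = ⊤
  Reach {suc ℓ}     = Via edges Reach

  -- The words reaching v are those with indices in [F v, L v) in the list αs.
  record Represents {ℓ} (R : Word ℓ → Vertex → Set) (αs : List (Word ℓ)) (F L : ℕ → ℕ) : Set where
    field
      unique-words : Unique αs
      index        : ∀ {α v} → R α v →
                     ∃[ i ] F (toℕ v) ≤ i × i < L (toℕ v) × nth αs i ≡ just α
      indexed      : ∀ i {α v} → F (toℕ v) ≤ i → i < L (toℕ v) → nth αs i ≡ just α → R α v
      sound        : ∀ i {α} → nth αs i ≡ just α → ∃[ v ] R α v
      bounded      : ∀ (v : Vertex) → L (toℕ v) ≤ length αs
      ordered      : ∀ {u v : Vertex} → u ≺ v → F (toℕ u) < L (toℕ u) → F (toℕ v) < L (toℕ v) →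
                     L (toℕ u) ≤ suc (F (toℕ v))

  -- The scan knows the Wheeler property and determinism only through this relation between earlier
  -- and later edges.
  record _⊏_ (e e′ : Edge) : Set where
    constructor before
    field
      dst≼ : dst e ≼ dst e′
      lab≤ : toℕ (lab e) ≤ toℕ (lab e′)
      src≺ : toℕ (lab e) ≡ toℕ (lab e′) → src e ≺ src e′
  open _⊏_

  module Round {ℓ} {R : Word ℓ → Vertex → Set} {αs : List (Word ℓ)} {F L : ℕ → ℕ}
               (old : Represents R αs F L) where
    open Represents old

    NonEmpty : Vertex → Set
    NonEmpty v = F (toℕ v) < L (toℕ v)

    -- `≤top` and `top≤` make `top` an exact frontier for the current letter: no index from `top` on
    -- has been extended by it, and the index just below has been, its extension being the last word
    -- of `βs`. `latest` lets the block of the latest target grow in place. `letter-lab` ties the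
    -- current letter to a scanned edge, so that it cannot exceed the label of the next one.
    record Swept (es : List Edge) (m : Sweep) (βs : List (Word (suc ℓ))) : Set where
      field
        represents : Represents (Via es R) βs (first m) (end m)
        length≡    : length βs ≡ count m
        latest     : ∀ {v} → first m (toℕ v) < end m (toℕ v) →
                     (∀ {e} → e ∈ es → dst e ≼ v) → end m (toℕ v) ≡ count m
        lab≤letter : ∀ {e} → e ∈ es → toℕ (lab e) ≤ letter m
        letter-lab : ∀ {e} → e ∈ es → ∃[ e′ ] e′ ∈ es × toℕ (lab e′) ≡ letter m
        ≤top       : ∀ {e} → e ∈ es → toℕ (lab e) ≡ letter m → NonEmpty (src e) →
                     L (toℕ (src e)) ≤ top m
        top≤       : ∀ {h} → top m ≡ suc h → ∃[ c ] ∃[ α ] ∃[ u ] ∃[ v ] ∃[ a ]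
                     count m ≡ suc c × (u , v , a) ∈ es × toℕ a ≡ letter m ×
                     F (toℕ u) ≤ h × h < L (toℕ u) ×
                     nth αs h ≡ just α × nth βs c ≡ just (a ∷ α)

    swept-initial : Swept [] initialSweep []
    swept-initial = record
      { represents = record
        { unique-words = []
        ; index = λ { {a ∷ α} (_ , () , _) }
        ; indexed = λ _ _ ()
        ; sound = λ { zero () ; (suc _) () }
        ; bounded = λ _ → z≤n
        ; ordered = λ _ ()
        }
      ; length≡    = refl
      ; latest     = λ ()
      ; lab≤letter = λ ()
      ; letter-lab = λ ()
      ; ≤top       = λ ()
      ; top≤       = λ ()
      }

    module Extend {es m βs} (swept : Swept es m βs) (u v : Vertex) (a : Label)
                  (es⊏ : ∀ {e} → e ∈ es → e ⊏ (u , v , a)) where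
      open Swept swept
      open Represents represents using () renaming
        ( unique-words to unique′; index to index′; indexed to indexed′; sound to sound′
        ; bounded to bounded′; ordered to ordered′ )

      f l top′ n : ℕ
      f    = F (toℕ u)
      l    = L (toℕ u)
      top′ = nextTop F L m (toℕ u) (toℕ v) (toℕ a)
      n    = startIndex F L m (toℕ u) (toℕ v) (toℕ a)

      e₀ : Edge
      e₀ = u , v , a

      -- If the letter has grown, no scanned edge carries `a` and there is nothing to bound.
      -- Otherwise `letter-lab` and `lab≤` force the current letter to be `a`, and `≤top` applies.
      ≤top′ : ∀ {e} → e ∈ es → toℕ (lab e) ≡ toℕ a → NonEmpty (src e) →
              L (toℕ (src e)) ≤ top′
      ≤top′ {e} e∈ lab≡ ne with letter m <? toℕ a
      ... | yes p = ⊥-elim (<-irrefl lab≡ (≤-<-trans (lab≤letter e∈) p))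
      ... | no ¬p rewrite ≥⇒<ᵇ≡false (≮⇒≥ ¬p) =
        let e′ , e′∈ , eq = letter-lab e∈ in
        ≤top e∈ (trans lab≡ (≤-antisym (≮⇒≥ ¬p) (subst (_≤ toℕ a) eq (lab≤ (es⊏ e′∈))))) ne

      -- A positive `top′` means that the letter is still `a`, so the edge behind `top≤` carries the
      -- same label as the new one and `src≺` orders the two sources.
      top′≤ : ∀ {h} → top′ ≡ suc h → ∃[ c ] ∃[ α ] ∃[ u′ ]
              count m ≡ suc c × u′ ≺ u × F (toℕ u′) ≤ h × h < L (toℕ u′) ×
              L (toℕ u′) ≤ top′ ×
              nth αs h ≡ just α × nth βs c ≡ just (a ∷ α)
      top′≤ eq with letter m <? toℕ a
      top′≤ eq | yes p rewrite <⇒<ᵇ≡true p with () ← eq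
      top′≤ eq | no ¬p rewrite ≥⇒<ᵇ≡false (≮⇒≥ ¬p)
        with c , α , u′ , v′ , a′ , c≡ , e∈ , a′≡ , F≤ , <L , p , q ← top≤ eq
        with a≡ ← ≤-antisym (≮⇒≥ ¬p) (subst (_≤ toℕ a) a′≡ (lab≤ (es⊏ e∈)))
        with refl ← Fin.toℕ-injective (trans a′≡ (sym a≡)) =
        c , α , u′ , c≡ , src≺ (es⊏ e∈) refl , F≤ , <L , ≤top e∈ a′≡ (≤-<-trans F≤ <L) , p , q

      -- The index just below `top′` lies in the block of a source before `u`, and `ordered` lets
      -- that block overlap the block of `u` in one index at most. This reduces the search for old
      -- words to one comparison.
      top′≤suc : NonEmpty u → top′ ≤ suc f
      top′≤suc ne with top′ in eq
      ... | zero  = z≤n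
      ... | suc h = let _ , _ , _ , _ , u′≺u , F≤ , <L , _ = top′≤ eq in
        ≤-trans <L (ordered u′≺u (≤-<-trans F≤ <L) ne)

      -- Hides whether the first word of the block is old. In either case `j ↦ n + (j ∸ f)` carries
      -- the block of `u` to its extensions by `a`, and the appended words come from indices not
      -- below `top′`, which makes them new.
      record Extension (n : ℕ) : Set where
        field
          words    : List (Word (suc ℓ))
          length+  : length (βs ++ words) ≡ n + (l ∸ f)
          shifted  : ∀ {j α} → f ≤ j → j < l → nth αs j ≡ just α →
                     nth (βs ++ words) (n + (j ∸ f)) ≡ just (a ∷ α)
          words⁻   : ∀ i {β} → nth words i ≡ just β → ∃[ j ] ∃[ α ]
                     β ≡ a ∷ α × top′ ≤ j × f ≤ j × j < l × nth αs j ≡ just α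
          unique+  : Unique words
          n≤count  : n ≤ count m
          count≤   : count m ≤ suc n

      newWords : ℕ → List (Word (suc ℓ))
      newWords s = map (a ∷_) (slice s l αs)

      newWords⁻ : ∀ s i {β} → nth (newWords s) i ≡ just β →
                  ∃[ j ] ∃[ α ] β ≡ a ∷ α × s ≤ j × j < l × nth αs j ≡ just α
      newWords⁻ s i eq =
        let α , p , β≡ = nth-map⁻ (a ∷_) (slice s l αs) i eq
            i< , q = nth-take⁻ (l ∸ s) (drop s αs) i p
        in s + i , α , β≡ , m≤m+n s i , <∸⇒+< s i< ,
           trans (sym (nth-drop s αs i)) q

      newWords⁺ : ∀ s j {α} → s ≤ j → j < l → nth αs j ≡ just α →
                  nth (newWords s) (j ∸ s) ≡ just (a ∷ α)
      newWords⁺ s j s≤j j<l eq = nth-map (a ∷_) (slice s l αs) (j ∸ s)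
        (trans (nth-take (l ∸ s) (drop s αs) (∸-monoˡ-< j<l s≤j))
          (trans (nth-drop s αs (j ∸ s)) (trans (cong (nth αs) (m+[n∸m]≡n s≤j)) eq)))

      unique-newWords : ∀ s → Unique (newWords s)
      unique-newWords s =
        Unique.map⁺ ∷-injectiveʳ (AllPairs.take⁺ (l ∸ s) (AllPairs.drop⁺ s unique-words))

      length-newWords : ∀ s → length (βs ++ newWords s) ≡ count m + (l ∸ s)
      length-newWords s = trans (length-++ βs)
        (cong₂ _+_ length≡ (trans (length-map (a ∷_) (slice s l αs))
                                  (length-slice s αs (bounded u))))

      extension : NonEmpty u → Extension n
      extension ne with f <? top′
      ... | no f≮top rewrite ≥⇒<ᵇ≡false (≮⇒≥ f≮top) = record
        { words   = newWords f
        ; length+ = length-newWords f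
        ; shifted = λ {j} f≤j j<l eq →
            trans (cong (λ c → nth (βs ++ newWords f) (c + (j ∸ f))) (sym length≡))
              (trans (nth-++ʳ βs (j ∸ f)) (newWords⁺ f j f≤j j<l eq))
        ; words⁻  = λ i eq → let j , α , p , f≤j , q = newWords⁻ f i eq in
            j , α , p , ≤-trans (≮⇒≥ f≮top) f≤j , f≤j , q
        ; unique+ = unique-newWords f
        ; n≤count = ≤-refl
        ; count≤  = n≤1+n _
        }
      -- Here `top′` is squeezed to `suc f`: the shared word has index `f`, and `top≤` places its
      -- extension at the end of `βs`. Only the words from `suc f` on are appended.
      ... | yes f<top rewrite <⇒<ᵇ≡true f<top
        with c , α , _ , c≡ , _ , _ , _ , _ , α≡ , β≡ ← top′≤ (≤-antisym (top′≤suc ne) f<top)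
        = record
        { words   = newWords (suc f)
        ; length+ = trans (length-newWords (suc f)) (trans (cong (_+ (l ∸ suc f)) c≡)
            (trans (sym (+-suc c (l ∸ suc f))) (cong₂ _+_ (cong pred (sym c≡)) (sym (+-∸-assoc 1 ne)))))
        ; shifted = λ {j} f≤j j<l eq → shift j f≤j j<l eq
        ; words⁻  = λ i eq → let j , α , p , f<j , q = newWords⁻ (suc f) i eq in
            j , α , p , ≤-trans (top′≤suc ne) f<j , <⇒≤ f<j , q
        ; unique+ = unique-newWords (suc f)
        ; n≤count = m∸n≤m (count m) 1
        ; count≤  = m≤n+m∸n (count m) 1
        }
        where
        shift : ∀ j {α′} → f ≤ j → j < l → nth αs j ≡ just α′ →
                nth (βs ++ newWords (suc f)) (count m ∸ 1 + (j ∸ f)) ≡ just (a ∷ α′)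
        shift j f≤j j<l eq with m≤n⇒m<n∨m≡n f≤j
        ... | inj₂ refl rewrite n∸n≡0 f | +-identityʳ (count m ∸ 1) | c≡
                              | just-injective (trans (sym eq) α≡) = nth-++ˡ βs c β≡
        ... | inj₁ f<j = trans (cong (nth (βs ++ newWords (suc f))) idx)
              (trans (nth-++ʳ βs (j ∸ suc f)) (newWords⁺ (suc f) j f<j j<l eq))
          where
          idx : count m ∸ 1 + (j ∸ f) ≡ length βs + (j ∸ suc f)
          idx = trans (cong₂ _+_ (cong pred c≡) (+-∸-assoc 1 f<j))
                  (trans (+-suc c (j ∸ suc f)) (cong (_+ (j ∸ suc f)) (trans (sym c≡) (sym length≡))))

      m′ : Sweep
      m′ = next F L m (toℕ u) (toℕ v) (toℕ a)

      Via-snoc : ∀ {β x} → Via es R β x → Via (es ++ e₀ ∷ []) R β x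
      Via-snoc {_ ∷ _} (y , e∈ , r) = y , ∈-++⁺ˡ e∈ , r

      Via-last : ∀ {α} → R α u → Via (es ++ e₀ ∷ []) R (a ∷ α) v
      Via-last r = u , ∈-++⁺ʳ es (here refl) , r

      Via-snoc⁻ : ∀ {b α x} → Via (es ++ e₀ ∷ []) R (b ∷ α) x →
                  Via es R (b ∷ α) x ⊎ (b ≡ a × x ≡ v × R α u)
      Via-snoc⁻ (y , e∈ , r) with ∈-++⁻ es e∈
      ... | inj₁ e∈es = inj₁ (y , e∈es , r)
      ... | inj₂ (here refl) = inj₂ (refl , refl , r)

      -- A nonempty block has a word at its first index, and `indexed′` turns it into a scanned edge
      -- entering `x`.
      dst-∈ : ∀ {x} → first m (toℕ x) < end m (toℕ x) → ∃[ e ] e ∈ es × dst e ≡ x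
      dst-∈ {x} p with <⇒nth βs (<-≤-trans p (bounded′ x))
      ... | a ∷ α , q = let y , e∈ , _ = indexed′ _ ≤-refl p q in _ , e∈ , refl

      -- Edges are processed in the order of their targets.
      beyond-empty : ∀ {x} → v ≺ x → first m (toℕ x) < end m (toℕ x) → ⊥
      beyond-empty v≺x p with e , e∈ , refl ← dst-∈ p = ≺-≼-absurd v≺x (dst≼ (es⊏ e∈))

      lab≤letter′ : ∀ {e} → e ∈ es ++ e₀ ∷ [] → toℕ (lab e) ≤ toℕ a
      lab≤letter′ e∈ with ∈-++⁻ es e∈
      ... | inj₁ e∈es = lab≤ (es⊏ e∈es)
      ... | inj₂ (here refl) = ≤-refl

      extend-empty : ¬ NonEmpty u → Swept (es ++ e₀ ∷ []) m′ βs
      extend-empty ¬ne rewrite ≥⇒<ᵇ≡false (≮⇒≥ ¬ne) = record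
        { represents = record
          { unique-words = unique′
          ; index = λ { {_ ∷ _} r → index″ r }
          ; indexed = λ i p q eq → Via-snoc (indexed′ i p q eq)
          ; sound = λ i eq → let x , r = sound′ i eq in x , Via-snoc r
          ; bounded = bounded′
          ; ordered = ordered′
          }
        ; length≡    = length≡
        ; latest     = λ p below → latest p (λ e∈ → below (∈-++⁺ˡ e∈))
        ; lab≤letter = lab≤letter′
        ; letter-lab = λ _ → e₀ , ∈-++⁺ʳ es (here refl) , refl
        ; ≤top       = top″
        ; top≤       = λ eq → top‴ eq
        }
        where
        index″ : ∀ {b α x} → Via (es ++ e₀ ∷ []) R (b ∷ α) x →
                 ∃[ i ] first m (toℕ x) ≤ i × i < end m (toℕ x) × nth βs i ≡ just (b ∷ α)
        index″ r with Via-snoc⁻ r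
        ... | inj₁ r′ = index′ r′
        ... | inj₂ (refl , refl , r′) = let i , p , q , _ = index r′ in ⊥-elim (¬ne (≤-<-trans p q))
        top″ : ∀ {e} → e ∈ es ++ e₀ ∷ [] → toℕ (lab e) ≡ toℕ a → NonEmpty (src e) →
               L (toℕ (src e)) ≤ top′
        top″ e∈ with ∈-++⁻ es e∈
        ... | inj₁ e∈es = ≤top′ e∈es
        ... | inj₂ (here refl) = λ _ ne → ⊥-elim (¬ne ne)
        top‴ : ∀ {h} → top′ ≡ suc h → _
        top‴ eq with letter m <? toℕ a
        top‴ eq | yes p rewrite <⇒<ᵇ≡true p with () ← eq
        top‴ eq | no ¬p rewrite ≥⇒<ᵇ≡false (≮⇒≥ ¬p)
          with c , α , u′ , v′ , a′ , c≡ , e∈ , a′≡ , rest ← top≤ eq =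
          c , α , u′ , v′ , a′ , c≡ , ∈-++⁺ˡ e∈ ,
          trans a′≡ (≤-antisym (subst (_≤ toℕ a) a′≡ (lab≤ (es⊏ e∈))) (≮⇒≥ ¬p)) , rest

      module _ (ne : NonEmpty u) where
        open Extension (extension ne)

        private
          N = n + (l ∸ f)
          first″ = if first m (toℕ v) <ᵇ end m (toℕ v) then first m else first m [ toℕ v ≔ n ]
          end″ = end m [ toℕ v ≔ N ]

        first-other : ∀ {x} → x ≢ v → first″ (toℕ x) ≡ first m (toℕ x)
        first-other x≢v with first m (toℕ v) <ᵇ end m (toℕ v)
        ... | true  = refl
        ... | false = ≔-other (first m) n (λ eq → x≢v (Fin.toℕ-injective eq))

        end-other : ∀ {x} → x ≢ v → end″ (toℕ x) ≡ end m (toℕ x)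
        end-other x≢v = ≔-other (end m) N (λ eq → x≢v (Fin.toℕ-injective eq))

        end-v : end″ (toℕ v) ≡ N
        end-v = ≔-same (end m) (toℕ v) N

        n<N : n < N
        n<N = m<m+n n (m<n⇒0<n∸m ne)

        count≤N : count m ≤ N
        count≤N = ≤-trans count≤ n<N

        -- If v was nonempty, its interval ended at count m, hence can grow in place.
        first-v : (first m (toℕ v) < end m (toℕ v) × first″ (toℕ v) ≡ first m (toℕ v) ×
                   end m (toℕ v) ≡ count m × first m (toℕ v) ≤ n)
                ⊎ (¬ first m (toℕ v) < end m (toℕ v) × first″ (toℕ v) ≡ n)
        first-v with first m (toℕ v) <? end m (toℕ v)
        ... | yes p rewrite <⇒<ᵇ≡true p =
          let eq = latest p (λ e∈ → dst≼ (es⊏ e∈)) in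
          inj₁ (p , refl , eq , ≤-pred (≤-trans p (≤-trans (≤-reflexive eq) count≤)))
        ... | no ¬p rewrite ≥⇒<ᵇ≡false (≮⇒≥ ¬p) = inj₂ (¬p , ≔-same (first m) (toℕ v) n)

        first≤n : first″ (toℕ v) ≤ n
        first≤n with first-v
        ... | inj₁ (_ , eq , _ , le) = ≤-trans (≤-reflexive eq) le
        ... | inj₂ (_ , eq)          = ≤-reflexive eq

        old⊆new : ∀ {x i} → first m (toℕ x) ≤ i → i < end m (toℕ x) →
                  first″ (toℕ x) ≤ i × i < end″ (toℕ x)
        old⊆new {x} {i} p q with x Fin.≟ v
        ... | no x≢v = subst (_≤ i) (sym (first-other x≢v)) p , subst (i <_) (sym (end-other x≢v)) q
        ... | yes refl with first-v
        ...   | inj₁ (_ , eq , eq′ , _) = subst (_≤ i) (sym eq) p ,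
                <-≤-trans q (≤-trans (≤-reflexive eq′) (≤-trans count≤N (≤-reflexive (sym end-v))))
        ...   | inj₂ (¬ne , _) = ⊥-elim (¬ne (≤-<-trans p q))

        -- A block of `v` grown in place is cut at `count m`: the old block ends there, and the
        -- image of the block of `u` starts at `n ≤ count m`, so no gap is left.
        new-cases : ∀ {x i} → first″ (toℕ x) ≤ i → i < end″ (toℕ x) →
                    (first m (toℕ x) ≤ i × i < end m (toℕ x)) ⊎ (x ≡ v × n ≤ i × i < N)
        new-cases {x} {i} p q with x Fin.≟ v
        ... | no x≢v = inj₁ (subst (_≤ i) (first-other x≢v) p , subst (i <_) (end-other x≢v) q)
        ... | yes refl with first-v
        ...   | inj₂ (_ , eq) = inj₂ (refl , subst (_≤ i) eq p , subst (i <_) end-v q)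
        ...   | inj₁ (_ , eq , eq′ , _) with i <? count m
        ...     | yes i<c = inj₁ (subst (_≤ i) eq p , subst (i <_) (sym eq′) i<c)
        ...     | no i≮c  = inj₂ (refl , ≤-trans n≤count (≮⇒≥ i≮c) , subst (i <_) end-v q)

        index″ : ∀ {b α x} → Via (es ++ e₀ ∷ []) R (b ∷ α) x →
                 ∃[ i ] first″ (toℕ x) ≤ i × i < end″ (toℕ x) × nth (βs ++ words) i ≡ just (b ∷ α)
        index″ r with Via-snoc⁻ r
        ... | inj₁ r′ = let i , p , q , eq = index′ r′ ; p′ , q′ = old⊆new p q in
                        i , p′ , q′ , nth-++ˡ βs i eq
        ... | inj₂ (refl , refl , r′) =
          let j , p , q , eq = index r′ in
          n + (j ∸ f) , ≤-trans first≤n (m≤m+n n _) ,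
          subst (n + (j ∸ f) <_) (sym end-v) (+-monoʳ-< n (∸-monoˡ-< q p)) , shifted p q eq

        indexed″ : ∀ i {β x} → first″ (toℕ x) ≤ i → i < end″ (toℕ x) →
                   nth (βs ++ words) i ≡ just β → Via (es ++ e₀ ∷ []) R β x
        indexed″ i {β} {x} p q eq with new-cases p q
        ... | inj₁ (p′ , q′) = Via-snoc (indexed′ i p′ q′
                (nth-++ˡ⁻ βs i (<-≤-trans q′ (bounded′ x)) eq))
        ... | inj₂ (refl , n≤i , i<N)
          with j<l ← <∸⇒+< f {i ∸ n} {l} (+-cancelˡ-< n _ _ (subst (_< N) (sym (m+[n∸m]≡n n≤i)) i<N))
          with α , eq′ ← <⇒nth αs {f + (i ∸ n)} (<-≤-trans j<l (bounded u))
          = subst (λ γ → Via (es ++ e₀ ∷ []) R γ v)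
              (just-injective (trans (sym (shifted (m≤m+n f _) j<l eq′)) (trans (cong (nth (βs ++ words))
                (trans (cong (n +_) (m+n∸m≡n f (i ∸ n))) (m+[n∸m]≡n n≤i))) eq)))
              (Via-last (indexed _ (m≤m+n f _) j<l eq′))

        sound″ : ∀ i {β} → nth (βs ++ words) i ≡ just β → ∃[ x ] Via (es ++ e₀ ∷ []) R β x
        sound″ i eq with nth-++⁻ βs i eq
        ... | inj₁ eq′ = let x , r = sound′ i eq′ in x , Via-snoc r
        ... | inj₂ (i′ , eq′) with _ , _ , refl , _ , p , q , eq″ ← words⁻ i′ eq′ =
          v , Via-last (indexed _ p q eq″)

        bounded″ : ∀ x → end″ (toℕ x) ≤ length (βs ++ words)
        bounded″ x with x Fin.≟ v
        ... | yes refl = ≤-reflexive (trans end-v (sym length+))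
        ... | no x≢v   = ≤-trans (≤-reflexive (end-other x≢v)) (≤-trans (bounded′ x)
              (≤-trans (≤-reflexive length≡) (≤-trans count≤N (≤-reflexive (sym length+)))))

        nonempty-other : ∀ {x} → x ≢ v → first″ (toℕ x) < end″ (toℕ x) →
                         first m (toℕ x) < end m (toℕ x)
        nonempty-other x≢v = subst₂ _<_ (first-other x≢v) (end-other x≢v)

        ordered″ : ∀ {x y} → x ≺ y → first″ (toℕ x) < end″ (toℕ x) →
                   first″ (toℕ y) < end″ (toℕ y) → end″ (toℕ x) ≤ suc (first″ (toℕ y))
        ordered″ {x} {y} x≺y nx ny with x Fin.≟ v | y Fin.≟ v
        ... | yes refl | yes refl = ⊥-elim (≺-irrefl refl x≺y)
        ... | yes refl | no y≢v   = ⊥-elim (beyond-empty x≺y (nonempty-other y≢v ny))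
        ... | no x≢v | no y≢v = subst₂ (λ p q → p ≤ suc q) (sym (end-other x≢v)) (sym (first-other y≢v))
              (ordered′ x≺y (nonempty-other x≢v nx) (nonempty-other y≢v ny))
        ... | no x≢v | yes refl with first-v
        ...   | inj₁ (p , eq , _) = subst₂ (λ p q → p ≤ suc q) (sym (end-other x≢v)) (sym eq)
                (ordered′ x≺y (nonempty-other x≢v nx) p)
        -- A fresh block starts at `n`, at most one below `count m`, and no earlier block ends
        -- beyond `count m`.
        ...   | inj₂ (_ , eq) = subst₂ (λ p q → p ≤ suc q) (sym (end-other x≢v)) (sym eq)
                (≤-trans (bounded′ x) (≤-trans (≤-reflexive length≡) count≤))

        -- A word a ∷ α occurring in βs has the index of α in αs below top′.
        unique″ : Unique (βs ++ words)
        unique″ = Unique.++⁺ unique′ unique+ disjoint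
          where
          disjoint : ∀ {β} → β ∈ βs × β ∈ words → ⊥
          disjoint {β} (p , q) with i , eq ← ∈⇒nth p | i′ , eq′ ← ∈⇒nth q
            with j , α , refl , top≤j , _ , j<l , eq″ ← words⁻ i′ eq′
            with x , y , e∈ , r ← sound′ i eq
            with j′ , F≤ , <L , eq‴ ← index r
            with refl ← nth-injective αs j j′ unique-words eq″ eq‴ =
            <⇒≱ <L (≤-trans (≤top′ e∈ refl (≤-<-trans F≤ <L)) top≤j)

        extend-nonempty : Swept (es ++ e₀ ∷ []) m′ (βs ++ words)
        extend-nonempty rewrite <⇒<ᵇ≡true ne = record
          { represents = record
            { unique-words = unique″
            ; index = λ { {_ ∷ _} → index″ }
            ; indexed = indexed″
            ; sound = sound″
            ; bounded = bounded″
            ; ordered = ordered″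
            }
          ; length≡    = length+
          ; latest     = latest″
          ; lab≤letter = lab≤letter′
          ; letter-lab = λ _ → e₀ , ∈-++⁺ʳ es (here refl) , refl
          ; ≤top       = top″
          ; top≤       = top‴
          }
          where
          latest″ : ∀ {x} → first″ (toℕ x) < end″ (toℕ x) →
                    (∀ {e} → e ∈ es ++ e₀ ∷ [] → dst e ≼ x) → end″ (toℕ x) ≡ N
          latest″ {x} p below with x Fin.≟ v | below (∈-++⁺ʳ es (here refl))
          ... | yes refl | _        = end-v
          ... | no x≢v | inj₁ v≺x  = ⊥-elim (beyond-empty v≺x (nonempty-other x≢v p))
          ... | no x≢v | inj₂ refl = ⊥-elim (x≢v refl)
          top″ : ∀ {e} → e ∈ es ++ e₀ ∷ [] → toℕ (lab e) ≡ toℕ a → NonEmpty (src e) →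
                 L (toℕ (src e)) ≤ l
          top″ e∈ with ∈-++⁻ es e∈
          -- Within a letter the frontier does not move back: `top′ ≤ suc f ≤ l`.
          ... | inj₁ e∈es = λ p q → ≤-trans (≤top′ e∈es p q) (≤-trans (top′≤suc ne) ne)
          ... | inj₂ (here refl) = λ _ _ → ≤-refl
          top‴ : ∀ {h} → l ≡ suc h → _
          -- The witness is the last word of the block of `u`; its extension has the last index of
          -- the extended list.
          top‴ {h} eq with α , eq′ ← <⇒nth αs {h} (<-≤-trans (≤-reflexive (sym eq)) (bounded u)) =
            n + (h ∸ f) , α , u , v , a ,
            trans (cong (n +_) (trans (cong (_∸ f) eq) (+-∸-assoc 1 f≤h))) (+-suc n (h ∸ f)) ,
            ∈-++⁺ʳ es (here refl) , refl , f≤h , ≤-reflexive (sym eq) , eq′ ,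
            shifted f≤h (≤-reflexive (sym eq)) eq′
            where
            f≤h : f ≤ h
            f≤h = ≤-pred (subst (f <_) eq ne)

      extend : ∃[ γs ] Swept (es ++ e₀ ∷ []) m′ γs
      extend with f <? l
      ... | yes ne = _ , extend-nonempty ne
      ... | no ¬ne = _ , extend-empty ¬ne

-- Sorting the edges, and words as k-mers

-- Pigeonhole. Used in both directions, it shows that sorting preserves the number of edges without
-- any counting inside buckets.
length-mono-⊆ : ∀ {A : Set} {xs ys : List A} → Unique xs → (∀ {x} → x ∈ xs → x ∈ ys) →
                length xs ≤ length ys
length-mono-⊆ {xs = []}     u       ⊆ = z≤n
length-mono-⊆ {xs = x ∷ xs} (a ∷ u) ⊆ with ps , qs , refl ← ∈-∃++ (⊆ (here refl)) =
  ≤-trans (s≤s (length-mono-⊆ u drop-x)) (≤-reflexive (trans (cong suc (length-++ ps))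
    (trans (sym (+-suc (length ps) (length qs))) (sym (length-++ ps)))))
  where
  drop-x : ∀ {y} → y ∈ xs → y ∈ ps ++ qs
  drop-x y∈ with ∈-++⁻ ps (⊆ (there y∈))
  ... | inj₁ p           = ∈-++⁺ˡ p
  ... | inj₂ (here refl) = ⊥-elim (All.lookup a y∈ refl)
  ... | inj₂ (there p)   = ∈-++⁺ʳ ps p

allPairs-zip : ∀ {A : Set} {P : A → Set} {R : Rel A 0ℓ} {xs} → All P xs → AllPairs R xs →
               AllPairs (λ x y → P x × P y × R x y) xs
allPairs-zip []       []       = []
allPairs-zip (p ∷ ps) (r ∷ rs) = All.zipWith (λ (q , s) → p , q , s) (ps , r) ∷ allPairs-zip ps rs

module BucketSort {A K : Set} (_≟ᴷ_ : DecidableEquality K) (key : A → K) where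

  bucket : K → List A → List A
  bucket u = filter (λ x → key x ≟ᴷ u)

  bucketSort : List K → List A → List A
  bucketSort us xs = concatMap (λ u → bucket u xs) us

  ∈-bucketSort⁺ : ∀ {us xs x} → key x ∈ us → x ∈ xs → x ∈ bucketSort us xs
  ∈-bucketSort⁺ {u ∷ us} {xs} (here refl) x∈ = ∈-++⁺ˡ (∈-filter⁺ _ x∈ refl)
  ∈-bucketSort⁺ {u ∷ us} {xs} (there u∈) x∈ = ∈-++⁺ʳ (bucket u xs) (∈-bucketSort⁺ u∈ x∈)

  ∈-bucketSort⁻ : ∀ us {xs x} → x ∈ bucketSort us xs → key x ∈ us × x ∈ xs
  ∈-bucketSort⁻ (u ∷ us) {xs} x∈ with ∈-++⁻ (bucket u xs) x∈
  ... | inj₁ p = let q , eq = ∈-filter⁻ _ p in here eq , q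
  ... | inj₂ p = let u∈ , q = ∈-bucketSort⁻ us p in there u∈ , q

  -- Stability: `filter` keeps the order inside a bucket, so the relation `R` of the input survives
  -- as the tie-break among equal keys.
  bucketSort-sorted : ∀ {S : Rel K 0ℓ} {R : Rel A 0ℓ} us {xs} → AllPairs S us → AllPairs R xs →
    AllPairs (λ x y → S (key x) (key y) ⊎ (key x ≡ key y × R x y)) (bucketSort us xs)
  bucketSort-sorted []             []       rs = []
  bucketSort-sorted {S} (u ∷ us) {xs} (s ∷ ss) rs = AllPairs.++⁺
    (AllPairs.map (λ (p , q , r) → inj₂ (trans p (sym q) , r))
      (allPairs-zip (All.all-filter (λ x → key x ≟ᴷ u) xs) (AllPairs.filter⁺ _ rs)))
    (bucketSort-sorted us ss rs)
    (All.tabulate λ x∈ → All.tabulate λ y∈ → inj₁ (ahead x∈ y∈))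
    where
    ahead : ∀ {x y} → x ∈ bucket u xs → y ∈ bucketSort us xs → S (key x) (key y)
    ahead {x} {y} x∈ y∈ = subst (λ v → S v (key y))
      (sym (proj₂ (∈-filter⁻ (λ x → key x ≟ᴷ u) {xs = xs} x∈)))
      (All.lookup s (proj₁ (∈-bucketSort⁻ us {xs} y∈)))

module _ (F L : ℕ → ℕ) where

  -- Even if the block starts one index back, its nonempty length makes up for it. Monotonicity
  -- bounds all intermediate counts by the final one.
  count≤next : ∀ m u v a → count m ≤ count (next F L m u v a)
  count≤next m u v a with F u <? L u
  ... | no  f≮l rewrite ≥⇒<ᵇ≡false (≮⇒≥ f≮l) = ≤-refl
  ... | yes f<l rewrite <⇒<ᵇ≡true f<l with F u <ᵇ nextTop F L m u v a
  ...   | true  = ≤-trans (m≤n+m∸n (count m) 1) (≤-trans (≤-reflexive (+-comm 1 (count m ∸ 1)))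
                    (+-monoʳ-≤ (count m ∸ 1) (m<n⇒0<n∸m f<l)))
  ...   | false = m≤m+n (count m) _

-- From one scan to the words of all lengths

module Kmers (G : LabeledGraph) (_≺_ : Rel (LabeledGraph.Vertex G) 0ℓ)
  (sto : IsStrictTotalOrder _≡_ _≺_) where

  open LabeledGraph G
  open Counting G _≺_ sto

  nextEdge : (F L : ℕ → ℕ) → Sweep → Edge → Sweep
  nextEdge F L m (u , v , a) = next F L m (toℕ u) (toℕ v) (toℕ a)

  sweepEdges : (F L : ℕ → ℕ) → List Edge → Sweep
  sweepEdges F L = foldl (nextEdge F L) initialSweep

  sweepEdges-snoc : ∀ F L es e → sweepEdges F L (es ++ e ∷ []) ≡ nextEdge F L (sweepEdges F L es) e
  sweepEdges-snoc F L es e = foldl-++ (nextEdge F L) initialSweep es (e ∷ [])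

  count-mono : ∀ F L es es′ → count (sweepEdges F L es) ≤ count (sweepEdges F L (es ++ es′))
  count-mono F L es es′ = subst (λ m → _ ≤ count m) (sym (foldl-++ (nextEdge F L) initialSweep es es′))
    (go (sweepEdges F L es) es′)
    where
    go : ∀ m es → count m ≤ count (foldl (nextEdge F L) m es)
    go m []               = ≤-refl
    go m ((u , v , a) ∷ es) = ≤-trans (count≤next F L m (toℕ u) (toℕ v) (toℕ a)) (go _ es)

  allPairs-++ : ∀ {A : Set} {R : Rel A 0ℓ} xs {y ys} → AllPairs R (xs ++ y ∷ ys) →
                ∀ {x} → x ∈ xs → R x y
  allPairs-++ (x ∷ xs) (r ∷ rs) (here refl) = All.lookup r (∈-++⁺ʳ xs (here refl))
  allPairs-++ (x ∷ xs) (r ∷ rs) (there x∈)  = allPairs-++ xs rs x∈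

  allPairs-prefix : ∀ {A : Set} {R : Rel A 0ℓ} xs {ys} → AllPairs R (xs ++ ys) → AllPairs R xs
  allPairs-prefix []       _        = []
  allPairs-prefix (x ∷ xs) (r ∷ rs) = All.++⁻ˡ xs r ∷ allPairs-prefix xs rs

  module _ {ℓ} {R : Word ℓ → Vertex → Set} {αs : List (Word ℓ)} {F L : ℕ → ℕ}
           (old : Represents R αs F L) where
    open Round old

    sweep-swept : ∀ es es′ → AllPairs _⊏_ (es ++ es′) →
                  (∃[ βs ] Swept es (sweepEdges F L es) βs) →
                  ∃[ βs ] Swept (es ++ es′) (sweepEdges F L (es ++ es′)) βs
    sweep-swept es [] ord sw = subst (λ es → ∃[ βs ] Swept es (sweepEdges F L es) βs)
      (sym (++-identityʳ es)) sw
    sweep-swept es (e@(u , v , a) ∷ es′) ord (βs , sw) =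
      subst (λ es → ∃[ βs ] Swept es (sweepEdges F L es) βs) (++-assoc es (e ∷ []) es′)
        (sweep-swept (es ++ e ∷ []) es′ (subst (AllPairs _⊏_) (sym (++-assoc es (e ∷ []) es′)) ord)
          (subst (λ m → ∃[ γs ] Swept (es ++ e ∷ []) m γs) (sym (sweepEdges-snoc F L es e))
            (Extend.extend sw u v a (allPairs-++ es ord))))

    swept-all : ∀ es → AllPairs _⊏_ es → ∃[ βs ] Swept es (sweepEdges F L es) βs
    swept-all es ord = sweep-swept [] es ord ([] , swept-initial)

    -- Allows the program to decrement the count without truncation: a positive frontier is
    -- witnessed by a word already found.
    count-positive : ∀ es {u v a} {es′} → AllPairs _⊏_ (es ++ (u , v , a) ∷ es′) →
      F (toℕ u) < nextTop F L (sweepEdges F L es) (toℕ u) (toℕ v) (toℕ a) →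
      1 ≤ count (sweepEdges F L es)
    count-positive es {u} {v} {a} ord p
      with sw ← proj₂ (swept-all es (allPairs-prefix es ord))
      with nextTop F L (sweepEdges F L es) (toℕ u) (toℕ v) (toℕ a) | Extend.top′≤ sw u v a (allPairs-++ es ord)
    ... | zero | _ = ⊥-elim (n≮0 p)
    ... | suc h | g = let c , _ , _ , c≡ , _ = g refl in subst (1 ≤_) (sym c≡) (s≤s z≤n)

  represents-⇔ : ∀ {ℓ} {R R′ : Word ℓ → Vertex → Set} {αs F L} →
    (∀ {α v} → R α v → R′ α v) → (∀ {α v} → R′ α v → R α v) →
    Represents R αs F L → Represents R′ αs F L
  represents-⇔ to from r = record
    { unique-words = unique-words
    ; index   = λ p → index (from p)
    ; indexed = λ i p q eq → to (indexed i p q eq)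
    ; sound   = λ i eq → let v , p = sound i eq in v , to p
    ; bounded = bounded
    ; ordered = ordered
    }
    where open Represents r

  represents-next : ∀ {ℓ} {αs : List (Word ℓ)} {F L} es → AllPairs _⊏_ es →
    (∀ {e} → e ∈ es → e ∈ edges) → (∀ {e} → e ∈ edges → e ∈ es) →
    Represents Reach αs F L →
    ∃[ βs ] Represents {suc ℓ} Reach βs (first (sweepEdges F L es)) (end (sweepEdges F L es)) ×
            length βs ≡ count (sweepEdges F L es)
  represents-next es ord ⊆ ⊇ r =
    let βs , sw = swept-all r es ord in
    βs ,
    represents-⇔ (λ { {_ ∷ _} (u , e∈ , p) → u , ⊆ e∈ , p })
                 (λ { {_ ∷ _} (u , e∈ , p) → u , ⊇ e∈ , p }) (Round.Swept.represents sw) ,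
    Round.Swept.length≡ sw

  -- Every vertex has the block [0, 1), since the empty word reaches all of them; the given vertex
  -- is the one that `sound` asks for.
  represents-empty : ∀ {F L} → Vertex → (∀ v → F (toℕ v) ≡ 0) → (∀ v → L (toℕ v) ≡ 1) →
                     Represents {0} Reach ([] ∷ []) F L
  represents-empty v F≡0 L≡1 = record
    { unique-words = [] ∷ []
    ; index   = λ { {[]} {x} _ → 0 , ≤-reflexive (F≡0 x) , ≤-reflexive (sym (L≡1 x)) , refl }
    ; indexed = λ _ _ _ _ → tt
    ; sound   = λ _ _ → v , tt
    ; bounded = λ x → ≤-reflexive (L≡1 x)
    ; ordered = λ {x} {y} _ _ _ → ≤-trans (≤-reflexive (L≡1 x)) (s≤s z≤n)
    }

  -- Mediates between `Contains`, where a walk is a function read from the front, and `Reach`, which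
  -- peels off the last edge.
  Path : ∀ {ℓ} → Vertex → Vec Label ℓ → Vertex → Set
  Path u []      v = u ≡ v
  Path u (a ∷ α) v = ∃[ x ] (u , x , a) ∈ edges × Path x α v

  contains⇒path : ∀ {ℓ} (α : Vec Label ℓ) ((f , _) : Contains G α) → ∃[ v ] Path (f Fin.zero) α v
  contains⇒path []      (f , h) = f Fin.zero , refl
  contains⇒path (a ∷ α) (f , h) =
    let v , p = contains⇒path α ((λ i → f (Fin.suc i)) , (λ i → h (Fin.suc i))) in
    v , f (Fin.suc Fin.zero) , h Fin.zero , p

  path⇒contains : ∀ {ℓ u v} (α : Vec Label ℓ) → Path u α v →
                  Σ[ (f , _) ∈ Contains G α ] f Fin.zero ≡ u
  path⇒contains {u = u} []      refl = ((λ _ → u) , λ ()) , refl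
  path⇒contains {u = u} (a ∷ α) (x , e∈ , p) with (f , h) , refl ← path⇒contains α p =
    ((λ { Fin.zero → u ; (Fin.suc i) → f i }) , λ { Fin.zero → e∈ ; (Fin.suc i) → h i }) , refl

  path-∷ʳ⁺ : ∀ {ℓ u x v a} (α : Vec Label ℓ) → Path u α x → (x , v , a) ∈ edges → Path u (α ∷ʳ a) v
  path-∷ʳ⁺ []      refl         e = _ , e , refl
  path-∷ʳ⁺ (b ∷ α) (y , e′ , p) e = y , e′ , path-∷ʳ⁺ α p e

  path-∷ʳ⁻ : ∀ {ℓ u v a} (α : Vec Label ℓ) → Path u (α ∷ʳ a) v → ∃[ x ] Path u α x × (x , v , a) ∈ edges
  path-∷ʳ⁻ []      (_ , e , refl) = _ , refl , e
  path-∷ʳ⁻ (b ∷ α) (y , e′ , p)   = let x , q , e = path-∷ʳ⁻ α p in x , (y , e′ , q) , e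

  reach⇒path : ∀ {ℓ v} (α : Word ℓ) → Reach α v → ∃[ u ] Path u (reverse α) v
  reach⇒path {v = v} []      _            = v , refl
  reach⇒path {v = v} (a ∷ α) (x , e∈ , r) = let u , p = reach⇒path α r in
    u , subst (λ β → Path u β v) (sym (reverse-∷ a α)) (path-∷ʳ⁺ (reverse α) p e∈)

  path⇒reach : ∀ {ℓ u v} (α : Word ℓ) → Path u (reverse α) v → Reach α v
  path⇒reach []      _ = tt
  path⇒reach {u = u} {v} (a ∷ α) p =
    let x , q , e∈ = path-∷ʳ⁻ (reverse α) (subst (λ β → Path u β v) (reverse-∷ a α) p) in
    x , e∈ , path⇒reach α q

  hasKmerCount : ∀ {ℓ αs F L} → Represents {ℓ} Reach αs F L → HasKmerCount G ℓ (length αs)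
  hasKmerCount {ℓ} {αs} r =
    map reverse αs , Unique.map⁺ reverse-injective unique-words ,
    (λ α → mk⇔ (to α) (from α)) , length-map reverse αs
    where
    open Represents r
    to : ∀ α → α ∈ map reverse αs → Contains G α
    to α α∈ with β , β∈ , refl ← ∈-map⁻ reverse α∈ =
      let i , eq = ∈⇒nth β∈ ; v , p = sound i eq ; u , q = reach⇒path β p in
      proj₁ (path⇒contains (reverse β) q)
    from : ∀ α → Contains G α → α ∈ map reverse αs
    from α c = let v , p = contains⇒path α c
                   i , _ , _ , eq = index (path⇒reach (reverse α)
                     (subst (λ β → Path _ β v) (sym (reverse-involutive α)) p)) in
      subst (_∈ map reverse αs) (reverse-involutive α) (∈-map⁺ reverse (nth⇒∈ αs i eq))

-- The sorted edges of a deterministic Wheeler graph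

module SortedEdges (G : LabeledGraph) (_≺_ : Rel (LabeledGraph.Vertex G) 0ℓ)
  (det : Deterministic G) (wheeler : IsWheelerOrder G _≺_)
  (vs : List (LabeledGraph.Vertex G)) (enum : Enumerates G vs _≺_) where

  open LabeledGraph G
  open IsWheelerOrder wheeler
  open IsStrictTotalOrder isStrictTotalOrder using () renaming (compare to ≺-compare; irrefl to ≺-irrefl)
  open Counting G _≺_ isStrictTotalOrder
  module BySource = BucketSort Fin._≟_ src
  module ByTarget = BucketSort Fin._≟_ dst

  bySource sortedEdges : List Edge
  bySource    = BySource.bucketSort vs edges
  sortedEdges = ByTarget.bucketSort vs bySource

  ∈-bySource⁺ : ∀ {e} → e ∈ edges → e ∈ bySource
  ∈-bySource⁺ {e} = BySource.∈-bucketSort⁺ (proj₂ enum (src e))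

  ∈-bySource⁻ : ∀ {e} → e ∈ bySource → e ∈ edges
  ∈-bySource⁻ e∈ = proj₂ (BySource.∈-bucketSort⁻ vs e∈)

  ∈-sorted⁺ : ∀ {e} → e ∈ edges → e ∈ sortedEdges
  ∈-sorted⁺ {e} e∈ = ByTarget.∈-bucketSort⁺ (proj₂ enum (dst e)) (∈-bySource⁺ e∈)

  ∈-sorted⁻ : ∀ {e} → e ∈ sortedEdges → e ∈ edges
  ∈-sorted⁻ e∈ = ∈-bySource⁻ (proj₂ (ByTarget.∈-bucketSort⁻ vs e∈))

  private
    -- The sorts start with the tie-break `_≢_`, supplied by the duplicate-free edge list, so
    -- distinctness passes through both of them.
    bySource-sorted : AllPairs (λ d e → src d ≺ src e ⊎ (src d ≡ src e × d ≢ e)) bySource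
    bySource-sorted = BySource.bucketSort-sorted vs (proj₁ enum) unique

    sorted : AllPairs (λ d e → dst d ≺ dst e ⊎
               (dst d ≡ dst e × (src d ≺ src e ⊎ (src d ≡ src e × d ≢ e)))) sortedEdges
    sorted = ByTarget.bucketSort-sorted vs (proj₁ enum) bySource-sorted

  ≺⇒≢ : ∀ {u v} → u ≺ v → u ≢ v
  ≺⇒≢ p refl = ≺-irrefl refl p

  unique-bySource : Unique bySource
  unique-bySource = AllPairs.map (λ { (inj₁ p) refl → ≺⇒≢ p refl ; (inj₂ (_ , q)) → q }) bySource-sorted

  unique-sorted : Unique sortedEdges
  unique-sorted = AllPairs.map (λ { (inj₁ p) refl → ≺⇒≢ p refl
    ; (inj₂ (_ , inj₁ p)) refl → ≺⇒≢ p refl ; (inj₂ (_ , inj₂ (_ , q))) → q }) sorted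

  length-bySource : length bySource ≡ #E
  length-bySource = ≤-antisym (length-mono-⊆ unique-bySource ∈-bySource⁻) (length-mono-⊆ unique ∈-bySource⁺)

  length-sorted : length sortedEdges ≡ #E
  length-sorted = ≤-antisym (length-mono-⊆ unique-sorted ∈-sorted⁻) (length-mono-⊆ unique ∈-sorted⁺)

  length-vs : length vs ≡ #V
  length-vs = trans (≤-antisym
      (length-mono-⊆ (AllPairs.map ≺⇒≢ (proj₁ enum)) (λ _ → ∈-allFin _))
      (length-mono-⊆ (Unique.allFin⁺ #V) (λ _ → proj₂ enum _)))
    (length-tabulate (λ i → i))

  -- By W1, W2 and determinism, sorting by target and then by source also sorts
  -- by label and then by source.
  sorted-⊏ : AllPairs _⊏_ sortedEdges
  sorted-⊏ = AllPairs.map (λ (p , q , r) → ⊏-intro p q r) (allPairs-zip (All.tabulate ∈-sorted⁻) sorted)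
    where
    ⊏-intro : ∀ {d e} → d ∈ edges → e ∈ edges →
              dst d ≺ dst e ⊎ (dst d ≡ dst e × (src d ≺ src e ⊎ (src d ≡ src e × d ≢ e))) → d ⊏ e
    ⊏-intro {d} {e} d∈ e∈ (inj₁ p) = before (inj₁ p)
      (≮⇒≥ (λ q → ≺-≼-absurd p (inj₁ (W1 e∈ d∈ q))))
      (λ q → src≺ (Fin.toℕ-injective q))
      where
      src≺ : lab d ≡ lab e → src d ≺ src e
      src≺ refl with ≺-compare (src d) (src e)
      ... | tri< r _ _    = r
      -- W2 only excludes sources in the opposite order; equal sources are excluded by determinism,
      -- as the targets differ.
      ... | tri≈ _ refl _ = ⊥-elim (≺⇒≢ p (det d∈ e∈))
      ... | tri> _ _ r    = ⊥-elim (≺-≼-absurd p (W2 e∈ d∈ refl r))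
    ⊏-intro {d} {e} d∈ e∈ (inj₂ (refl , p)) = before (inj₂ refl)
      (≮⇒≥ (λ q → ≺⇒≢ (W1 e∈ d∈ q) refl)) (λ _ → src≺ p)
      where
      src≺ : src d ≺ src e ⊎ (src d ≡ src e × d ≢ e) → src d ≺ src e
      src≺ (inj₁ q) = q
      -- Parallel edges with different labels would put their common target before itself by W1, so
      -- two parallel edges coincide.
      src≺ (inj₂ (refl , q)) with Fin.<-cmp (lab d) (lab e)
      ... | tri< r _ _    = ⊥-elim (≺⇒≢ (W1 d∈ e∈ r) refl)
      ... | tri≈ _ refl _ = ⊥-elim (q refl)
      ... | tri> _ _ r    = ⊥-elim (≺⇒≢ (W1 e∈ d∈ r) refl)

-- The program

module _ {A : Set} where

  nth-snoc⁻ : ∀ (xs : List A) {x} i {y} → nth (xs ++ x ∷ []) i ≡ just y →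
              nth xs i ≡ just y ⊎ (i ≡ length xs × y ≡ x)
  nth-snoc⁻ []       zero    refl = inj₂ (refl , refl)
  nth-snoc⁻ []       (suc zero) ()
  nth-snoc⁻ []       (suc (suc i)) ()
  nth-snoc⁻ (z ∷ xs) zero    e    = inj₁ e
  nth-snoc⁻ (z ∷ xs) (suc i) e with nth-snoc⁻ xs i e
  ... | inj₁ e′        = inj₁ e′
  ... | inj₂ (i≡ , y≡) = inj₂ (cong suc i≡ , y≡)

  drop-nth : ∀ (xs : List A) i {x} → nth xs i ≡ just x → drop i xs ≡ x ∷ drop (suc i) xs
  drop-nth (x ∷ xs) zero    refl = refl
  drop-nth (x ∷ xs) (suc i) e    = drop-nth xs i e

  take-nth : ∀ (xs : List A) i {x} → nth xs i ≡ just x → take (suc i) xs ≡ take i xs ++ x ∷ []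
  take-nth (x ∷ xs) zero    refl = refl
  take-nth (x ∷ xs) (suc i) e    = cong (x ∷_) (take-nth xs i e)

  split-nth : ∀ (xs : List A) i {x} → nth xs i ≡ just x → xs ≡ take i xs ++ x ∷ drop (suc i) xs
  split-nth (x ∷ xs) zero    refl = refl
  split-nth (x ∷ xs) (suc i) e    = cong (x ∷_) (split-nth xs i e)

vZ vV vE v1 vK v4 vI vJ vR vP vO vD vH vU vT vA vF vL vN vX vY vCount vTop vLetter vPos vQ : Var
vZ = 0 ; vV = 1 ; vE = 2 ; v1 = 3 ; vK = 4 ; v4 = 5 ; vI = 6 ; vJ = 7 ; vR = 8 ; vP = 9 ; vO = 10
vD = 11 ; vH = 12 ; vU = 13 ; vT = 14 ; vA = 15 ; vF = 16 ; vL = 17 ; vN = 18 ; vX = 19 ; vY = 20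
vCount = 21 ; vTop = 22 ; vLetter = 23 ; vPos = 24 ; vQ = 25

-- S, D and A are the sources, targets and labels of the edges; primed fields
-- hold the output of a sort or of a scan.
fOrder fS fD fA fHead fDegree fNext fS′ fD′ fA′ fFirst fEnd fFirst′ fEnd′ : Field
fOrder = 0 ; fS = 1 ; fD = 2 ; fA = 3 ; fHead = 4 ; fDegree = 5 ; fNext = 6
fS′ = 7 ; fD′ = 8 ; fA′ = 9 ; fFirst = 10 ; fEnd = 11 ; fFirst′ = 12 ; fEnd′ = 13

#fields : ℕ
#fields = 14

pushAt : Field → Cmd
pushAt key =
  vPos := vPos ⊖ v1 ⨾
  vU := key ⟨ vPos ⟩ ⨾
  vH := fHead ⟨ vU ⟩ ⨾
  fNext ⟨ vPos ⟩:= vH ⨾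
  fHead ⟨ vU ⟩:= vPos ⨾
  vD := fDegree ⟨ vU ⟩ ⨾
  vD := vD ⊕ v1 ⨾
  fDegree ⟨ vU ⟩:= vD

-- Positions are handled from the last to the first, so pushing to the front of a list restores the
-- original order within each bucket and the pass is stable. As `vZ` holds 0, `x := y ⊖ vZ` is a
-- copy.
push : Field → Cmd
push key = vPos := vE ⊖ vZ ⨾ FOR vI < vE DO pushAt key

emit : Cmd
emit =
  vX := fS ⟨ vP ⟩ ⨾ fS′ ⟨ vO ⟩:= vX ⨾
  vX := fD ⟨ vP ⟩ ⨾ fD′ ⟨ vO ⟩:= vX ⨾
  vX := fA ⟨ vP ⟩ ⨾ fA′ ⟨ vO ⟩:= vX ⨾
  vP := fNext ⟨ vP ⟩ ⨾
  vO := vO ⊕ v1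

collectAt : Cmd
collectAt =
  vU := fOrder ⟨ vI ⟩ ⨾
  vP := fHead ⟨ vU ⟩ ⨾
  vD := fDegree ⟨ vU ⟩ ⨾
  FOR vJ < vD DO emit

collect : Cmd
collect = vO :=# 0 ⨾ FOR vI < vV DO collectAt

copyBack : Cmd
copyBack = FOR vI < vE DO (
  vX := fS′ ⟨ vI ⟩ ⨾ fS ⟨ vI ⟩:= vX ⨾
  vX := fD′ ⟨ vI ⟩ ⨾ fD ⟨ vI ⟩:= vX ⨾
  vX := fA′ ⟨ vI ⟩ ⨾ fA ⟨ vI ⟩:= vX)

fill : Field → Var → Cmd
fill f x = FOR vI < vV DO (f ⟨ vI ⟩:= x)

-- Only the degrees are cleared for the next pass: they delimit the lists, so stale heads and links
-- are never followed.
pass : Field → Cmd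
pass key = push key ⨾ collect ⨾ copyBack ⨾ fill fDegree vZ

-- Verification of the sorting passes

module Columns {nV nΣ : ℕ} where

  private
    Edge = Fin nV × Fin nV × Fin nΣ

  Holds : (S D A : ℕ → ℕ) → ℕ → Edge → Set
  Holds S D A p (u , v , a) = S p ≡ toℕ u × D p ≡ toℕ v × A p ≡ toℕ a

  HoldsAll : (S D A : ℕ → ℕ) → List Edge → Set
  HoldsAll S D A es = ∀ p {e} → nth es p ≡ just e → Holds S D A p e

  holdsAll-snoc : ∀ {S D A es e o s d a} → o ≡ length es → HoldsAll S D A es →
    s ≡ toℕ (proj₁ e) → d ≡ toℕ (proj₁ (proj₂ e)) → a ≡ toℕ (proj₂ (proj₂ e)) →
    HoldsAll (S [ o ≔ s ]) (D [ o ≔ d ]) (A [ o ≔ a ]) (es ++ e ∷ [])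
  holdsAll-snoc {S} {D} {A} {es} refl h refl refl refl p eq with nth-snoc⁻ es p eq
  ... | inj₁ eq′ rewrite ≢⇒≡ᵇ (<⇒≢ (nth⇒< es p eq′)) = h p eq′
  ... | inj₂ (refl , refl) rewrite ≡ᵇ-refl (length es) = refl , refl , refl

  module Lists (key : Edge → Fin nV) (nE : ℕ) (S D A : ℕ → ℕ) where
    open BucketSort Fin._≟_ key

    -- A linked list of positions in [lo, nE), starting at h, holding es.
    Chain : (nx : ℕ → ℕ) (lo h : ℕ) → List Edge → Set
    Chain nx lo h []       = ⊤
    Chain nx lo h (e ∷ es) = lo ≤ h × h < nE × Holds S D A h e × Chain nx lo (nx h) es

    -- The reason for the lower bound in `Chain`: a link written at `j` cannot disturb lists that
    -- use later positions only.
    chain-update : ∀ {nx j z h} es → Chain nx (suc j) h es → Chain (nx [ j ≔ z ]) j h es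
    chain-update []       c                 = tt
    chain-update {nx} {j} {z} {h} (e ∷ es) (j<h , h< , at , c) =
      <⇒≤ j<h , h< , at ,
      subst (λ h′ → Chain (nx [ j ≔ z ]) j h′ es) (sym (≔-other nx z (λ h≡j → <⇒≢ j<h (sym h≡j))))
        (chain-update es c)

    Buckets : (nx hd dg : ℕ → ℕ) → ℕ → List Edge → Set
    Buckets nx hd dg lo es = ∀ u →
      Chain nx lo (hd (toℕ u)) (bucket u es) × dg (toℕ u) ≡ length (bucket u es)

    buckets-push : ∀ nx hd dg {j k one es e} →
      Buckets nx hd dg (suc j) es → j < nE → Holds S D A j e → k ≡ toℕ (key e) → one ≡ 1 →
      Buckets (nx [ j ≔ hd k ]) (hd [ k ≔ j ]) (dg [ k ≔ dg k + one ]) j (e ∷ es)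
    buckets-push nx hd dg {j} {es = es} {e} b j<nE at refl refl u with key e Fin.≟ u
    ... | yes refl
      rewrite ≡ᵇ-refl (toℕ (key e)) | ≡ᵇ-refl j =
      (≤-refl , j<nE , at , chain-update (bucket (key e) es) (proj₁ (b (key e)))) ,
      trans (+-comm _ 1) (cong suc (proj₂ (b (key e))))
    ... | no ke≢u
      rewrite ≢⇒≡ᵇ {toℕ u} {toℕ (key e)} (λ eq → ke≢u (sym (Fin.toℕ-injective eq))) =
      chain-update (bucket u es) (proj₁ (b u)) , proj₂ (b u)

module Passes {nV nΣ : ℕ} (nE : ℕ) (input : ℕ → ℕ) (B M W : ℕ)
  (nV<M : nV < M) (nE<M : nE < M) (1+nE<W : suc nE < W)
  (vs : List (Fin nV)) (length-vs : length vs ≡ nV) where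

  open Hoare input B M W
  open Columns {nV} {nΣ}

  private
    Edge = Fin nV × Fin nV × Fin nΣ

  record Constants (σ : Store) : Set where
    field
      zero≡ : env σ vZ ≡ 0
      one≡  : env σ v1 ≡ 1
      nV≡   : env σ vV ≡ nV
      nE≡   : env σ vE ≡ nE
  open Constants public

  constants : ∀ {c σ τ} → Frame c σ τ →
    assigns c vZ ≡ false → assigns c v1 ≡ false → assigns c vV ≡ false → assigns c vE ≡ false →
    Constants σ → Constants τ
  constants fr p q r s k = record
    { zero≡ = trans (var fr vZ p) (zero≡ k)
    ; one≡  = trans (var fr v1 q) (one≡ k)
    ; nV≡   = trans (var fr vV r) (nV≡ k)
    ; nE≡   = trans (var fr vE s) (nE≡ k)
    }

  -- Meant for straight-line commands, whose cost computes to a numeral; matching the equation with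
  -- `refl` makes later goals speak of the explicit store.
  exec : ∀ {c σ} → Ok B M W c σ → Run c σ (cost c σ) (λ τ → τ ≡ run c σ)
  exec o = ran o ≤-refl refl

  Stored Stored′ : Store → List Edge → Set
  Stored  σ = HoldsAll (arr σ fS) (arr σ fD) (arr σ fA)
  Stored′ σ = HoldsAll (arr σ fS′) (arr σ fD′) (arr σ fA′)

  stored : ∀ {c σ τ es} → Frame c σ τ →
    writes c fS ≡ false → writes c fD ≡ false → writes c fA ≡ false → Stored σ es → Stored τ es
  stored fr p q r st rewrite fld fr fS p | fld fr fD q | fld fr fA r = st

  Ordered : Store → Set
  Ordered σ = ∀ p {v} → nth vs p ≡ just v → arr σ fOrder p ≡ toℕ v

  toℕ<M : (v : Fin nV) → toℕ v < M
  toℕ<M v = <-trans (Fin.toℕ<n v) nV<M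

  run-fill : ∀ f x {σ} → Constants σ → (x ≡ᵇ vI) ≡ false →
    Run (fill f x) σ (3 + nV * 10) (λ τ → ∀ p → p < nV → arr τ f p ≡ env σ x)
  run-fill f x {σ} k x≢I = consequence
    (≤-reflexive (cong (λ n → 3 + n * 10) (nV≡ k))) (λ _ _ q → q)
    (run-for-uniform (λ i τ → ∀ p → p < i → arr τ f p ≡ env σ x) 6 (λ _ ())
      (λ i τ i<n fr inv → ran (<-trans (subst (i <_) (nV≡ k) i<n) nV<M) ≤-refl (body i τ fr inv))
      (λ τ inv p p<n → inv p (subst (p <_) (sym (nV≡ k)) p<n)))
    where
    body : ∀ i τ → Frame (fill f x) σ τ → (∀ p → p < i → arr τ f p ≡ env σ x) →
           ∀ p → p < suc i → arr (run (f ⟨ vI ⟩:= x) (τ ⟦ vI ≔ i ⟧)) f p ≡ env σ x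
    body i τ fr inv p (s≤s p≤i) rewrite ≡ᵇ-refl f | x≢I with p ≟ i
    ... | yes refl rewrite ≡ᵇ-refl p = var fr x (cong (_∨ false) x≢I)
    ... | no p≢i rewrite ≢⇒≡ᵇ p≢i = inv p (≤∧≢⇒< p≤i p≢i)

  run-copyBack : ∀ {σ es} → Constants σ → length es ≡ nE → Stored′ σ es →
    Run copyBack σ (3 + nE * 40) (λ τ → Stored τ es)
  run-copyBack {σ} {es} k len st′ = consequence
    (≤-reflexive (cong (λ n → 3 + n * 40) (nE≡ k))) (λ _ _ q → q)
    (run-for-uniform
      (λ i τ → ∀ p → p < i → arr τ fS p ≡ arr σ fS′ p × arr τ fD p ≡ arr σ fD′ p × arr τ fA p ≡ arr σ fA′ p)
      36 (λ _ ())
      (λ i τ i<n fr inv → let i<M = <-trans (subst (i <_) (nE≡ k) i<n) nE<M in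
        ran (i<M , i<M , i<M , i<M , i<M , i<M) ≤-refl (body i τ fr inv))
      (λ τ inv p eq →
        let p₁ , p₂ , p₃ = inv p (subst (p <_) (trans len (sym (nE≡ k))) (nth⇒< es p eq))
            q₁ , q₂ , q₃ = st′ p eq
        in trans p₁ q₁ , trans p₂ q₂ , trans p₃ q₃))
    where
    body : ∀ i τ → Frame copyBack σ τ →
      (∀ p → p < i → arr τ fS p ≡ arr σ fS′ p × arr τ fD p ≡ arr σ fD′ p × arr τ fA p ≡ arr σ fA′ p) →
      ∀ p → p < suc i →
      (arr τ fS [ i ≔ arr τ fS′ i ]) p ≡ arr σ fS′ p ×
      (arr τ fD [ i ≔ arr τ fD′ i ]) p ≡ arr σ fD′ p ×
      (arr τ fA [ i ≔ arr τ fA′ i ]) p ≡ arr σ fA′ p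
    body i τ fr inv p (s≤s p≤i) with p ≟ i
    ... | yes refl rewrite ≡ᵇ-refl p =
      cong-app (fld fr fS′ refl) p , cong-app (fld fr fD′ refl) p , cong-app (fld fr fA′ refl) p
    ... | no p≢i rewrite ≢⇒≡ᵇ p≢i = inv p (≤∧≢⇒< p≤i p≢i)

  module _ (fk : Field) (key : Edge → Fin nV)
    (select : ∀ σ {p e} → Holds (arr σ fS) (arr σ fD) (arr σ fA) p e → arr σ fk p ≡ toℕ (key e)) where

    open BucketSort Fin._≟_ key

    Chains : Store → Store → ℕ → List Edge → Set
    Chains σ τ = Lists.Buckets key nE (arr σ fS) (arr σ fD) (arr σ fA)
                   (arr τ fNext) (arr τ fHead) (arr τ fDegree)

    run-push : ∀ {σ es} → Constants σ → length es ≡ nE → Stored σ es →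
      (∀ p → p < nV → arr σ fDegree p ≡ 0) →
      Run (push fk) σ (1 + (3 + nE * 42)) (λ τ → Chains σ τ 0 es)
    run-push {σ} {es} k len st deg0 =
      exec z≤0 >> λ { σ₁ _ refl → consequence (≤-reflexive (cong (λ n → 3 + n * 42) (nE≡ k)))
        (λ _ _ q → q)
        (run-for-uniform Inv 38 (start , startChains)
        (λ i τ i<n fr (pos , ch) → body i τ (subst (i <_) (nE≡ k) i<n) fr pos ch)
        (λ τ (pos , ch) → subst₂ (Chains σ τ) (final τ pos) (cong (λ j → drop j es) (final τ pos)) ch)) }
      where
      z≤0 : env σ vZ ≤ env σ vE
      z≤0 = ≤-trans (≤-reflexive (zero≡ k)) z≤n
      Inv : ℕ → Store → Set
      Inv i τ = env τ vPos + i ≡ nE × Chains σ τ (env τ vPos) (drop (env τ vPos) es)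
      pos₀ : env σ vE ∸ env σ vZ ≡ nE
      pos₀ = cong₂ _∸_ (nE≡ k) (zero≡ k)
      start : env σ vE ∸ env σ vZ + 0 ≡ nE
      start = trans (+-identityʳ _) pos₀
      startChains : Chains σ σ (env σ vE ∸ env σ vZ) (drop (env σ vE ∸ env σ vZ) es)
      startChains u rewrite pos₀ | drop-all nE es (≤-reflexive len) = tt , deg0 (toℕ u) (Fin.toℕ<n u)
      final : ∀ τ → env τ vPos + env σ vE ≡ nE → env τ vPos ≡ 0
      final τ pos = +-cancelʳ-≡ nE _ 0 (trans (cong (env τ vPos +_) (sym (nE≡ k))) pos)
      σ₁ : Store
      σ₁ = run (vPos := vE ⊖ vZ) σ
      body : ∀ i τ → i < nE → Frame (FOR vI < vE DO pushAt fk) σ₁ τ → env τ vPos + i ≡ nE →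
             Chains σ τ (env τ vPos) (drop (env τ vPos) es) →
             Run (pushAt fk) (τ ⟦ vI ≔ i ⟧) 38 (Inv (suc i))
      body i τ i<nE fr pos ch = ran
        (one≤ , j<M , k<M , j<M , k<M , k<M , deg< , k<M) ≤-refl
        (trans (+-suc j i) (trans (cong (_+ i) suc-j) pos) ,
         subst (Chains σ (run (pushAt fk) (τ ⟦ vI ≔ i ⟧)) j)
           (sym (drop-nth es j eq))
           (Lists.buckets-push key nE (arr σ fS) (arr σ fD) (arr σ fA)
             (arr τ fNext) (arr τ fHead) (arr τ fDegree)
             (subst (λ j → Chains σ τ j (drop j es)) (sym suc-j) ch)
             j<nE (st j eq) k≡ one))
        where
        one : env τ v1 ≡ 1
        one = trans (var fr v1 refl) (one≡ k)
        pos>0 : 1 ≤ env τ vPos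
        pos>0 with env τ vPos
        ... | zero  = ⊥-elim (<-irrefl pos i<nE)
        ... | suc _ = s≤s z≤n
        j : ℕ
        j = env τ vPos ∸ env τ v1
        suc-j : suc j ≡ env τ vPos
        suc-j = trans (cong (λ n → suc (env τ vPos ∸ n)) one) (m+[n∸m]≡n pos>0)
        one≤ : env τ v1 ≤ env τ vPos
        one≤ = subst (_≤ env τ vPos) (sym one) pos>0
        j<nE : j < nE
        j<nE = ≤-trans (≤-reflexive suc-j) (≤-trans (m≤m+n _ i) (≤-reflexive pos))
        j<M : j < M
        j<M = <-trans j<nE nE<M
        e = proj₁ (<⇒nth es {j} (subst (j <_) (sym len) j<nE))
        eq : nth es j ≡ just e
        eq = proj₂ (<⇒nth es {j} (subst (j <_) (sym len) j<nE))
        k≡ : arr τ fk j ≡ toℕ (key e)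
        k≡ = select τ (stored fr refl refl refl st j eq)
        k<M : arr τ fk j < M
        k<M = subst (_< M) (sym k≡) (toℕ<M (key e))
        deg< : arr τ fDegree (arr τ fk j) + env τ v1 < W
        deg< = ≤-<-trans (≤-trans (≤-reflexive (trans (cong₂ _+_
            (trans (cong (arr τ fDegree) k≡) (proj₂ (ch (key e)))) one) (+-comm _ 1)))
          (s≤s (≤-trans (length-filter _ (drop (env τ vPos) es))
            (≤-trans (≤-reflexive (length-drop (env τ vPos) es)) (≤-trans (m∸n≤m _ (env τ vPos)) (≤-reflexive len))))))
          1+nE<W

    bucketSort-snoc : ∀ us v es → bucketSort (us ++ v ∷ []) es ≡ bucketSort us es ++ bucket v es
    bucketSort-snoc us v es = trans (concatMap-++ (λ u → bucket u es) us (v ∷ []))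
      (cong (bucketSort us es ++_) (++-identityʳ (bucket v es)))

    length-bucketSort-take : ∀ i es → length (bucketSort (take i vs) es) ≤ length (bucketSort vs es)
    length-bucketSort-take i es = ≤-trans (m≤m+n _ (length (bucketSort (drop i vs) es)))
      (≤-reflexive (trans (sym (length-++ (bucketSort (take i vs) es)))
        (cong length (trans (sym (concatMap-++ (λ u → bucket u es) (take i vs) (drop i vs)))
          (cong (λ us → bucketSort us es) (take++drop≡id i vs))))))

    -- A uniform bound on the inner loop would give a product of `nV` and `nE`. Instead each vertex
    -- is charged 25 and each emitted edge 47, and the buckets together contain `nE` edges. `σ₀` is
    -- the store before the lists were built, to whose columns the chains refer.
    run-collect : ∀ {σ es} σ₀ → Constants σ → Ordered σ → length (bucketSort vs es) ≡ nE →
      Stored σ₀ es → arr σ fS ≡ arr σ₀ fS → arr σ fD ≡ arr σ₀ fD → arr σ fA ≡ arr σ₀ fA →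
      Chains σ₀ σ 0 es →
      Run collect σ (1 + (3 + (nV * 25 + nE * 47))) (λ τ → Stored′ τ (bucketSort vs es))
    run-collect {σ} {es} σ₀ k ord len st eqS eqD eqA ch =
      exec (≤-<-trans z≤n 1+nE<W) >> λ { σ₁ _ refl → consequence time≤ (λ _ _ q → q)
        (run-for Outer (λ i → i * 25 + length (sorted i) * 47)
          (refl , λ { zero () ; (suc _) () })
          (λ i τ i<n fr inv → body i τ (subst (i <_) (nV≡ k) i<n) fr inv)
          (λ τ (_ , h) → subst (Stored′ τ) sorted-all h)) }
      where
      sorted : ℕ → List Edge
      sorted i = bucketSort (take i vs) es

      sorted-all : sorted (env σ vV) ≡ bucketSort vs es
      sorted-all = cong (λ us → bucketSort us es)
        (take-all (env σ vV) vs (≤-reflexive (trans length-vs (sym (nV≡ k)))))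

      time≤ : 3 + (env σ vV * 25 + length (sorted (env σ vV)) * 47) ≤ 3 + (nV * 25 + nE * 47)
      time≤ = ≤-reflexive (cong (3 +_) (cong₂ (λ a b → a * 25 + b * 47) (nV≡ k)
        (trans (cong length sorted-all) len)))

      Outer : ℕ → Store → Set
      Outer i τ = env τ vO ≡ length (sorted i) × Stored′ τ (sorted i)

      σ₁ : Store
      σ₁ = run (vO :=# 0) σ

      body : ∀ i τ → i < nV → Frame (FOR vI < vV DO collectAt) σ₁ τ → Outer i τ →
             ∃[ t ] Run collectAt (τ ⟦ vI ≔ i ⟧) t (Outer (suc i)) ×
                    i * 25 + length (sorted i) * 47 + (4 + t) ≤ suc i * 25 + length (sorted (suc i)) * 47
      body i τ i<nV fr (out , h) = 6 + (6 + (6 + (3 + length bs * 47))) ,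
        (exec i<M >> λ { _ _ refl → exec u<M >> λ { _ _ refl → exec u<M >> λ { _ _ refl →
          consequence (≤-reflexive (cong (λ n → 3 + n * 47) deg)) (λ _ _ q → q)
            (run-for-uniform Inner 43 start inner finish) }}}) ,
        ≤-reflexive time≡
        where
        i<M = <-trans i<nV nV<M
        v = proj₁ (<⇒nth vs {i} (subst (i <_) (sym length-vs) i<nV))
        v≡ : nth vs i ≡ just v
        v≡ = proj₂ (<⇒nth vs {i} (subst (i <_) (sym length-vs) i<nV))
        bs = bucket v es
        u = arr τ fOrder i
        u≡ : u ≡ toℕ v
        u≡ = trans (cong-app (fld fr fOrder refl) i) (ord i v≡)
        u<M : u < M
        u<M = subst (_< M) (sym u≡) (toℕ<M v)
        sorted-suc : sorted (suc i) ≡ sorted i ++ bs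
        sorted-suc = trans (cong (λ us → bucketSort us es) (take-nth vs i v≡))
          (bucketSort-snoc (take i vs) v es)
        deg : arr τ fDegree u ≡ length bs
        deg = trans (cong-app (fld fr fDegree refl) u) (trans (cong (arr σ fDegree) u≡) (proj₂ (ch v)))
        time≡ : i * 25 + length (sorted i) * 47 + (4 + (6 + (6 + (6 + (3 + length bs * 47)))))
                ≡ suc i * 25 + length (sorted (suc i)) * 47
        time≡ = trans (regroup i (length (sorted i)) (length bs))
          (cong (λ n → suc i * 25 + n * 47) (sym (trans (cong length sorted-suc) (length-++ (sorted i)))))
          where
          regroup : ∀ i a b → i * 25 + a * 47 + (4 + (6 + (6 + (6 + (3 + b * 47))))) ≡ suc i * 25 + (a + b) * 47
          regroup = solve-∀

        Chain : ℕ → List Edge → Set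
        Chain = Lists.Chain key nE (arr σ₀ fS) (arr σ₀ fD) (arr σ₀ fA) (arr σ fNext) 0

        Inner : ℕ → Store → Set
        Inner j ρ = Chain (env ρ vP) (drop j bs) × env ρ vO ≡ length (sorted i ++ take j bs) ×
                    Stored′ ρ (sorted i ++ take j bs)

        σ₂ : Store
        σ₂ = τ ⟦ vI ≔ i ⟧ ⟦ vU ≔ u ⟧ ⟦ vP ≔ arr τ fHead u ⟧ ⟦ vD ≔ arr τ fDegree u ⟧

        start : Inner 0 σ₂
        start = subst (λ p → Chain p bs)
            (sym (trans (cong-app (fld fr fHead refl) u) (cong (arr σ fHead) u≡))) (proj₁ (ch v)) ,
          trans out (cong length (sym (++-identityʳ (sorted i)))) ,
          subst (Stored′ τ) (sym (++-identityʳ (sorted i))) h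

        inner : ∀ j ρ → j < env σ₂ vD → Frame (FOR vJ < vD DO emit) σ₂ ρ → Inner j ρ →
                Run emit (ρ ⟦ vJ ≔ j ⟧) 43 (Inner (suc j))
        inner j ρ j<d fr′ (c , o≡ , h′) with e , e≡ ← <⇒nth bs {j} (subst (j <_) deg j<d)
          with _ , p<nE , (s≡ , d≡ , a≡) , c′ ← subst (Chain (env ρ vP)) (drop-nth bs j e≡) c =
          ran (p<M , o<M , p<M , o<M , p<M , o<M , p<M , o+1<W) ≤-refl
          ( subst (λ p → Chain p (drop (suc j) bs))
              (sym (cong-app (trans (fld fr′ fNext refl) (fld fr fNext refl)) (env ρ vP))) c′
          , trans (cong₂ _+_ o≡ one) (sym (trans (cong length take≡)
              (length-++ (sorted i ++ take j bs))))
          , subst (Stored′ (run emit (ρ ⟦ vJ ≔ j ⟧))) (sym take≡)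
              (holdsAll-snoc {S = arr ρ fS′} {D = arr ρ fD′} {A = arr ρ fA′} o≡ h′
                (trans (same fS refl refl eqS) s≡) (trans (same fD refl refl eqD) d≡)
                (trans (same fA refl refl eqA) a≡)))
          where
          same : ∀ f → writes emit f ≡ false → writes collectAt f ≡ false → arr σ f ≡ arr σ₀ f →
                 arr ρ f (env ρ vP) ≡ arr σ₀ f (env ρ vP)
          same f q r eq = cong-app (trans (fld fr′ f q) (trans (fld fr f r) eq)) (env ρ vP)
          p<M = <-trans p<nE nE<M
          one : env ρ v1 ≡ 1
          one = trans (var fr′ v1 refl) (trans (var fr v1 refl) (one≡ k))
          take≡ : sorted i ++ take (suc j) bs ≡ (sorted i ++ take j bs) ++ e ∷ []
          take≡ = trans (cong (sorted i ++_) (take-nth bs j e≡)) (sym (++-assoc (sorted i) (take j bs) (e ∷ [])))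
          -- The edges emitted so far and the next one form a prefix of the sorted list, which has
          -- `nE` entries.
          o<nE : env ρ vO < nE
          o<nE = begin
            suc (env ρ vO)                                  ≡⟨ cong suc o≡ ⟩
            suc (length (sorted i ++ take j bs))            ≡⟨ cong suc (length-++ (sorted i)) ⟩
            suc (length (sorted i) + length (take j bs))    ≡⟨ +-suc _ _ ⟨
            length (sorted i) + suc (length (take j bs))    ≤⟨ +-monoʳ-≤ _ (s≤s (≤-trans (≤-reflexive (length-take j bs)) (m⊓n≤m j _))) ⟩
            length (sorted i) + suc j                       ≤⟨ +-monoʳ-≤ _ (nth⇒< bs j e≡) ⟩
            length (sorted i) + length bs                   ≡⟨ length-++ (sorted i) ⟨
            length (sorted i ++ bs)                         ≡⟨ cong length sorted-suc ⟨
            length (sorted (suc i))                         ≤⟨ length-bucketSort-take (suc i) es ⟩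
            length (bucketSort vs es)                       ≡⟨ len ⟩
            nE                                              ∎
            where open ≤-Reasoning
          o<M = <-trans o<nE nE<M
          o+1<W : env ρ vO + env ρ v1 < W
          o+1<W = ≤-<-trans (≤-trans (≤-reflexive (trans (cong (env ρ vO +_) one) (+-comm _ 1)))
            (s≤s (<⇒≤ o<nE))) 1+nE<W

        finish : ∀ ρ → Inner (env σ₂ vD) ρ → Outer (suc i) (ρ ⟦ vJ ≔ env σ₂ vD ⟧)
        finish ρ (_ , o≡ , h′) = trans o≡ (cong length all≡) , subst (Stored′ ρ) all≡ h′
          where
          all≡ : sorted i ++ take (env σ₂ vD) bs ≡ sorted (suc i)
          all≡ = trans (cong (sorted i ++_) (take-all _ bs (≤-reflexive (sym deg)))) (sym sorted-suc)

    passTime : ℕ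
    passTime = (1 + (3 + nE * 42)) + ((1 + (3 + (nV * 25 + nE * 47))) + ((3 + nE * 40) + (3 + nV * 10)))

    run-pass : ∀ {σ es} → Constants σ → Ordered σ → length es ≡ nE → length (bucketSort vs es) ≡ nE →
      Stored σ es → (∀ p → p < nV → arr σ fDegree p ≡ 0) →
      Run (pass fk) σ passTime (λ τ → Stored τ (bucketSort vs es) × (∀ p → p < nV → arr τ fDegree p ≡ 0))
    run-pass {σ} k ord len len′ st deg0 =
      run-push k len st deg0 >> λ σ₁ fr₁ ch →
      let k₁ = constants fr₁ refl refl refl refl k
          ord₁ = λ p {v} eq → trans (cong-app (fld fr₁ fOrder refl) p) (ord p {v} eq) in
      run-collect σ k₁ ord₁ len′ st (fld fr₁ fS refl) (fld fr₁ fD refl) (fld fr₁ fA refl) ch >>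
      λ σ₂ fr₂ st′ →
      let k₂ = constants fr₂ refl refl refl refl k₁ in
      run-copyBack k₂ len′ st′ >> λ σ₃ fr₃ st₃ →
      let k₃ = constants fr₃ refl refl refl refl k₂ in
      consequence ≤-refl
        (λ τ fr₄ deg → stored fr₄ refl refl refl st₃ , λ p p<nV → trans (deg p p<nV) (zero≡ k₃))
        (run-fill fDegree vZ k₃ refl)

-- Commands for loading and scanning

loadVertices loadEdges : Cmd
loadVertices = FOR vI < vV DO (vT := v4 ⊕ vI ⨾ vX :=in vT ⨾ fOrder ⟨ vI ⟩:= vX)
loadEdges =
  vQ := v4 ⊕ vV ⨾
  FOR vI < vE DO (
    vX :=in vQ ⨾ fS ⟨ vI ⟩:= vX ⨾ vQ := vQ ⊕ v1 ⨾
    vX :=in vQ ⨾ fD ⟨ vI ⟩:= vX ⨾ vQ := vQ ⊕ v1 ⨾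
    vX :=in vQ ⨾ fA ⟨ vI ⟩:= vX ⨾ vQ := vQ ⊕ v1)

-- The less significant key comes first, as in radix sort: the stable pass by target keeps the order
-- by source among equal targets. The last command turns every block into [0, 1), the block of the
-- empty word.
setup : Cmd
setup =
  loadVertices ⨾ loadEdges ⨾ pass fS ⨾ pass fD ⨾ fill fEnd v1

fetchEdge extendSweep sweepEdge sweepAll moveVertex : Cmd
fetchEdge =
  vU := fS ⟨ vI ⟩ ⨾ vT := fD ⟨ vI ⟩ ⨾ vA := fA ⟨ vI ⟩ ⨾
  vF := fFirst ⟨ vU ⟩ ⨾ vL := fEnd ⟨ vU ⟩
extendSweep =
  vN := vCount ⊖ vZ ⨾
  IF vF < vTop THEN vN := vN ⊖ v1 ELSE skip ⨾
  vD := vL ⊖ vF ⨾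
  vCount := vN ⊕ vD ⨾
  vTop := vL ⊖ vZ ⨾
  vX := fFirst′ ⟨ vT ⟩ ⨾
  vY := fEnd′ ⟨ vT ⟩ ⨾
  IF vX < vY THEN skip ELSE fFirst′ ⟨ vT ⟩:= vN ⨾
  fEnd′ ⟨ vT ⟩:= vCount
sweepEdge =
  fetchEdge ⨾
  IF vLetter < vA THEN vTop :=# 0 ELSE skip ⨾
  vLetter := vA ⊖ vZ ⨾
  IF vF < vL THEN extendSweep ELSE skip
sweepAll =
  vCount :=# 0 ⨾ vTop :=# 0 ⨾ vLetter :=# 0 ⨾
  FOR vI < vE DO sweepEdge
moveVertex =
  vX := fFirst′ ⟨ vI ⟩ ⨾ fFirst ⟨ vI ⟩:= vX ⨾ fFirst′ ⟨ vI ⟩:= vZ ⨾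
  vX := fEnd′ ⟨ vI ⟩ ⨾ fEnd ⟨ vI ⟩:= vX ⨾ fEnd′ ⟨ vI ⟩:= vZ

rounds : Cmd
rounds = FOR vR < vK DO (sweepAll ⨾ FOR vI < vV DO moveVertex)

readSizes : Cmd
readSizes =
  v1 :=# 1 ⨾ v4 :=# 4 ⨾ vT :=# 3 ⨾
  vV :=in vZ ⨾ vE :=in v1 ⨾ vK :=in vT

-- A graph without vertices contains no word, not even the empty one from which the rounds start;
-- the count then keeps its initial value 0.
main : Cmd
main = readSizes ⨾ IF vZ < vV THEN (setup ⨾ rounds) ELSE skip

-- Verification of the scan of one edge

module Sweeping {nV nΣ : ℕ} (nE : ℕ) (input : ℕ → ℕ) (B M W : ℕ)
  (nV<M : nV < M) (nE<M : nE < M) (1+nE<W : suc nE < W)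
  (vs : List (Fin nV)) (length-vs : length vs ≡ nV) where

  open Hoare input B M W
  open Columns {nV} {nΣ}
  open Passes {nV} {nΣ} nE input B M W nV<M nE<M 1+nE<W vs length-vs

  record Tracks (τ : Store) (m : Sweep) : Set where
    constructor tracks
    field
      count≡  : env τ vCount ≡ count m
      top≡    : env τ vTop ≡ top m
      letter≡ : env τ vLetter ≡ letter m
      first≡  : ∀ p → p < nV → arr τ fFirst′ p ≡ first m p
      end≡    : ∀ p → p < nV → arr τ fEnd′ p ≡ end m p
  open Tracks

  run-extendSweep : ∀ {τ C T f l g e} {v : Fin nV} →
    env τ vZ ≡ 0 → env τ v1 ≡ 1 → env τ vCount ≡ C → env τ vTop ≡ T →
    env τ vF ≡ f → env τ vL ≡ l → env τ vT ≡ toℕ v → f < l → (f < T → 1 ≤ C) →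
    let n = if f <ᵇ T then C ∸ 1 else C in n + (l ∸ f) < W →
    (∀ p → p < nV → arr τ fFirst′ p ≡ g p) → (∀ p → p < nV → arr τ fEnd′ p ≡ e p) →
    Run extendSweep τ 33 (λ ρ → env ρ vCount ≡ n + (l ∸ f) × env ρ vTop ≡ l ×
      (∀ p → p < nV → arr ρ fFirst′ p ≡ (if g (toℕ v) <ᵇ e (toℕ v) then g else g [ toℕ v ≔ n ]) p) ×
      (∀ p → p < nV → arr ρ fEnd′ p ≡ (e [ toℕ v ≔ n + (l ∸ f) ]) p))
  run-extendSweep {τ} {C} {T} {f} {l} {g} {e} {v} zero₀ one refl refl refl refl target f<l pos n< g≡ e≡ =
    exec (≤-trans (≤-reflexive zero₀) z≤n) >> λ { _ _ refl →
    run-if {t = 1} {Q = λ τ → env τ vN ≡ n}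
      (λ f<T → ran (subst₂ _≤_ (sym one) (sym C≡) (pos f<T)) ≤-refl
        (trans (cong₂ _∸_ C≡ one) (sym (cong (if_then C ∸ 1 else C) (<⇒<ᵇ≡true f<T)))))
      (λ T≤f → ran tt z≤n (trans C≡ (sym (cong (if_then C ∸ 1 else C) (≥⇒<ᵇ≡false T≤f)))))
    >> λ τ₁ fr₁ n₁ →
    let f₁ : env τ₁ vF ≡ f
        f₁ = var fr₁ vF refl
        l₁ : env τ₁ vL ≡ l
        l₁ = var fr₁ vL refl
        v₁ : env τ₁ vT ≡ toℕ v
        v₁ = trans (var fr₁ vT refl) target
        sum₁ : env τ₁ vN + (env τ₁ vL ∸ env τ₁ vF) ≡ n + (l ∸ f)
        sum₁ = cong₂ _+_ n₁ (cong₂ _∸_ l₁ f₁)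
        zero₁ : env τ₁ vZ ≡ 0
        zero₁ = trans (var fr₁ vZ refl) zero₀
        first₁ : ∀ p → p < nV → arr τ₁ fFirst′ p ≡ g p
        first₁ p p< = trans (cong-app (fld fr₁ fFirst′ refl) p) (g≡ p p<)
        end₁ : ∀ p → p < nV → arr τ₁ fEnd′ p ≡ e p
        end₁ p p< = trans (cong-app (fld fr₁ fEnd′ refl) p) (e≡ p p<)
        v<M : env τ₁ vT < M
        v<M = subst (_< M) (sym v₁) (toℕ<M v)
        at-v : ∀ {h h′ : ℕ → ℕ} → (∀ p → p < nV → h p ≡ h′ p) → h (env τ₁ vT) ≡ h′ (toℕ v)
        at-v {h} eq = trans (cong h v₁) (eq (toℕ v) (Fin.toℕ<n v))
    in
    exec (subst₂ _≤_ (sym f₁) (sym l₁) (<⇒≤ f<l)) >> λ { _ _ refl →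
    exec (subst (_< W) (sym sum₁) n<) >> λ { _ _ refl →
    exec (≤-trans (≤-reflexive zero₁) z≤n) >> λ { _ _ refl →
    exec v<M >> λ { _ _ refl →
    exec v<M >> λ { _ _ refl →
    run-if {t = 6} {Q = λ ρ → ∀ p → p < nV →
        arr ρ fFirst′ p ≡ (if g (toℕ v) <ᵇ e (toℕ v) then g else g [ toℕ v ≔ n ]) p}
      (λ x<y → ran tt z≤n λ p p< → trans (first₁ p p<) (sym (cong (λ b → (if b then g else g [ toℕ v ≔ n ]) p)
        (<⇒<ᵇ≡true (subst₂ _<_ (at-v first₁) (at-v end₁) x<y)))))
      (λ y≤x → ran v<M ≤-refl λ p p< → trans
        (cong₂ (λ u c → if p ≡ᵇ u then c else arr τ₁ fFirst′ p) v₁ n₁)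
        (trans (cong (if p ≡ᵇ toℕ v then n else_) (first₁ p p<))
        (sym (cong (λ b → (if b then g else g [ toℕ v ≔ n ]) p)
        (≥⇒<ᵇ≡false (subst₂ _≤_ (at-v end₁) (at-v first₁) y≤x))))))
    >> λ τ₂ fr₂ first₂ →
    ran (subst (_< M) (sym (var fr₂ vT refl)) v<M) ≤-refl
      ( trans (var fr₂ vCount refl) sum₁
      , trans (var fr₂ vTop refl) (trans (cong₂ _∸_ l₁ zero₁) refl)
      , first₂
      , λ p p< → cong₃if p (trans (var fr₂ vT refl) v₁) (trans (var fr₂ vCount refl) sum₁)
          (trans (cong-app (fld fr₂ fEnd′ refl) p) (end₁ p p<)) ) }}}}}}
    where
    n = if f <ᵇ T then C ∸ 1 else C
    C≡ : env τ vCount ∸ env τ vZ ≡ C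
    C≡ = cong (env τ vCount ∸_) zero₀
    cong₃if : ∀ p {u u′ c c′ d d′ : ℕ} → u ≡ u′ → c ≡ c′ → d ≡ d′ →
              (if p ≡ᵇ u then c else d) ≡ (if p ≡ᵇ u′ then c′ else d′)
    cong₃if p refl refl refl = refl

  run-sweepEdge : ∀ {σ m u v a p F L} → Constants σ → env σ vI ≡ p → p < M →
    arr σ fFirst ≡ F → arr σ fEnd ≡ L →
    Holds (arr σ fS) (arr σ fD) (arr σ fA) p (u , v , a) → Tracks σ m →
    let m′ = next F L m (toℕ u) (toℕ v) (toℕ a) in
    count m′ < W →
    (F (toℕ u) < nextTop F L m (toℕ u) (toℕ v) (toℕ a) → 1 ≤ count m) →
    Run sweepEdge σ 69 (λ τ → Tracks τ m′)
  run-sweepEdge {σ} {m} {u} {v} {a} {p} k refl p<M refl refl (s≡ , d≡ , a≡) tr count<W pos =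
    exec (p<M , p<M , p<M , s<M , s<M) >> λ { _ _ refl →
    run-if {t = 1} {Q = λ τ → env τ vTop ≡ top′}
      (λ lt → ran (≤-<-trans z≤n 1+nE<W) ≤-refl (sym (cong (if_then 0 else top m)
        (<⇒<ᵇ≡true (subst₂ _<_ (letter≡ tr) a≡ lt)))))
      (λ ge → ran tt z≤n (trans (top≡ tr) (sym (cong (if_then 0 else top m)
        (≥⇒<ᵇ≡false (subst₂ _≤_ a≡ (letter≡ tr) ge))))))
    >> λ τ₁ fr₁ top₁ →
    let zero₁ : env τ₁ vZ ≡ 0
        zero₁ = trans (var fr₁ vZ refl) (zero≡ k)
        first₁ : ∀ p → p < nV → arr τ₁ fFirst′ p ≡ first m p
        first₁ p p< = trans (cong-app (fld fr₁ fFirst′ refl) p) (first≡ tr p p<)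
        end₁ : ∀ p → p < nV → arr τ₁ fEnd′ p ≡ end m p
        end₁ p p< = trans (cong-app (fld fr₁ fEnd′ refl) p) (end≡ tr p p<)
        count₁ : env τ₁ vCount ≡ count m
        count₁ = trans (var fr₁ vCount refl) (count≡ tr)
        f₁ : env τ₁ vF ≡ F (toℕ u)
        f₁ = trans (var fr₁ vF refl) (cong F s≡)
        l₁ : env τ₁ vL ≡ L (toℕ u)
        l₁ = trans (var fr₁ vL refl) (cong L s≡)
        letter₁ : env τ₁ vA ∸ env τ₁ vZ ≡ toℕ a
        letter₁ = cong₂ _∸_ (trans (var fr₁ vA refl) a≡) zero₁
    in
    exec (≤-trans (≤-reflexive zero₁) z≤n) >> λ { _ _ refl →
    run-if
      (λ lt → let f<l = subst₂ _<_ f₁ l₁ lt in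
        consequence ≤-refl
          (λ τ fr (c , t , g , e) → subst (Tracks τ) (sym (next-yes f<l))
            (tracks c t (trans (var fr vLetter refl) letter₁) g e))
          (run-extendSweep {v = v} zero₁ (trans (var fr₁ v1 refl) (one≡ k)) count₁ top₁ f₁ l₁
            (trans (var fr₁ vT refl) d≡) f<l pos
            (subst (λ m → count m < W) (next-yes f<l) count<W) first₁ end₁))
      (λ ge → ran tt z≤n (subst (Tracks _) (sym (next-no (subst₂ _≤_ l₁ f₁ ge)))
        (tracks count₁ top₁ letter₁ first₁ end₁))) }}
    where
    F = arr σ fFirst
    L = arr σ fEnd
    top′ = nextTop F L m (toℕ u) (toℕ v) (toℕ a)
    n = startIndex F L m (toℕ u) (toℕ v) (toℕ a)
    N = n + (L (toℕ u) ∸ F (toℕ u))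
    s<M : arr σ fS p < M
    s<M = subst (_< M) (sym s≡) (toℕ<M u)
    next-yes : F (toℕ u) < L (toℕ u) → next F L m (toℕ u) (toℕ v) (toℕ a) ≡
      sweep N (L (toℕ u)) (toℕ a)
        (if first m (toℕ v) <ᵇ end m (toℕ v) then first m else first m [ toℕ v ≔ n ])
        (end m [ toℕ v ≔ N ])
    next-yes f<l rewrite <⇒<ᵇ≡true f<l = refl
    next-no : L (toℕ u) ≤ F (toℕ u) → next F L m (toℕ u) (toℕ v) (toℕ a) ≡
      sweep (count m) top′ (toℕ a) (first m) (end m)
    next-no l≤f rewrite ≥⇒<ᵇ≡false l≤f = refl

  -- Besides moving the new blocks it clears the primed fields, because the next scan starts from
  -- `initialSweep`.
  run-move : ∀ {σ} {g e : ℕ → ℕ} → Constants σ →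
    (∀ p → p < nV → arr σ fFirst′ p ≡ g p) → (∀ p → p < nV → arr σ fEnd′ p ≡ e p) →
    Run (FOR vI < vV DO moveVertex) σ (3 + nV * 40) (λ τ → ∀ p → p < nV →
      (arr τ fFirst p ≡ g p × arr τ fEnd p ≡ e p) × (arr τ fFirst′ p ≡ 0 × arr τ fEnd′ p ≡ 0))
  run-move {σ} {g} {e} k g≡ e≡ = consequence
    (≤-reflexive (cong (λ n → 3 + n * 40) (nV≡ k))) (λ _ _ q → q)
    (run-for-uniform Inv 36 ((λ _ ()) , λ p p< _ → g≡ p p< , e≡ p p<)
      (λ i τ i<n fr inv → let i<nV = subst (i <_) (nV≡ k) i<n ; i<M = <-trans i<nV nV<M in
        ran (i<M , i<M , i<M , i<M , i<M , i<M) ≤-refl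
            (done i τ (trans (var fr vZ refl) (zero≡ k)) i<nV inv , todo i τ inv))
      (λ τ (inv , _) p p<n → inv p (subst (p <_) (sym (nV≡ k)) p<n)))
    where
    Done Todo : Store → ℕ → Set
    Done τ p = (arr τ fFirst p ≡ g p × arr τ fEnd p ≡ e p) × (arr τ fFirst′ p ≡ 0 × arr τ fEnd′ p ≡ 0)
    Todo τ p = arr τ fFirst′ p ≡ g p × arr τ fEnd′ p ≡ e p
    Inv : ℕ → Store → Set
    Inv i τ = (∀ p → p < i → Done τ p) × (∀ p → p < nV → i ≤ p → Todo τ p)
    done : ∀ i τ → env τ vZ ≡ 0 → i < nV → Inv i τ →
           ∀ p → p < suc i → Done (run moveVertex (τ ⟦ vI ≔ i ⟧)) p
    done i τ zero₀ i<nV (d , t) p (s≤s p≤i) with p ≟ i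
    ... | yes refl rewrite ≡ᵇ-refl p = t p i<nV ≤-refl , (zero₀ , zero₀)
    ... | no p≢i rewrite ≢⇒≡ᵇ p≢i = d p (≤∧≢⇒< p≤i p≢i)
    todo : ∀ i τ → Inv i τ → ∀ p → p < nV → suc i ≤ p → Todo (run moveVertex (τ ⟦ vI ≔ i ⟧)) p
    todo i τ (d , t) p p<nV i<p rewrite ≢⇒≡ᵇ {p} {i} (λ p≡i → <⇒≢ i<p (sym p≡i)) =
      t p p<nV (<⇒≤ i<p)

inputLength : LabeledGraph → ℕ
inputLength G = 4 + #V + #E * 3
  where open LabeledGraph G

ReadsVertices : ∀ {n} → (ℕ → ℕ) → List (Fin n) → Set
ReadsVertices input vs = ∀ i {v} → nth vs i ≡ just v → input (4 + i) ≡ toℕ v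

-- The addresses have the form in which successive increments of `vQ` produce them.
ReadsEdges : LabeledGraph → (ℕ → ℕ) → Set
ReadsEdges G input = ∀ i {u v a} → nth edges i ≡ just (u , v , a) → let q = 4 + #V + i * 3 in
  input q ≡ toℕ u × input (q + 1) ≡ toℕ v × input (q + 1 + 1) ≡ toℕ a
  where open LabeledGraph G

-- Verification of the rounds and of the whole command

module Rounds (G : LabeledGraph) (_≺_ : Rel (LabeledGraph.Vertex G) 0ℓ)
  (det : Deterministic G) (wheeler : IsWheelerOrder G _≺_)
  (vs : List (LabeledGraph.Vertex G)) (enum : Enumerates G vs _≺_)
  (k : ℕ) (1≤k : 1 ≤ k) (input : ℕ → ℕ) (M W : ℕ)
  (#V<M : LabeledGraph.#V G < M) (#E<M : LabeledGraph.#E G < M) (B<W : inputLength G < W)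
  (kmers< : ∀ ℓ N → 1 ≤ ℓ → ℓ ≤ k → HasKmerCount G ℓ N → N < W)
  (input-V : input 0 ≡ LabeledGraph.#V G) (input-E : input 1 ≡ LabeledGraph.#E G)
  (input-k : input 3 ≡ k) (input-vertex : ReadsVertices input vs)
  (input-edge : ReadsEdges G input) where

  open LabeledGraph G
  open IsWheelerOrder wheeler using (isStrictTotalOrder)
  open Counting G _≺_ isStrictTotalOrder
  open Kmers G _≺_ isStrictTotalOrder
  open SortedEdges G _≺_ det wheeler vs enum

  B : ℕ
  B = inputLength G

  represents-cong : ∀ {ℓ αs F L F′ L′} {R : Word ℓ → Vertex → Set} →
    (∀ p → p < #V → F′ p ≡ F p × L′ p ≡ L p) → Represents R αs F L → Represents R αs F′ L′
  represents-cong {αs = αs} {F} {L} {F′} {L′} eq r = record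
    { unique-words = unique-words
    ; index   = λ {_} {v} p → let i , q , q′ , e = index p in
        i , subst (_≤ i) (sym (F≡ v)) q , subst (i <_) (sym (L≡ v)) q′ , e
    ; indexed = λ i {_} {v} q q′ e → indexed i (subst (_≤ i) (F≡ v) q) (subst (i <_) (L≡ v) q′) e
    ; sound   = sound
    ; bounded = λ v → subst (_≤ length αs) (sym (L≡ v)) (bounded v)
    ; ordered = λ {u} {v} u≺v p q → subst₂ (λ a b → a ≤ suc b) (sym (L≡ u)) (sym (F≡ v))
        (ordered u≺v (subst₂ _<_ (F≡ u) (L≡ u) p) (subst₂ _<_ (F≡ v) (L≡ v) q))
    }
    where
    open Represents r
    F≡ : ∀ (v : Vertex) → F′ (toℕ v) ≡ F (toℕ v)
    F≡ v = proj₁ (eq (toℕ v) (Fin.toℕ<n v))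
    L≡ : ∀ (v : Vertex) → L′ (toℕ v) ≡ L (toℕ v)
    L≡ v = proj₂ (eq (toℕ v) (Fin.toℕ<n v))

  1+#E<W : suc #E < W
  1+#E<W = ≤-<-trans (≤-trans (s≤s (m≤m*n #E 3)) (≤-trans (m≤n+m (suc (#E * 3)) (3 + #V))
      (≤-reflexive (+-suc (3 + #V) (#E * 3))))) B<W

  open Hoare input B M W
  open Columns {#V} {#Σ}
  open Passes {#V} {#Σ} #E input B M W #V<M #E<M 1+#E<W vs length-vs
  open Sweeping {#V} {#Σ} #E input B M W #V<M #E<M 1+#E<W vs length-vs
  open Tracks

  Cleared : Store → Set
  Cleared σ = ∀ p → p < #V → arr σ fFirst′ p ≡ 0 × arr σ fEnd′ p ≡ 0

  run-sweepAll : ∀ {σ ℓ αs} → Constants σ → Stored σ sortedEdges → Cleared σ →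
    Represents {ℓ} Reach αs (arr σ fFirst) (arr σ fEnd) →
    count (sweepEdges (arr σ fFirst) (arr σ fEnd) sortedEdges) < W →
    Run sweepAll σ (6 + #E * 73) (λ τ → Tracks τ (sweepEdges (arr σ fFirst) (arr σ fEnd) sortedEdges))
  run-sweepAll {σ} {ℓ} {αs} con st cl rep final<W =
    exec 0<W >> λ { _ _ refl → exec 0<W >> λ { _ _ refl → exec 0<W >> λ { _ _ refl →
    consequence (≤-reflexive (cong (λ n → 3 + n * 73) (nE≡ con)))
      (λ _ _ q → q)
      (run-for-uniform (λ i τ → Tracks τ (sweepEdges F L (take i sortedEdges))) 69
        (tracks refl refl refl (λ p p< → proj₁ (cl p p<)) (λ p p< → proj₂ (cl p p<)))
        (λ i τ i<n fr tr → body i τ (subst (i <_) (trans (nE≡ con) (sym length-sorted)) i<n) fr tr)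
        (λ τ tr → finish τ (subst (λ es → Tracks τ (sweepEdges F L es))
          (take-all (env σ vE) sortedEdges (≤-reflexive (trans length-sorted (sym (nE≡ con))))) tr))) }}}
    where
    F = arr σ fFirst
    L = arr σ fEnd
    0<W : 0 < W
    0<W = ≤-<-trans z≤n B<W
    σ₁ : Store
    σ₁ = σ ⟦ vCount ≔ 0 ⟧ ⟦ vTop ≔ 0 ⟧ ⟦ vLetter ≔ 0 ⟧
    finish : ∀ {n m} τ → Tracks τ m → Tracks (τ ⟦ vI ≔ n ⟧) m
    finish τ (tracks c t l g e) = tracks c t l g e
    body : ∀ i τ → i < length sortedEdges → Frame (FOR vI < vE DO sweepEdge) σ₁ τ →
           Tracks τ (sweepEdges F L (take i sortedEdges)) →
           Run sweepEdge (τ ⟦ vI ≔ i ⟧) 69 (λ τ → Tracks τ (sweepEdges F L (take (suc i) sortedEdges)))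
    body i τ i<n fr tr with (u , v , a) , eq ← <⇒nth sortedEdges i<n =
      subst (λ m → Run sweepEdge (τ ⟦ vI ≔ i ⟧) 69 (λ τ → Tracks τ m)) (sym next≡)
        (run-sweepEdge (con′ con) refl
          (<-trans (subst (i <_) length-sorted i<n) #E<M)
          (fld fr fFirst refl) (fld fr fEnd refl)
          (st′ i eq) (finish τ tr)
          (subst (λ m → count m < W) next≡ (≤-<-trans (≤-trans
            (count-mono F L (take (suc i) sortedEdges) (drop (suc i) sortedEdges))
            (≤-reflexive (cong (λ es → count (sweepEdges F L es)) (take++drop≡id (suc i) sortedEdges))))
            final<W))
          (count-positive rep (take i sortedEdges)
            (subst (AllPairs _⊏_) (split-nth sortedEdges i eq) sorted-⊏)))
      where
      next≡ : sweepEdges F L (take (suc i) sortedEdges) ≡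
              nextEdge F L (sweepEdges F L (take i sortedEdges)) (u , v , a)
      next≡ = trans (cong (sweepEdges F L) (take-nth sortedEdges i eq))
        (sweepEdges-snoc F L (take i sortedEdges) (u , v , a))
      st′ : Stored τ sortedEdges
      st′ = stored fr refl refl refl st
      con′ : Constants σ → Constants (τ ⟦ vI ≔ i ⟧)
      con′ c = record
        { zero≡ = trans (var fr vZ refl) (zero≡ c)
        ; one≡ = trans (var fr v1 refl) (one≡ c)
        ; nV≡ = trans (var fr vV refl) (nV≡ c)
        ; nE≡ = trans (var fr vE refl) (nE≡ c)
        }

  roundsTime : ℕ
  roundsTime = 3 + k * (4 + ((6 + #E * 73) + (3 + #V * 40)))

  run-rounds : ∀ {σ} → Vertex → Constants σ → env σ vK ≡ k → Stored σ sortedEdges → Cleared σ →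
    (∀ p → p < #V → arr σ fFirst p ≡ 0 × arr σ fEnd p ≡ 1) →
    Run rounds σ roundsTime (λ τ → HasKmerCount G k (env τ vCount))
  run-rounds {σ} vertex con k≡ st cl start = consequence
    (≤-reflexive (cong (λ n → 3 + n * (4 + ((6 + #E * 73) + (3 + #V * 40)))) k≡)) (λ _ _ q → q)
    (run-for-uniform Inv ((6 + #E * 73) + (3 + #V * 40))
      (cl , [] ∷ [] , inj₁ refl ,
       represents-empty vertex (λ v → proj₁ (start _ (Fin.toℕ<n v))) (λ v → proj₂ (start _ (Fin.toℕ<n v))))
      (λ r τ r<n fr inv → body r τ (subst (r <_) k≡ r<n) fr inv)
      finish)
    where
    Inv : ℕ → Store → Set
    -- Before the first round `αs` consists of the empty word, but `vCount` has not been computed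
    -- yet; hence the exception for `r ≡ 0`, which `1 ≤ k` rules out at the end.
    Inv r τ = Cleared τ × ∃[ αs ] (r ≡ 0 ⊎ length αs ≡ env τ vCount) ×
              Represents {r} Reach αs (arr τ fFirst) (arr τ fEnd)
    finish : ∀ τ → Inv (env σ vK) τ → HasKmerCount G k (env τ vCount)
    finish τ inv with subst (λ r → Inv r τ) k≡ inv
    ... | _ , αs , inj₁ k≡0 , rep = ⊥-elim (<-irrefl (sym k≡0) 1≤k)
    ... | _ , αs , inj₂ len , rep = subst (HasKmerCount G k) len (hasKmerCount rep)
    body : ∀ r τ → r < k → Frame rounds σ τ → Inv r τ →
           Run (sweepAll ⨾ FOR vI < vV DO moveVertex) (τ ⟦ vR ≔ r ⟧)
               ((6 + #E * 73) + (3 + #V * 40)) (Inv (suc r))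
    body r τ r<k fr (cl , αs , _ , rep)
      with βs , rep′ , len ← represents-next sortedEdges sorted-⊏ ∈-sorted⁻ ∈-sorted⁺ rep =
      run-sweepAll con₁ st₁ cl rep
        -- The final count of this round is the number of distinct words of length `suc r`, and
        -- `suc r ≤ k`, so the hypothesis on word length applies before the scan is run.
        (subst (_< W) len (kmers< (suc r) (length βs) (s≤s z≤n) r<k (hasKmerCount rep′)))
      >> λ τ₁ fr₁ tr →
      consequence ≤-refl
        (λ τ₂ fr₂ q → (λ p p< → proj₂ (q p p<)) , βs ,
          inj₂ (trans len (trans (sym (count≡ tr)) (sym (var fr₂ vCount refl)))) ,
          represents-cong (λ p p< → proj₁ (q p p<)) rep′)
        (run-move (constants fr₁ refl refl refl refl con₁) (first≡ tr) (end≡ tr))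
      where
      con₁ : Constants (τ ⟦ vR ≔ r ⟧)
      con₁ = record
        { zero≡ = trans (var fr vZ refl) (zero≡ con)
        ; one≡ = trans (var fr v1 refl) (one≡ con)
        ; nV≡ = trans (var fr vV refl) (nV≡ con)
        ; nE≡ = trans (var fr vE refl) (nE≡ con)
        }
      st₁ : Stored (τ ⟦ vR ≔ r ⟧) sortedEdges
      st₁ = stored fr refl refl refl st

  run-loadVertices : ∀ {σ} → Constants σ → env σ v4 ≡ 4 →
    Run loadVertices σ (3 + #V * 12) Ordered
  run-loadVertices {σ} con four = consequence
    (≤-reflexive (cong (λ n → 3 + n * 12) (nV≡ con))) (λ _ _ q → q)
    (run-for-uniform (λ i τ → ∀ p {v} → p < i → nth vs p ≡ just v → arr τ fOrder p ≡ toℕ v) 8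
      (λ _ ())
      (λ i τ i<n fr inv → body i τ (subst (i <_) (nV≡ con) i<n) fr inv)
      (λ τ inv p eq → inv p (subst (p <_) (trans length-vs (sym (nV≡ con))) (nth⇒< vs p eq)) eq))
    where
    body : ∀ i τ → i < #V → Frame loadVertices σ τ →
      (∀ p {v} → p < i → nth vs p ≡ just v → arr τ fOrder p ≡ toℕ v) →
      Run (vT := v4 ⊕ vI ⨾ vX :=in vT ⨾ fOrder ⟨ vI ⟩:= vX) (τ ⟦ vI ≔ i ⟧) 8
        (λ τ → ∀ p {v} → p < suc i → nth vs p ≡ just v → arr τ fOrder p ≡ toℕ v)
    body i τ i<V fr inv = ran (<-trans t<B B<W , t<B , <-trans i<V #V<M) ≤-refl written
      where
      t≡ : env τ v4 + i ≡ 4 + i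
      t≡ = cong (_+ i) (trans (var fr v4 refl) four)
      t<B : env τ v4 + i < B
      t<B = <-≤-trans (subst (_< 4 + #V) (sym t≡) (+-monoʳ-< 4 i<V)) (m≤m+n (4 + #V) (#E * 3))
      written : ∀ p {v} → p < suc i → nth vs p ≡ just v →
                (arr τ fOrder [ i ≔ input (env τ v4 + i) ]) p ≡ toℕ v
      written p (s≤s p≤i) eq with p ≟ i
      ... | yes refl rewrite ≡ᵇ-refl p = trans (cong input t≡) (input-vertex p eq)
      ... | no p≢i rewrite ≢⇒≡ᵇ p≢i = inv p (≤∧≢⇒< p≤i p≢i) eq

  run-loadEdges : ∀ {σ} → Constants σ → env σ v4 ≡ 4 →
    Run loadEdges σ (1 + (3 + #E * 28)) (λ τ → Stored τ edges)
  run-loadEdges {σ} con four =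
    exec (subst (_< W) (sym start≡) (≤-<-trans (m≤m+n (4 + #V) (#E * 3)) B<W)) >> λ { _ _ refl →
    consequence (≤-reflexive (cong (λ n → 3 + n * 28) (nE≡ con))) (λ _ _ q → q)
    (run-for-uniform Inv 24
      (trans start≡ (sym (+-identityʳ (4 + #V))) , λ { zero () ; (suc _) () })
      (λ i τ i<n fr inv → body i τ (subst (i <_) (nE≡ con) i<n) fr inv)
      (λ τ (_ , h) → subst (Stored τ) (take-all (env σ vE) edges (≤-reflexive (sym (nE≡ con)))) h)) }
    where
    start≡ : env σ v4 + env σ vV ≡ 4 + #V
    start≡ = cong₂ _+_ four (nV≡ con)
    σ₁ : Store
    σ₁ = run (vQ := v4 ⊕ vV) σ
    loadEdge : Cmd
    loadEdge =
      vX :=in vQ ⨾ fS ⟨ vI ⟩:= vX ⨾ vQ := vQ ⊕ v1 ⨾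
      vX :=in vQ ⨾ fD ⟨ vI ⟩:= vX ⨾ vQ := vQ ⊕ v1 ⨾
      vX :=in vQ ⨾ fA ⟨ vI ⟩:= vX ⨾ vQ := vQ ⊕ v1
    Inv : ℕ → Store → Set
    Inv i τ = env τ vQ ≡ 4 + #V + i * 3 × Stored τ (take i edges)
    body : ∀ i τ → i < #E → Frame (FOR vI < vE DO loadEdge) σ₁ τ → Inv i τ →
           Run loadEdge (τ ⟦ vI ≔ i ⟧) 24 (Inv (suc i))
    body i τ i<E fr (q≡ , h) with (u , v , a) , eq ← <⇒nth edges i<E
      with u≡ , v≡ , a≡ ← input-edge i eq =
      ran ( subst (_< B) (sym q≡) (<-trans (n<1+n′ q) (<-trans (n<1+n′ (q + 1)) last<B)) , i<M
          , subst (_< W) (sym q₁) (<-trans (<-trans (n<1+n′ (q + 1)) last<B) B<W)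
          , subst (_< B) (sym q₁) (<-trans (n<1+n′ (q + 1)) last<B) , i<M
          , subst (_< W) (sym q₂) (<-trans last<B B<W)
          , subst (_< B) (sym q₂) last<B , i<M
          , subst (_< W) (sym q₃) (≤-<-trans (≤-trans (≤-reflexive (+-comm _ 1)) last<B) B<W))
          ≤-refl
          ( trans q₃ (regroup i #V)
          , subst (Stored (run loadEdge (τ ⟦ vI ≔ i ⟧))) (sym (take-nth edges i eq))
              (holdsAll-snoc {S = arr τ fS} {D = arr τ fD} {A = arr τ fA}
                (sym (trans (length-take i edges) (m≤n⇒m⊓n≡m (<⇒≤ i<E)))) h
                (trans (cong input q≡) u≡) (trans (cong input q₁) v≡) (trans (cong input q₂) a≡)))
      where
      q = 4 + #V + i * 3
      i<M = <-trans i<E #E<M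
      n<1+n′ : ∀ n → n < n + 1
      n<1+n′ n = ≤-reflexive (+-comm 1 n)
      one : env τ v1 ≡ 1
      one = trans (var fr v1 refl) (one≡ con)
      q₁ : env τ vQ + env τ v1 ≡ q + 1
      q₁ = cong₂ _+_ q≡ one
      q₂ : env τ vQ + env τ v1 + env τ v1 ≡ q + 1 + 1
      q₂ = cong₂ _+_ q₁ one
      q₃ : env τ vQ + env τ v1 + env τ v1 + env τ v1 ≡ q + 1 + 1 + 1
      q₃ = cong₂ _+_ q₂ one
      regroup : ∀ i n → 4 + n + i * 3 + 1 + 1 + 1 ≡ 4 + n + suc i * 3
      regroup = solve-∀
      last<B : q + 1 + 1 < B
      last<B = ≤-trans (≤-reflexive (trans (+-comm 1 (q + 1 + 1)) (regroup i #V)))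
        (+-monoʳ-≤ (4 + #V) (*-monoˡ-≤ 3 i<E))

  setupTime : ℕ
  setupTime = (3 + #V * 12) + ((1 + (3 + #E * 28)) +
    (passTime fS src (λ _ h → proj₁ h) + (passTime fD dst (λ _ h → proj₁ (proj₂ h)) + (3 + #V * 10))))

  run-setup : ∀ {σ} → Constants σ → env σ v4 ≡ 4 → (∀ p → arr σ fDegree p ≡ 0) →
    Run setup σ setupTime (λ τ → Stored τ sortedEdges × (∀ p → p < #V → arr τ fEnd p ≡ 1))
  run-setup {σ} con four deg0 =
    run-loadVertices con four >> λ σ₁ fr₁ ord₁ →
    let con₁ = constants fr₁ refl refl refl refl con in
    run-loadEdges con₁ (trans (var fr₁ v4 refl) four) >> λ σ₂ fr₂ st₂ →
    let con₂ = constants fr₂ refl refl refl refl con₁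
        ord₂ = λ p {v} eq → trans (cong-app (fld fr₂ fOrder refl) p) (ord₁ p {v} eq) in
    run-pass fS src (λ _ h → proj₁ h) con₂ ord₂ refl length-bySource st₂
      (λ p _ → trans (cong-app (trans (fld fr₂ fDegree refl) (fld fr₁ fDegree refl)) p) (deg0 p))
    >> λ σ₃ fr₃ (st₃ , deg₃) →
    let con₃ = constants fr₃ refl refl refl refl con₂
        ord₃ = λ p {v} eq → trans (cong-app (fld fr₃ fOrder refl) p) (ord₂ p {v} eq) in
    run-pass fD dst (λ _ h → proj₁ (proj₂ h)) con₃ ord₃ length-bySource length-sorted st₃ deg₃
    >> λ σ₄ fr₄ (st₄ , _) →
    let con₄ = constants fr₄ refl refl refl refl con₃ in
    consequence ≤-refl
      (λ τ fr₅ ones → stored fr₅ refl refl refl st₄ , λ p p< → trans (ones p p<) (one≡ con₄))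
      (run-fill fEnd v1 con₄ refl)

  mainTime : ℕ
  mainTime = 1 + (1 + (1 + (1 + (1 + (1 + (2 + (setupTime + roundsTime)))))))

  4<W : 4 < W
  4<W = ≤-<-trans (≤-trans (m≤m+n 4 #V) (m≤m+n (4 + #V) (#E * 3))) B<W

  in-range : ∀ {n} → n ≤ 3 → n < B
  in-range n≤3 = ≤-trans (s≤s n≤3) (≤-trans (m≤m+n 4 #V) (m≤m+n (4 + #V) (#E * 3)))

  readSizes-ok : Ok B M W readSizes emptyStore
  readSizes-ok = <-trans (s≤s (s≤s z≤n)) 4<W , 4<W , <-trans ≤-refl 4<W ,
    in-range z≤n , in-range (s≤s z≤n) , in-range ≤-refl

  run-main : Vertex → Run main emptyStore mainTime (λ τ → HasKmerCount G k (env τ vCount))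
  run-main vertex = exec readSizes-ok >> λ { _ _ refl →
    run-if
      (λ _ → run-setup con refl (λ _ → refl) >> λ σ₂ fr₂ (st , ones) →
        run-rounds vertex (constants fr₂ refl refl refl refl con) (trans (var fr₂ vK refl) input-k) st
          (λ p _ → cong-app (fld fr₂ fFirst′ refl) p , cong-app (fld fr₂ fEnd′ refl) p)
          (λ p p< → cong-app (fld fr₂ fFirst refl) p , ones p p<))
      (λ V≤0 → ⊥-elim (Fin.¬Fin0 (subst Fin (n≤0⇒n≡0 (subst (_≤ 0) input-V V≤0)) vertex))) }
    where
    con : Constants (run readSizes emptyStore)
    con = record { zero≡ = refl ; one≡ = refl ; nV≡ = input-V ; nE≡ = input-E }

  run-main-empty : #V ≡ 0 → Run main emptyStore 8 (λ τ → HasKmerCount G k (env τ vCount))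
  run-main-empty V≡0 = exec readSizes-ok >> λ { _ _ refl →
    run-if {t = 0}
      (λ 0<V → ⊥-elim (<-irrefl (sym V≡0) (subst (0 <_) input-V 0<V)))
      (λ _ → ran tt z≤n ([] , [] , (λ α → mk⇔ (λ ()) (λ (f , _) → ⊥-elim (Fin.¬Fin0 (subst Fin V≡0 (f Fin.zero))))) , refl)) }

-- The word RAM run

open Compiler #fields

-- Computes the length 4 + #V + 3 #E of the input into register 2.
prologue : List Instr
prologue =
  const 0 1 ∷ load 0 0 ∷ arith add 1 0 0 ∷ arith add 1 1 0 ∷
  const 0 0 ∷ load 0 0 ∷ arith add 1 1 0 ∷ const 0 4 ∷ arith add 2 1 0 ∷ []

epilogue : List Instr
epilogue = const 1 0 ∷ arith add 0 (3 + vCount) 1 ∷ []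

-- The offset 9 is the length of `prologue`.
program : Cmd → Program
program c = prologue ++ code 9 c ++ epilogue

module _ (c : Cmd) where

  private
    parts : CodeAt (program c) 9 (code 9 c) × CodeAt (program c) (length (code 9 c) + 9) epilogue
    parts = codeAt-++ (program c) 9 (code 9 c) epilogue (codeAt-suffix prologue (code 9 c ++ epilogue))

  code-at : CodeAt (program c) 9 (code 9 c)
  code-at = proj₁ parts

  epilogue-at : CodeAt (program c) (size c + 9) epilogue
  epilogue-at = subst (λ n → CodeAt (program c) (n + 9) epilogue) (length-code 9 c) (proj₂ parts)

  length-program : length (program c) ≡ 2 + (size c + 9)
  length-program = trans (length-++ prologue {code 9 c ++ epilogue})
    (trans (cong (9 +_) (trans (length-++ (code 9 c)) (cong (_+ 2) (length-code 9 c))))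
      (regroup (size c)))
    where
    regroup : ∀ n → 9 + (n + 2) ≡ 2 + (n + 9)
    regroup = solve-∀

nth-≥ : ∀ {A : Set} (xs : List A) {i} → length xs ≤ i → nth xs i ≡ nothing
nth-≥ []       {zero}  _         = refl
nth-≥ []       {suc i} _         = refl
nth-≥ (x ∷ xs) {suc i} (s≤s le) = nth-≥ xs le

module Encoding (G : LabeledGraph) where
  open LabeledGraph G

  triple : Vertex × Vertex × Label → List ℕ
  triple (u , v , a) = toℕ u ∷ toℕ v ∷ toℕ a ∷ []

  length-triples : ∀ es → length (concatMap triple es) ≡ length es * 3
  length-triples []       = refl
  length-triples (e ∷ es) = cong (3 +_) (length-triples es)

  nth-triples : ∀ es i {u v a} → nth es i ≡ just (u , v , a) →
    nth (concatMap triple es) (i * 3) ≡ just (toℕ u) ×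
    nth (concatMap triple es) (i * 3 + 1) ≡ just (toℕ v) ×
    nth (concatMap triple es) (i * 3 + 1 + 1) ≡ just (toℕ a)
  nth-triples (e ∷ es) zero    refl = refl , refl , refl
  nth-triples (e ∷ es) (suc i) eq   = nth-triples es i eq

-- Word size, memory layout and total running time

module Correctness (G : LabeledGraph) (det : Deterministic G)
  (_≺_ : Rel (LabeledGraph.Vertex G) 0ℓ) (wheeler : IsWheelerOrder G _≺_)
  (vs : List (LabeledGraph.Vertex G)) (enum : Enumerates G vs _≺_)
  (k : ℕ) (1≤k : 1 ≤ k) (w : ℕ) (suffice : WordsSuffice 32 w G k) where

  open LabeledGraph G
  open SortedEdges G _≺_ det wheeler vs enum using (length-vs)
  open Encoding G
  open WordRAM w

  W M : ℕ
  W = 2 ^ w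
  M = 1 + #V + #E

  instance
    W≢0 : NonZero W
    W≢0 = m^n≢0 2 w

  cells : List ℕ
  cells = encode G vs k

  input : ℕ → ℕ
  input i = wrap (fromMaybe 0 (nth cells i))

  private
    X : ℕ
    X = 1 + #V + #E + #Σ + k

  -- Of the 32 copies of the positive number `X` one buys strictness. The other 31 cover small
  -- numerals and the memory, 14 fields of `M` cells plus the input, where no coefficient exceeds
  -- 18.
  fits : ∀ {n} → n ≤ 31 * X → n < W
  fits n≤ = ≤-trans (s≤s n≤) (≤-trans (+-monoˡ-≤ (31 * X) (s≤s z≤n)) (proj₁ suffice))

  fits₁ : ∀ {n} → n ≤ X → n < W
  fits₁ n≤X = fits (≤-trans n≤X (m≤m+n X (30 * X)))

  V<W : #V < W
  V<W = fits₁ (≤-trans (n≤1+n #V) (≤-trans (m≤m+n _ #E) (≤-trans (m≤m+n _ #Σ) (m≤m+n _ k))))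
  E<W : #E < W
  E<W = fits₁ (≤-trans (m≤n+m #E (1 + #V)) (≤-trans (m≤m+n _ #Σ) (m≤m+n _ k)))
  Σ<W : #Σ < W
  Σ<W = fits₁ (≤-trans (m≤n+m #Σ (1 + #V + #E)) (m≤m+n _ k))
  k<W : k < W
  k<W = fits₁ (m≤n+m k _)

  numeral<W : ∀ {n} → n ≤ 31 → n < W
  numeral<W n≤ = fits (≤-trans n≤ (m≤m*n 31 X))

  B : ℕ
  B = inputLength G

  memory-bound : M * #fields + B ≤ 31 * X
  memory-bound = ≤-trans (m≤m+n _ (13 + #V * 16 + #E * 14 + (#Σ + k) * 31))
    (≤-reflexive (split #V #E #Σ k))
    where
    split : ∀ v e s k → (1 + v + e) * 14 + (4 + v + e * 3) + (13 + v * 16 + e * 14 + (s + k) * 31)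
            ≡ 31 * (1 + v + e + s + k)
    split = solve-∀

  B<W : B < W
  B<W = fits (≤-trans (m≤n+m B (M * #fields)) memory-bound)

  V<M : #V < M
  V<M = m≤m+n (1 + #V) #E
  E<M : #E < M
  E<M = s≤s (m≤n+m #E #V)

  kmers< : ∀ ℓ N → 1 ≤ ℓ → ℓ ≤ k → HasKmerCount G ℓ N → N < W
  kmers< ℓ zero    p q h = numeral<W z≤n
  kmers< ℓ (suc N) p q h = ≤-trans (m<m+n (suc N) {31 * suc N} (s≤s z≤n)) (proj₂ suffice ℓ (suc N) p q h)

  open Simulation w #fields B M input (λ i → m%n<n (fromMaybe 0 (nth cells i)) W)
    (<⇒≤ (fits memory-bound)) (numeral<W (m≤m+n 14 17)) (numeral<W (s≤s z≤n))

  read : ∀ i {n} → nth cells i ≡ just n → n < W → input i ≡ n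
  read i eq n<W = trans (cong (λ m → wrap (fromMaybe 0 m)) eq) (wrap-small n<W)

  length-cells : length cells ≡ B
  length-cells = cong (4 +_) (trans (length-++ (map toℕ vs))
    (cong₂ _+_ (trans (length-map toℕ vs) length-vs) (length-triples edges)))

  read-vertex : ReadsVertices input vs
  read-vertex i {v} eq = read (4 + i) (nth-++ˡ (map toℕ vs) i (nth-map toℕ vs i eq)) (<-trans (Fin.toℕ<n v) V<W)

  read-edge : ReadsEdges G input
  read-edge i {u} {v} {a} eq =
    let p₀ , p₁ , p₂ = nth-triples edges i eq in
    read (4 + #V + i * 3) (at-edge (i * 3) refl p₀) (<-trans (Fin.toℕ<n u) V<W) ,
    read (4 + #V + i * 3 + 1) (at-edge (i * 3 + 1) (+-assoc #V (i * 3) 1) p₁) (<-trans (Fin.toℕ<n v) V<W) ,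
    read (4 + #V + i * 3 + 1 + 1) (at-edge (i * 3 + 1 + 1) (trans (cong (_+ 1) (+-assoc #V (i * 3) 1)) (+-assoc #V (i * 3 + 1) 1)) p₂)
      (<-trans (Fin.toℕ<n a) Σ<W)
    where
    at-edge : ∀ j {j′ n} → j′ ≡ #V + j → nth (concatMap triple edges) j ≡ just n →
              nth (map toℕ vs ++ concatMap triple edges) j′ ≡ just n
    at-edge j refl eq = trans
      (cong (λ n → nth (map toℕ vs ++ concatMap triple edges) (n + j))
        (trans (sym length-vs) (sym (length-map toℕ vs))))
      (trans (nth-++ʳ (map toℕ vs) j) eq)

  input-V : input 0 ≡ #V
  input-V = read 0 refl V<W
  input-E : input 1 ≡ #E
  input-E = read 1 refl E<W
  input-k : input 3 ≡ k
  input-k = read 3 refl k<W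

  open Rounds G _≺_ det wheeler vs enum k 1≤k input M W
    V<M E<M B<W kmers< input-V input-E input-k read-vertex read-edge
    using (mainTime; run-main; run-main-empty)
  open Hoare input B M W using (Run; ran)
  open Semantics input using (run; cost; Ok)

  start-state : State
  start-state = initial cells

  prologue-steps : ∀ c → ∃[ s ] Steps (program c) start-state 9 s × State.pc s ≡ 9 × emptyStore ≈ s
  prologue-steps c = _ , refl ▸ refl ▸ refl ▸ refl ▸ refl ▸ refl ▸ refl ▸ refl ▸ refl ▸ done , refl , record
    { vars   = λ _ → refl
    ; vars<  = λ _ → 0<W
    ; base   = base≡
    ; ins    = λ _ _ → refl
    -- The cells of the fields lie beyond the input, so they are zero initially, as in `emptyStore`.
    ; cells  = λ f i _ _ → trans (cong (λ m → wrap (fromMaybe 0 m))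
        (nth-≥ cells (≤-trans (≤-reflexive length-cells) (m≤n+m B (i * #fields + f))))) (wrap-small 0<W)
    ; cells< = λ _ _ → 0<W
    }
    where
    0<W : 0 < W
    0<W = numeral<W z≤n
    e v : ℕ
    e = input (wrap 1)
    v = input (wrap 0)
    e≡ : e ≡ #E
    e≡ = trans (cong input (wrap-small (numeral<W (s≤s z≤n)))) input-E
    v≡ : v ≡ #V
    v≡ = trans (cong input (wrap-small 0<W)) input-V
    total : ∀ a b → a + a + a + b + 4 ≡ 4 + b + a * 3
    total = solve-∀
    sum≡ : e + e + e + v + 4 ≡ B
    sum≡ = trans (cong₂ (λ a b → a + a + a + b + 4) e≡ v≡) (total #E #V)
    sum< : ∀ {n} → n ≤ e + e + e + v + 4 → n < W
    sum< n≤ = ≤-<-trans (≤-trans n≤ (≤-reflexive sum≡)) B<W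
    base≡ : wrap (wrap (wrap (wrap (e + e) + e) + v) + wrap 4) ≡ B
    base≡ = begin
      wrap (wrap (wrap (wrap (e + e) + e) + v) + wrap 4)
        ≡⟨ cong₂ (λ a b → wrap (wrap (wrap (a + e) + v) + b))
             (wrap-small (sum< (≤-trans (m≤m+n (e + e) e) (≤-trans (m≤m+n _ v) (m≤m+n _ 4)))))
             (wrap-small (numeral<W (m≤m+n 4 27))) ⟩
      wrap (wrap (wrap (e + e + e) + v) + 4)
        ≡⟨ cong (λ a → wrap (wrap (a + v) + 4)) (wrap-small (sum< (≤-trans (m≤m+n _ v) (m≤m+n _ 4)))) ⟩
      wrap (wrap (e + e + e + v) + 4) ≡⟨ cong (λ a → wrap (a + 4)) (wrap-small (sum< (m≤m+n _ 4))) ⟩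
      wrap (e + e + e + v + 4)        ≡⟨ wrap-small (sum< ≤-refl) ⟩
      e + e + e + v + 4               ≡⟨ sum≡ ⟩
      B                               ∎
      where open ≡-Reasoning

  epilogue-steps : ∀ c {τ s} → τ ≈ s → State.pc s ≡ size c + 9 →
    ∃[ s′ ] Steps (program c) s 2 s′ × State.pc s′ ≡ 2 + (size c + 9) × State.reg s′ 0 ≡ env τ vCount
  epilogue-steps c {τ} {s} r e =
    execute (arith add 0 (3 + vCount) 1) (execute (const 1 0) s) ,
    at (proj₁ (epilogue-at c)) e (at (proj₁ (proj₂ (epilogue-at c))) (cong suc e) done) ,
    cong (2 +_) e ,
    trans (cong₂ (λ a b → wrap (a + b)) (_≈_.vars r vCount) (wrap-small (numeral<W z≤n)))
      (trans (cong wrap (+-identityʳ _)) (wrap-small (_≈_.vars< r vCount)))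

  halts : ∀ c → T (wf c) → Ok B M W c emptyStore →
    ∃[ s ] program c ⊢ start-state ⇓[ 9 + (cost c emptyStore + 2) ] s ×
           State.reg s 0 ≡ env (run c emptyStore) vCount
  halts c wf-c ok =
    let s₁ , q₁ , e₁ , r₁ = prologue-steps c
        s₂ , q₂ , e₂ , r₂ = simulate c wf-c (code-at c) e₁ ok r₁
        s₃ , q₃ , e₃ , eq = epilogue-steps c r₂ e₂
    in s₃ ,
       steps⇒⇓ (q₁ ⊙ (q₂ ⊙ q₃)) (subst (λ n → nth (program c) n ≡ nothing)
         (trans (length-program c) (sym e₃)) (nth-beyond (program c))) ,
       eq

  halts-with-count : ∀ c {t} → T (wf c) →
    Run c emptyStore t (λ τ → HasKmerCount G k (env τ vCount)) →
    CountsKmersWithin (11 + t) w (program c) G vs k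
  halts-with-count c wf-c (ran ok time post) =
    let s , steps , eq = halts c wf-c ok in
    9 + (cost c emptyStore + 2) , s ,
    ≤-trans (≤-reflexive (cong (9 +_) (+-comm (cost c emptyStore) 2))) (+-monoʳ-≤ 11 time) ,
    steps , subst (HasKmerCount G k) (sym eq) post

  -- With `#V` and `k` positive, `Y` is at least 1, `k` and `#V + #E`. So the constant, the part
  -- linear in the graph, the part linear in `k` and the products are each at most a multiple of
  -- `Y`; the factors 60, 286, 13 and 73 add up to 432.
  time-bound : 1 ≤ #V →
    11 + mainTime ≤ 432 * (1 ⊔ (#V + #E) * k)
  time-bound 1≤V = begin
    11 + mainTime
      ≡⟨ expand #V #E k ⟩
    60 + (#V * 92 + #E * 286) + k * 13 + (#V * k * 40 + #E * k * 73)
      ≤⟨ +-mono-≤ (+-mono-≤ (+-mono-≤ (*-monoʳ-≤ 60 1≤Y) linear) (*-monoˡ-≤ 13 k≤Y)) bilinear ⟩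
    60 * Y + Y * 286 + Y * 13 + Y * 73
      ≡⟨ collect-terms Y ⟩
    432 * Y
      ≤⟨ *-monoʳ-≤ 432 (m≤n⊔m 1 Y) ⟩
    432 * (1 ⊔ Y) ∎
    where
    open ≤-Reasoning
    Y : ℕ
    Y = (#V + #E) * k
    expand : ∀ v e k →
      11 + (8 + (((3 + v * 12) + ((1 + (3 + e * 28)) +
        (((1 + (3 + e * 42)) + ((1 + (3 + (v * 25 + e * 47))) + ((3 + e * 40) + (3 + v * 10)))) +
        (((1 + (3 + e * 42)) + ((1 + (3 + (v * 25 + e * 47))) + ((3 + e * 40) + (3 + v * 10)))) +
         (3 + v * 10))))) + (3 + k * (4 + ((6 + e * 73) + (3 + v * 40))))))
      ≡ 60 + (v * 92 + e * 286) + k * 13 + (v * k * 40 + e * k * 73)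
    expand = solve-∀
    collect-terms : ∀ y → 60 * y + y * 286 + y * 13 + y * 73 ≡ 432 * y
    collect-terms = solve-∀
    instance
      k≢0 : NonZero k
      k≢0 = >-nonZero 1≤k
      V+E≢0 : NonZero (#V + #E)
      V+E≢0 = >-nonZero (≤-trans 1≤V (m≤m+n #V #E))
    V+E≤Y : #V + #E ≤ Y
    V+E≤Y = m≤m*n (#V + #E) k
    k≤Y : k ≤ Y
    k≤Y = m≤n*m k (#V + #E)
    1≤Y : 1 ≤ Y
    1≤Y = ≤-trans 1≤k k≤Y
    linear : #V * 92 + #E * 286 ≤ Y * 286
    linear = begin
      #V * 92 + #E * 286  ≤⟨ +-monoˡ-≤ (#E * 286) (*-monoʳ-≤ #V (m≤m+n 92 194)) ⟩
      #V * 286 + #E * 286 ≡⟨ *-distribʳ-+ 286 #V #E ⟨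
      (#V + #E) * 286     ≤⟨ *-monoˡ-≤ 286 V+E≤Y ⟩
      Y * 286             ∎
    bilinear : #V * k * 40 + #E * k * 73 ≤ Y * 73
    bilinear = begin
      #V * k * 40 + #E * k * 73 ≤⟨ +-monoˡ-≤ (#E * k * 73) (*-monoʳ-≤ (#V * k) (m≤m+n 40 33)) ⟩
      #V * k * 73 + #E * k * 73 ≡⟨ *-distribʳ-+ 73 (#V * k) (#E * k) ⟨
      (#V * k + #E * k) * 73    ≡⟨ cong (_* 73) (*-distribʳ-+ k #V #E) ⟨
      Y * 73                    ∎

  within : ∀ {T T′ P} → T ≤ T′ → CountsKmersWithin T w P G vs k → CountsKmersWithin T′ w P G vs k
  within T≤T′ (t , s , t≤T , rest) = t , s , ≤-trans t≤T T≤T′ , rest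

  counts : CountsKmersWithin (432 * (1 ⊔ (#V + #E) * k)) w (program main) G vs k
  counts with #V ≟ 0
  -- Without vertices the product may vanish, and the 19 steps are paid for by the 1 in the maximum.
  ... | yes V≡0 = within (≤-trans (m≤m+n 19 413) (*-monoʳ-≤ 432 (m≤m⊔n 1 ((#V + #E) * k))))
    (halts-with-count main tt (run-main-empty V≡0))
  ... | no V≢0 = within (time-bound (n≢0⇒n>0 V≢0))
    (halts-with-count main tt (run-main
      (Fin.fromℕ< (n≢0⇒n>0 V≢0))))

theorem9 : ∃[ P ] ∃[ C ] ∃[ D ]
    ((W : LabeledGraph) → let open LabeledGraph W in
    Deterministic W →
    (_≺_ : Rel Vertex 0ℓ) → IsWheelerOrder W _≺_ →
    (vs : List Vertex) → Enumerates W vs _≺_ →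
    (k : ℕ) → 1 ≤ k →
    (w : ℕ) → WordsSuffice D w W k →
    CountsKmersWithin (C * (1 ⊔ (#V + #E) * k)) w P W vs k)
theorem9 = program main , 432 , 32 , λ W det _≺_ wheeler vs enum k 1≤k w suffice →
  Correctness.counts W det _≺_ wheeler vs enum k 1≤k w suffice
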